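{- Let $G=(V,E)$ be a finite simple, unweighted, undirected graph with adjacency matrix $g$ and degrees $k_i$, and use the notation, summation conventions and graphlets defined in the context. Then the following identities hold. (a) $|M_{75}^{(5)}| = \sum_{i:k_{i} > 3}\binom{k_{i}}{4} = \frac{1}{24} \sum_{i:k_{i} > 3}k_{i} (k_{i}-1)(k_{i}-2)(k_{i}-3)$. (b) $|M_{77}^{(5)}| = \sum_{(i,j)^{\star} \in E,\ k_{i} > 2} \binom{k_{i}-1}{2}(k_{j}-1) - 2 |M_{15}^{(4)}| = \frac{1}{2}\sum_{(i,j)^{\star} \in E,\ k_{i} > 2}(k_{i} - 1)(k_{i} - 2)(k_{j} - 1) - 2 |M_{15}^{(4)}|$. (c) $|M_{79}^{(5)}| = \frac{1}{2}\sum_{i:k_{i} > 3}(g^{3})_{ii} \binom{k_{i}-2}{2} = \frac{1}{4} \sum_{i:k_{i}>3}(g^{3})_{ii}(k_{i}-2)(k_{i}-3)$. (d) $|M_{86}^{(5)}| = \frac{1}{2}\sum_{i,j:i \neq j} (g^{4})_{ij} - 2|M_{3}^{(3)}| - 9 |M_{7}^{(3)}| - 3 |M_{11}^{(4)}| - 2 |M_{13}^{(4)}| - 2 |M_{15}^{(4)}|$. (e) $|M_{87}^{(5)}| = \sum_{(i, j) \in E,\ k_{i} > 2,\ k_{j} > 2} (g^{2})_{ij} (k_{i}-2)(k_{j}-2) - 2 |M_{31}^{(4)}|$. (f) $|M_{94}^{(5)}| = \sum_{i,j:i \neq j,\ k_{i} > 2} \binom{(g^{2})_{ij}}{2}(k_{i}-2)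 - 2 |M_{31}^{(4)}| = \frac{1}{2} \sum_{i,j:i \neq j,\ k_{i} > 2} (g^{2})_{ij}((g^{2})_{ij} - 1)(k_{i}-2) - 2 |M_{31}^{(4)}|$. (g) $|M_{95}^{(5)}| = \sum_{i,j:i \neq j,\ k_{i} > 3} \binom{(g^{2})_{ij}(g)_{ij}}{2}(k_{i}-3) = \frac{1}{2} \sum_{(i,j)^{\star} \in E,\ k_{i} > 3} (g^{2})_{ij}((g^{2})_{ij} - 1)(k_{i}-3)$. (h) $|M_{117}^{(5)}| = \frac{1}{2} \sum_{(i, j)^{\star} \in E} (g^{3})_{ii} (k_{j}-1) - 6 |M_{7}^{(3)}| - 2 |M_{15}^{(4)}| - 4 |M_{31}^{(4)}|$. (i) $|M_{119}^{(5)}| = \sum_{(i, j) \in E,\ k_{i} > 2,\ k_{j} > 2} ((g^{2})_{ij} - 1) \sum_{r \in S(i, j),\ k_{r} > 1}(k_{r} - 2) - 12 |M_{63}^{(4)}|$. (j) $|M_{127}^{(5)}| = \sum_{i:k_{i} > 3}|M_{7}^{(3)}(g_{ -i})|\,(k_{i} - 3) = \frac{1}{6} \sum_{i:k_{i} > 3} \operatorname{tr}(g_{ -i}^{3}) (k_{i} - 3)$. (k) $|M_{222}^{(5)}| = \frac{1}{2} \sum_{i,j:i \neq j,\ k_{i}>2,\ k_{j}>2}\binom{(g^{2})_{ij}}{3} = \frac{1}{12} \sum_{i,j:i \neq j,\ k_{i}>2,\ k_{j}>2} (g^{2})_{ij}((g^{2})_{ij}-1)((g^{2})_{ij}-2)$.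 (l) $|M_{223}^{(5)}| = \frac{1}{2} \sum_{i,j:i \neq j,\ k_{i}>3,\ k_{j}>3}\binom{(g^{2})_{ij}(g)_{ij}}{3} = \frac{1}{6}\sum_{(i,j) \in E,\ k_{i}>3,\ k_{j}>3} (g^{2})_{ij}((g^{2})_{ij}-1)((g^{2})_{ij}-2)$. (m) $|M_{235}^{(5)}| = \sum_{i:k_{i}>2}\binom{\frac{1}{2}(g^{3})_{ii}}{2} - 2 |M_{31}^{(4)}| = \frac{1}{8} \sum_{i:k_{i}>2}(g^{3})_{ii}((g^{3})_{ii}-2) - 2 |M_{31}^{(4)}|$. (n) $|M_{236}^{(5)}| = \frac{1}{10}\left(\operatorname{tr}(g^{5}) - 30 |M_{7}^{(3)}| - 10 |M_{15}^{(4)}|\right)$. (o) $|M_{237}^{(5)}| = \sum_{(i,j) \in E} (g^{3})_{ij}(g^{2})_{ij} - 9 |M_{7}^{(3)}| - 2 |M_{15}^{(4)}| - 4 |M_{31}^{(4)}|$. (p) $|M_{239}^{(5)}| = \sum_{i:k_{i} > 3}|M_{13}^{(4)}(g_{ -i})| = \sum_{i:k_{i}>3}\Big(\sum_{\{j, r\} \in E(\Gamma_{G}(i))}(d_i(j)-1)(d_i(r)-1) - 3 |M_{7}^{(3)}(g_{ -i})|\Big)$. (q) $|M_{254}^{(5)}| = \sum_{(i, j) \in E,\ k_{i} > 2,\ k_{j} > 2} \ \sum_{\{r, q\} \subseteq S(i, j),\ r \neq q,\ k_{r} > 2,\ k_{q} > 2} ((g^{2})_{rq} - 2)$, where the inner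 sum is over unordered pairs $\{r,q\}$. (r) $|M_{255}^{(5)}| = \frac{1}{2}\sum_{i:k_{i} > 3}|M_{15}^{(4)}(g_{ -i})| = \frac{1}{4} \sum_{i:k_{i}>3} \ \sum_{r \in \Gamma_G(i):\ d_i(r) > 2} (g_{ -i}^{3})_{rr}(d_i(r)-2)$. (s) $|M_{507}^{(5)}| = \sum_{i:k_{i} > 3}|M_{30}^{(4)}(g_{ -i})| = \frac{1}{8} \sum_{i:k_{i}>3} \left(\operatorname{tr}(g_{ -i}^{4}) - 2 m(g_{ -i}) - 4 |M_{3}^{(3)}(g_{ -i})|\right)$. (t) $|M_{511}^{(5)}| = \frac{1}{3}\sum_{i:k_{i} > 3}|M_{31}^{(4)}(g_{ -i})| = \frac{1}{6} \sum_{i:k_{i} > 3}\ \sum_{r,s \in \Gamma_G(i):\ r \neq s,\ d_i(r) > 2,\ d_i(s) > 2}\binom{(g_{ -i}^{2})_{rs} (g_{ -i})_{rs}}{2}$. (u) $|M_{1023}^{(5)}| = \frac{1}{5} \sum_{i:k_{i} > 3} |M_{63}^{(4)} (g_{ -i}) | = \frac{1}{120} \sum_{i:k_{i} > 3} \ \sum_{j \in \Gamma_{G}(i),\ k_{j} > 2}\operatorname{tr}\big(((g_{ -i})_{ -j})^{3}\big)$.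
   Context: $G=(V,E)$ is a finite simple undirected unweighted graph; $g$ is its adjacency matrix ($(g)_{ij}=1$ if $\{i,j\}\in E$, else $0$; $(g)_{ii}=0$); $k_i=\sum_j (g)_{ij}$ is the degree of $i$; $(g^r)_{ij}$ is the $(i,j)$ entry of the $r$-th matrix power; $\operatorname{tr}$ is the trace. $\Gamma_G(i)$ is the set of neighbours of $i$, and $S(i,j)=\Gamma_G(i)\cap\Gamma_G(j)$ (so $|S(i,j)|=(g^2)_{ij}$ for $i\ne j$). For a vertex $i$, $g_{ -i}$ denotes the adjacency matrix (rows/columns indexed by $\Gamma_G(i)$) of the induced subgraph $G[\Gamma_G(i)]$; $E(\Gamma_G(i))$ is its edge set, $m(g_{ -i})$ its number of edges, and $d_i(r)$ the degree of $r$ in $G[\Gamma_G(i)]$; for $j\in\Gamma_G(i)$, $(g_{ -i})_{ -j}$ is the adjacency matrix of $G[\Gamma_G(i)\cap\Gamma_G(j)]$. Summation conventions: $\sum_{i,j:i\neq j}$ is over ordered pairs of distinct vertices; $\sum_{(i,j)\in E}$ is over edges, each edge counted once; $\sum_{(i,j)^\star\in E}$ is over ordered pairs $(i,j)$ with $\{i,j\}\in E$ (each edge in both orientations); further conditions written under a sum restrict the terms. $\binom{x}{r}=x(x-1)\cdots(x-r+1)/r!$. For a graph $H$ with adjacency matrix $h$ and a fixed graph $F$, $|F(h)|$ is the number of (not necessarily induced) subgraphs of $H$ (a vertex subset together with an edge subset) isomorphic to $F$; $|F|$ means $|F(g)|$. Graphlets (edge sets on vertex set $\{1,\dots,b\}$):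 $M_3^{(3)}$: $\{13,23\}$; $M_7^{(3)}$: triangle; $M_{11}^{(4)}$: $\{14,24,34\}$; $M_{13}^{(4)}$: $\{14,34,23\}$; $M_{15}^{(4)}$: $\{14,23,24,34\}$; $M_{30}^{(4)}$: $\{13,14,23,24\}$; $M_{31}^{(4)}$: $\{13,14,23,24,34\}$; $M_{63}^{(4)}$: $K_4$. $M_{75}^{(5)}$: $\{15,25,35,45\}$; $M_{77}^{(5)}$: $\{15,25,35,34\}$; $M_{79}^{(5)}$: $\{15,25,34,35,45\}$; $M_{86}^{(5)}$: $\{15,24,34,35\}$; $M_{87}^{(5)}$: $\{15,24,34,35,45\}$; $M_{94}^{(5)}$: $\{15,24,25,34,35\}$; $M_{95}^{(5)}$: $\{15,24,25,34,35,45\}$; $M_{117}^{(5)}$: $\{15,23,24,34,45\}$; $M_{119}^{(5)}$: $\{15,23,24,34,35,45\}$; $M_{127}^{(5)}$: $\{15,23,24,25,34,35,45\}$; $M_{222}^{(5)}$: $\{14,15,24,25,34,35\}$; $M_{223}^{(5)}$: $\{14,15,24,25,34,35,45\}$; $M_{235}^{(5)}$: $\{14,15,23,25,35,45\}$; $M_{236}^{(5)}$: $\{14,15,23,25,34\}$; $M_{237}^{(5)}$: $\{14,15,23,25,34,45\}$; $M_{239}^{(5)}$: $\{14,15,23,25,34,35,45\}$; $M_{254}^{(5)}$: $\{14,15,23,24,25,34,35\}$; $M_{255}^{(5)}$: $\{14,15,23,24,25,34,35,45\}$; $M_{507}^{(5)}$: $\{13,14,15,23,24,25,35,45\}$; $M_{511}^{(5)}$: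 all pairs except $12$; $M_{1023}^{(5)}$: $K_5$. -}

module Defs where

open import Data.Bool using (Bool; true; false; _∧_; not; if_then_else_; T)
open import Data.Bool.Properties using () renaming (_≟_ to _≟B_)
open import Data.Nat as ℕ using (ℕ; zero; suc; _<ᵇ_; _≤?_; _<?_)
open import Data.Nat.Properties using () renaming (_≟_ to _≟ℕ_)
open import Data.Fin as Fin using (Fin; fromℕ<)
open import Data.Fin.Properties using () renaming (_≟_ to _≟F_)
open import Data.List as List using (List; []; _∷_; length; allFin; filter; map; concatMap; deduplicate; foldr)
open import Data.Bool.ListAction using (any; all)
open import Data.Vec as Vec using (Vec; []; _∷_; lookup; tabulate)
import Data.Vec.Properties as VecP
import Data.Nat.Properties as NP
import Data.Product.Properties as ProdP
open import Data.Product using (_×_; _,_; proj₁; proj₂)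
open import Data.Integer using (ℤ; +_)
open import Data.Rational using (ℚ; _/_; _+_; _*_; _-_; 0ℚ; 1ℚ)
open import Relation.Nullary using (does)
open import Relation.Nullary.Decidable using (True; toWitness)
open import Relation.Binary.PropositionalEquality using (_≡_)

record Graph (n : ℕ) : Set where
  field
    adj    : Fin n → Fin n → Bool
    sym    : ∀ i j → adj i j ≡ adj j i
    irrefl : ∀ i → adj i i ≡ false
open Graph public

sumℕ : ∀ {n} → (Fin n → ℕ) → ℕ
sumℕ {n} f = foldr ℕ._+_ 0 (map f (allFin n))

g : ∀ {n} → Graph n → Fin n → Fin n → ℕ
g G i j = if adj G i j then 1 else 0

deg : ∀ {n} → Graph n → Fin n → ℕ
deg G i = sumℕ (λ j → g G i j)

idM : ∀ {n} → Fin n → Fin n → ℕ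
idM i j = if does (i ≟F j) then 1 else 0

pw : ∀ {n} → Graph n → ℕ → Fin n → Fin n → ℕ
pw G zero    i j = idM i j
pw G (suc r) i j = sumℕ (λ l → pw G r i l ℕ.* g G l j)

tr : ∀ {n} → Graph n → ℕ → ℕ
tr G r = sumℕ (λ i → pw G r i i)

edges# : ∀ {n} → Graph n → ℕ
edges# G = sumℕ (λ i → sumℕ (λ j → if (Fin.toℕ i <ᵇ Fin.toℕ j) then g G i j else 0))

ℚ[_] : ℕ → ℚ
ℚ[ m ] = + m / 1

_÷ℕ_ : ℚ → (d : ℕ) → .{{_ : ℕ.NonZero d}} → ℚ
x ÷ℕ d = x * (+ 1 / d)

[_]?_ : Bool → ℚ → ℚ
[ b ]? x = if b then x else 0ℚ

Σv : ∀ {n} → (Fin n → ℚ) → ℚ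
Σv {n} f = foldr _+_ 0ℚ (map f (allFin n))

_≢ᵇ_ : ∀ {n} → Fin n → Fin n → Bool
i ≢ᵇ j = not (does (i ≟F j))

_<ᶠ_ : ∀ {n} → Fin n → Fin n → Bool
i <ᶠ j = Fin.toℕ i <ᵇ Fin.toℕ j

Σ≠ : ∀ {n} → (Fin n → Fin n → ℚ) → ℚ
Σ≠ f = Σv (λ i → Σv (λ j → [ i ≢ᵇ j ]? f i j))

ΣE : ∀ {n} → Graph n → (Fin n → Fin n → ℚ) → ℚ
ΣE G f = Σv (λ i → Σv (λ j → [ adj G i j ∧ (i <ᶠ j) ]? f i j))

ΣE⋆ : ∀ {n} → Graph n → (Fin n → Fin n → ℚ) → ℚ
ΣE⋆ G f = Σv (λ i → Σv (λ j → [ adj G i j ]? f i j))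

falling : ℚ → ℕ → ℚ
falling x zero    = 1ℚ
falling x (suc r) = falling x r * (x - ℚ[ r ])

fact : ℕ → ℕ
fact zero    = 1
fact (suc r) = suc r ℕ.* fact r

fact-nz : ∀ r → ℕ.NonZero (fact r)
fact-nz zero    = _
fact-nz (suc r) = NP.m*n≢0 (suc r) (fact r) {{_}} {{fact-nz r}}

binom : ℚ → ℕ → ℚ
binom x r = falling x r * (_/_ (+ 1) (fact r) {{fact-nz r}})

sel : ∀ {n} → (Fin n → Bool) → List (Fin n)
sel {n} P = filter (λ r → T? (P r)) (allFin n)
  where open import Data.Bool.Properties using (T?)

induce : ∀ {n} → (G : Graph n) → (P : Fin n → Bool) → Graph (length (sel P))
induce G P = record
  { adj    = λ a b → adj G (List.lookup (sel P) a) (List.lookup (sel P) b)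
  ; sym    = λ a b → sym G (List.lookup (sel P) a) (List.lookup (sel P) b)
  ; irrefl = λ a → irrefl G (List.lookup (sel P) a)
  }

nbhd : ∀ {n} → (G : Graph n) → (i : Fin n) → Graph (length (sel (adj G i)))
nbhd G i = induce G (adj G i)

-- G[Γ_G(i) ∩ Γ_G(j)]  (the graph (g_{-i})_{-j} of the paper)
common : ∀ {n} → (G : Graph n) → (i j : Fin n) →
         Graph (length (sel (λ r → adj G i r ∧ adj G j r)))
common G i j = induce G (λ r → adj G i r ∧ adj G j r)

record Graphlet : Set where
  constructor graphlet
  field
    size  : ℕ
    links : List (Fin size × Fin size)
open Graphlet public

-- 1-based vertex labels a ∈ {1,…,b}, as in the paper
lbl : ∀ {b} (a : ℕ) → {p : True (1 ≤? a)} → {q : True (a ≤? b)} → Fin b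
lbl zero    {()}
lbl (suc a) {q = q} = fromℕ< (toWitness q)

_─_ : ∀ {b} (a c : ℕ) → {pa : True (1 ≤? a)} → {qa : True (a ≤? b)}
      → {pc : True (1 ≤? c)} → {qc : True (c ≤? b)} → Fin b × Fin b
(a ─ c) {pa} {qa} {pc} {qc} = lbl a {pa} {qa} , lbl c {pc} {qc}
infix 5 _─_

allMaps : ∀ n b → List (Vec (Fin n) b)
allMaps n zero    = [] ∷ []
allMaps n (suc b) = concatMap (λ x → map (x ∷_) (allMaps n b)) (allFin n)

_==F_ : ∀ {n} → Fin n → Fin n → Bool
i ==F j = does (i ≟F j)

injectiveᵇ : ∀ {n b} → Vec (Fin n) b → Bool
injectiveᵇ {b = b} φ =
  all (λ a → all (λ c → (a ==F c) Data.Bool.∨ not (lookup φ a ==F lookup φ c)) (allFin b)) (allFin b)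
  where import Data.Bool

homᵇ : ∀ {n} (G : Graph n) (F : Graphlet) → Vec (Fin n) (size F) → Bool
homᵇ G F φ = all (λ e → adj G (lookup φ (proj₁ e)) (lookup φ (proj₂ e))) (links F)

-- a subgraph of a graph on Fin n: (vertex subset, edge subset) given by
-- characteristic vectors; the edge subset is stored as a symmetric 0/1 matrix
Subgraph : ℕ → Set
Subgraph n = Vec Bool n × Vec (Vec Bool n) n

image : ∀ {n} (F : Graphlet) → Vec (Fin n) (size F) → Subgraph n
image F φ =
  ( tabulate (λ u → any (λ a → lookup φ a ==F u) (allFin (size F)))
  , tabulate (λ u → tabulate (λ v → any (λ e →
        ((lookup φ (proj₁ e) ==F u) ∧ (lookup φ (proj₂ e) ==F v)) Data.Bool.∨
        ((lookup φ (proj₁ e) ==F v) ∧ (lookup φ (proj₂ e) ==F u))) (links F))) )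
  where import Data.Bool

_≟S_ : ∀ {n} (x y : Subgraph n) → Relation.Nullary.Dec (x ≡ y)
_≟S_ = ProdP.≡-dec (VecP.≡-dec _≟B_) (VecP.≡-dec (VecP.≡-dec _≟B_))
  where import Relation.Nullary

-- |F(h)| : the number of (not necessarily induced) subgraphs of G isomorphic
-- to F.  The subgraphs isomorphic to F are exactly the images (φ(V(F)), φ(E(F)))
-- of the injective homomorphisms φ : F → G; we count the distinct such images.
count : ∀ {n} → Graph n → Graphlet → ℕ
count {n} G F =
  length (deduplicate _≟S_
    (map (image F) (filter (λ φ → T? (injectiveᵇ φ ∧ homᵇ G F φ)) (allMaps n (size F)))))
  where open import Data.Bool.Properties using (T?)

#_⟨_⟩ : ∀ {n} → Graphlet → Graph n → ℚ
# F ⟨ G ⟩ = ℚ[ count G F ]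

M3-3 M7-3 : Graphlet
M3-3 = graphlet 3 ((1 ─ 3) ∷ (2 ─ 3) ∷ [])
M7-3 = graphlet 3 ((1 ─ 2) ∷ (1 ─ 3) ∷ (2 ─ 3) ∷ [])

M11-4 M13-4 M15-4 M30-4 M31-4 M63-4 : Graphlet
M11-4 = graphlet 4 ((1 ─ 4) ∷ (2 ─ 4) ∷ (3 ─ 4) ∷ [])
M13-4 = graphlet 4 ((1 ─ 4) ∷ (3 ─ 4) ∷ (2 ─ 3) ∷ [])
M15-4 = graphlet 4 ((1 ─ 4) ∷ (2 ─ 3) ∷ (2 ─ 4) ∷ (3 ─ 4) ∷ [])
M30-4 = graphlet 4 ((1 ─ 3) ∷ (1 ─ 4) ∷ (2 ─ 3) ∷ (2 ─ 4) ∷ [])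
M31-4 = graphlet 4 ((1 ─ 3) ∷ (1 ─ 4) ∷ (2 ─ 3) ∷ (2 ─ 4) ∷ (3 ─ 4) ∷ [])
M63-4 = graphlet 4 ((1 ─ 2) ∷ (1 ─ 3) ∷ (1 ─ 4) ∷ (2 ─ 3) ∷ (2 ─ 4) ∷ (3 ─ 4) ∷ [])

M75-5 M77-5 M79-5 M86-5 M87-5 M94-5 M95-5 M117-5 M119-5 M127-5 : Graphlet
M75-5  = graphlet 5 ((1 ─ 5) ∷ (2 ─ 5) ∷ (3 ─ 5) ∷ (4 ─ 5) ∷ [])
M77-5  = graphlet 5 ((1 ─ 5) ∷ (2 ─ 5) ∷ (3 ─ 5) ∷ (3 ─ 4) ∷ [])
M79-5  = graphlet 5 ((1 ─ 5) ∷ (2 ─ 5) ∷ (3 ─ 4) ∷ (3 ─ 5) ∷ (4 ─ 5) ∷ [])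
M86-5  = graphlet 5 ((1 ─ 5) ∷ (2 ─ 4) ∷ (3 ─ 4) ∷ (3 ─ 5) ∷ [])
M87-5  = graphlet 5 ((1 ─ 5) ∷ (2 ─ 4) ∷ (3 ─ 4) ∷ (3 ─ 5) ∷ (4 ─ 5) ∷ [])
M94-5  = graphlet 5 ((1 ─ 5) ∷ (2 ─ 4) ∷ (2 ─ 5) ∷ (3 ─ 4) ∷ (3 ─ 5) ∷ [])
M95-5  = graphlet 5 ((1 ─ 5) ∷ (2 ─ 4) ∷ (2 ─ 5) ∷ (3 ─ 4) ∷ (3 ─ 5) ∷ (4 ─ 5) ∷ [])
M117-5 = graphlet 5 ((1 ─ 5) ∷ (2 ─ 3) ∷ (2 ─ 4) ∷ (3 ─ 4) ∷ (4 ─ 5) ∷ [])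
M119-5 = graphlet 5 ((1 ─ 5) ∷ (2 ─ 3) ∷ (2 ─ 4) ∷ (3 ─ 4) ∷ (3 ─ 5) ∷ (4 ─ 5) ∷ [])
M127-5 = graphlet 5 ((1 ─ 5) ∷ (2 ─ 3) ∷ (2 ─ 4) ∷ (2 ─ 5) ∷ (3 ─ 4) ∷ (3 ─ 5) ∷ (4 ─ 5) ∷ [])

M222-5 M223-5 M235-5 M236-5 M237-5 M239-5 M254-5 M255-5 M507-5 M511-5 M1023-5 : Graphlet
M222-5  = graphlet 5 ((1 ─ 4) ∷ (1 ─ 5) ∷ (2 ─ 4) ∷ (2 ─ 5) ∷ (3 ─ 4) ∷ (3 ─ 5) ∷ [])
M223-5  = graphlet 5 ((1 ─ 4) ∷ (1 ─ 5) ∷ (2 ─ 4) ∷ (2 ─ 5) ∷ (3 ─ 4) ∷ (3 ─ 5) ∷ (4 ─ 5) ∷ [])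
M235-5  = graphlet 5 ((1 ─ 4) ∷ (1 ─ 5) ∷ (2 ─ 3) ∷ (2 ─ 5) ∷ (3 ─ 5) ∷ (4 ─ 5) ∷ [])
M236-5  = graphlet 5 ((1 ─ 4) ∷ (1 ─ 5) ∷ (2 ─ 3) ∷ (2 ─ 5) ∷ (3 ─ 4) ∷ [])
M237-5  = graphlet 5 ((1 ─ 4) ∷ (1 ─ 5) ∷ (2 ─ 3) ∷ (2 ─ 5) ∷ (3 ─ 4) ∷ (4 ─ 5) ∷ [])
M239-5  = graphlet 5 ((1 ─ 4) ∷ (1 ─ 5) ∷ (2 ─ 3) ∷ (2 ─ 5) ∷ (3 ─ 4) ∷ (3 ─ 5) ∷ (4 ─ 5) ∷ [])
M254-5  = graphlet 5 ((1 ─ 4) ∷ (1 ─ 5) ∷ (2 ─ 3) ∷ (2 ─ 4) ∷ (2 ─ 5) ∷ (3 ─ 4) ∷ (3 ─ 5) ∷ [])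
M255-5  = graphlet 5 ((1 ─ 4) ∷ (1 ─ 5) ∷ (2 ─ 3) ∷ (2 ─ 4) ∷ (2 ─ 5) ∷ (3 ─ 4) ∷ (3 ─ 5) ∷ (4 ─ 5) ∷ [])
M507-5  = graphlet 5 ((1 ─ 3) ∷ (1 ─ 4) ∷ (1 ─ 5) ∷ (2 ─ 3) ∷ (2 ─ 4) ∷ (2 ─ 5) ∷ (3 ─ 5) ∷ (4 ─ 5) ∷ [])
M511-5  = graphlet 5 ((1 ─ 3) ∷ (1 ─ 4) ∷ (1 ─ 5) ∷ (2 ─ 3) ∷ (2 ─ 4) ∷ (2 ─ 5) ∷ (3 ─ 4) ∷ (3 ─ 5) ∷ (4 ─ 5) ∷ [])
M1023-5 = graphlet 5 ((1 ─ 2) ∷ (1 ─ 3) ∷ (1 ─ 4) ∷ (1 ─ 5) ∷ (2 ─ 3) ∷ (2 ─ 4) ∷ (2 ─ 5) ∷ (3 ─ 4) ∷ (3 ─ 5) ∷ (4 ─ 5) ∷ [])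

{-# OPTIONS --safe #-}
module Submission where

-- Each side of each identity is a polynomial expression in degrees, entries of powers of the
-- adjacency matrix and subgraph counts, hence a nested sum over vertices of products of
-- indicators "u ~ v", "u ≠ v" and "deg u > m".  Splitting every bound variable into the cases
-- "equal to an earlier variable" and "different from all of them" turns it into a linear
-- combination of sums over tuples of pairwise distinct vertices of a product of edges, that is,
-- of numbers of embeddings of small graphs.  A guard deg u > m is automatic as soon as the
-- product gives u more than m neighbours, and all terms with a surviving guard cancel; isomorphic
-- small graphs have equally many embeddings; and the number of copies of F is its number of
-- embeddings divided by |Aut F|.  So an identity holds once all coefficients of the difference
-- vanish after merging isomorphic terms.  This is a finite computation not involving G; it is
-- done by a verified normaliser, and every instance is closed by refl.  A sum over edges or over
-- unordered pairs of a symmetric function is first rewritten as half of a sum over ordered pairs.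

open import Defs renaming (sym to adj-sym)
open import Data.Bool using (Bool; true; false; _∧_; _∨_; not; if_then_else_; T)
open import Data.Bool.ListAction using (any; all)
open import Data.Bool.Properties using (T?; T-∧; T-∨; T-≡; ∧-comm; ∧-assoc; ∧-zeroʳ) renaming (_≟_ to _≟B_)
open import Data.Nat as ℕ using (ℕ; zero; suc; _<ᵇ_; _≡ᵇ_)
open import Data.Nat.Properties as ℕP using (<ᵇ⇒<; <⇒<ᵇ; ≡ᵇ⇒≡)
open import Data.Fin as Fin using (Fin; zero; suc; _↑ˡ_; _↑ʳ_)
open import Data.Fin.Properties using (any?; all?; injective⇒≤; suc-injective; toℕ-injective) renaming (_≟_ to _≟F_)
open import Data.List as List using (List; []; _∷_; _++_; map; foldr; filter; filterᵇ; concatMap; mapMaybe; length; allFin; deduplicate)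
open import Data.List.Properties using (map-tabulate; tabulate-lookup)
open import Data.List.Membership.Propositional using (_∈_; find; lose)
open import Data.List.Membership.Propositional.Properties using (∈-allFin; ∈-lookup; ∈-filter⁺; ∈-filter⁻; ∈-map⁺; ∈-map⁻; ∈-deduplicate⁺; ∈-deduplicate⁻)
open import Data.List.Relation.Unary.Any as Any using (here; there)
open import Data.List.Relation.Unary.Any.Properties using (any⁺; any⁻; lookup-index)
open import Data.List.Relation.Unary.All as All using (All; []; _∷_)
open import Data.List.Relation.Unary.All.Properties using (all⁺; all⁻)
open import Data.List.Relation.Unary.Unique.Propositional using (Unique; []; _∷_)
open import Data.List.Relation.Unary.Unique.Propositional.Properties using (allFin⁺; filter⁺)
open import Data.List.Relation.Unary.Unique.DecPropositional.Properties using (deduplicate-!)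
open import Data.Maybe using (just; nothing)
open import Data.Vec as Vec using (Vec; []; _∷_; lookup)
import Data.Vec.Properties as VecP
open import Data.Sum using (_⊎_; inj₁; inj₂)
open import Data.Product using (Σ; ∃; _×_; _,_; proj₁; proj₂)
import Data.Integer as ℤ
import Data.Integer.Properties as ℤP
open import Data.Rational using (ℚ; 0ℚ; 1ℚ; _/_; _+_; _*_; _-_; -_; fromℚᵘ)
open import Data.Rational.Properties
open import Data.Rational.Solver using (module +-*-Solver)
open import Data.Rational.Unnormalised as ℚᵘ using (ℚᵘ; mkℚᵘ)
import Data.Rational.Unnormalised.Properties as ℚᵘP
open import Function using (_∘_; id)
open import Function.Bundles using (Equivalence)
open import Relation.Nullary using (Dec; does; yes; no)
open import Relation.Nullary.Negation using (contradiction)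
open import Relation.Nullary.Decidable using (dec-true; dec-false)
open import Relation.Binary.Definitions using (DecidableEquality; tri<; tri≈; tri>)
open import Relation.Binary.PropositionalEquality
open Equivalence using (to; from)

-- Finite sums of rationals

-- `count` deduplicates a list that depends on `G`, so it does not compute for a variable graph. It
-- becomes accessible because the embeddings with a given image form one free orbit under the
-- automorphisms of F, whose number depends on the graphlet alone and is found by enumerating its
-- self-maps. After that, neither `n` nor `G` occurs in the data handed to the normaliser, which is
-- why `refl` can settle an instance. Two things escape this format. A comparison of vertex numbers
-- is not invariant under relabelling, which is why sums over `i <ᶠ j` have to be symmetrised. And
-- degrees and matrix powers in `Exp` always belong to `G` itself; only counts may be restricted to
-- induced subgraphs. Formulas for traces, degrees and powers inside an induced subgraph therefore
-- come from identities for triangle and four-vertex counts in an arbitrary graph, instantiated at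
-- `nbhd G i` or `common G i j`, which are again of type `Graph`.

private variable
  X Y : Set

𝟙 : Bool → ℚ
𝟙 b = [ b ]? 1ℚ

module _ where
  open +-*-Solver using (solve; _:+_; _:-_; _:*_; _:=_)

  +-interchange : ∀ a b c d → (a + b) + (c + d) ≡ (a + c) + (b + d)
  +-interchange = solve 4 (λ a b c d → (a :+ b) :+ (c :+ d) := (a :+ c) :+ (b :+ d)) refl

  +-exchange : ∀ a b c → a + (b + c) ≡ b + (a + c)
  +-exchange = solve 3 (λ a b c → a :+ (b :+ c) := b :+ (a :+ c)) refl

  *-exchange : ∀ a b c → a * (b * c) ≡ b * (a * c)
  *-exchange = solve 3 (λ a b c → a :* (b :* c) := b :* (a :* c)) refl

  *-assoc-exchange : ∀ a b c → a * b * c ≡ b * (a * c)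
  *-assoc-exchange = solve 3 (λ a b c → a :* b :* c := b :* (a :* c)) refl

  *-swapʳ : ∀ a b c → a * b * c ≡ a * c * b
  *-swapʳ = solve 3 (λ a b c → a :* b :* c := a :* c :* b) refl

  *-distrib-middle : ∀ a b c d → a * ((b + c) * d) ≡ a * (b * d) + a * (c * d)
  *-distrib-middle = solve 4 (λ a b c d → a :* ((b :+ c) :* d) := a :* (b :* d) :+ a :* (c :* d)) refl

  *-rotate : ∀ a b c d → a * (b * (c * d)) ≡ b * (d * (a * c))
  *-rotate = solve 4 (λ a b c d → a :* (b :* (c :* d)) := b :* (d :* (a :* c))) refl

  x-y≡0⇒x≡y : ∀ x y → x - y ≡ 0ℚ → x ≡ y
  x-y≡0⇒x≡y x y eq = trans (solve 2 (λ x y → x := (x :- y) :+ y) refl x y) (trans (cong (_+ y) eq) (+-identityˡ y))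

[]?-𝟙 : ∀ b x → [ b ]? x ≡ 𝟙 b * x
[]?-𝟙 true  x = sym (*-identityˡ x)
[]?-𝟙 false x = sym (*-zeroˡ x)

𝟙-∧ : ∀ a b → 𝟙 (a ∧ b) ≡ 𝟙 a * 𝟙 b
𝟙-∧ true  b = sym (*-identityˡ (𝟙 b))
𝟙-∧ false b = sym (*-zeroˡ (𝟙 b))

∑ : List X → (X → ℚ) → ℚ
∑ xs f = foldr _+_ 0ℚ (map f xs)

∑-cong : ∀ (xs : List X) {f h : X → ℚ} → (∀ x → f x ≡ h x) → ∑ xs f ≡ ∑ xs h
∑-cong []       f≗h = refl
∑-cong (x ∷ xs) f≗h = cong₂ _+_ (f≗h x) (∑-cong xs f≗h)

∑-cong-∈ : ∀ (xs : List X) {f h : X → ℚ} → (∀ x → x ∈ xs → f x ≡ h x) → ∑ xs f ≡ ∑ xs h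
∑-cong-∈ []       f≗h = refl
∑-cong-∈ (x ∷ xs) f≗h = cong₂ _+_ (f≗h x (here refl)) (∑-cong-∈ xs (λ y y∈ → f≗h y (there y∈)))

∑-zero : ∀ (xs : List X) → ∑ xs (λ _ → 0ℚ) ≡ 0ℚ
∑-zero []       = refl
∑-zero (x ∷ xs) = trans (+-identityˡ _) (∑-zero xs)

∑-++ : ∀ (xs ys : List X) f → ∑ (xs ++ ys) f ≡ ∑ xs f + ∑ ys f
∑-++ []       ys f = sym (+-identityˡ _)
∑-++ (x ∷ xs) ys f = trans (cong (f x +_) (∑-++ xs ys f)) (sym (+-assoc (f x) _ _))

∑-map : ∀ (h : X → Y) xs f → ∑ (map h xs) f ≡ ∑ xs (f ∘ h)
∑-map h []       f = refl
∑-map h (x ∷ xs) f = cong (f (h x) +_) (∑-map h xs f)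

∑-concatMap : ∀ (h : X → List Y) xs f → ∑ (concatMap h xs) f ≡ ∑ xs (λ x → ∑ (h x) f)
∑-concatMap h []       f = refl
∑-concatMap h (x ∷ xs) f = trans (∑-++ (h x) _ f) (cong (∑ (h x) f +_) (∑-concatMap h xs f))

∑-+ : ∀ (xs : List X) f h → ∑ xs (λ x → f x + h x) ≡ ∑ xs f + ∑ xs h
∑-+ []       f h = refl
∑-+ (x ∷ xs) f h = trans (cong ((f x + h x) +_) (∑-+ xs f h)) (+-interchange (f x) (h x) _ _)

∑-*ˡ : ∀ (xs : List X) c f → ∑ xs (λ x → c * f x) ≡ c * ∑ xs f
∑-*ˡ []       c f = sym (*-zeroʳ c)
∑-*ˡ (x ∷ xs) c f = trans (cong (c * f x +_) (∑-*ˡ xs c f)) (sym (*-distribˡ-+ c _ _))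

∑-*ʳ : ∀ (xs : List X) c f → ∑ xs (λ x → f x * c) ≡ ∑ xs f * c
∑-*ʳ xs c f = trans (∑-cong xs (λ x → *-comm (f x) c)) (trans (∑-*ˡ xs c f) (*-comm c _))

∑-swap : ∀ (xs : List X) (ys : List Y) (f : X → Y → ℚ) → ∑ xs (λ x → ∑ ys (f x)) ≡ ∑ ys (λ y → ∑ xs (λ x → f x y))
∑-swap []       ys f = sym (∑-zero ys)
∑-swap (x ∷ xs) ys f = trans (cong (∑ ys (f x) +_) (∑-swap xs ys f)) (sym (∑-+ ys (f x) _))

∑-filter : ∀ (p : X → Bool) xs f → ∑ (filter (T? ∘ p) xs) f ≡ ∑ xs (λ x → 𝟙 (p x) * f x)
∑-filter p []       f = refl
∑-filter p (x ∷ xs) f with p x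
... | true  = cong₂ _+_ (sym (*-identityˡ (f x))) (∑-filter p xs f)
... | false = trans (∑-filter p xs f) (sym (trans (cong (_+ _) (*-zeroˡ (f x))) (+-identityˡ _)))

does-sym : ∀ (_≟_ : DecidableEquality X) x y → does (x ≟ y) ≡ does (y ≟ x)
does-sym _≟_ x y with y ≟ x
... | yes y≡x = dec-true (x ≟ y) (sym y≡x)
... | no  y≢x = dec-false (x ≟ y) (y≢x ∘ sym)

-- "Every element occurs exactly once", phrased as a Kronecker delta so that it can be used directly
-- inside sums.
Enumerates : DecidableEquality X → List X → Set
Enumerates {X} _≟_ xs = ∀ (z : X) (f : X → ℚ) → ∑ xs (λ x → 𝟙 (does (x ≟ z)) * f x) ≡ f z

∑-absent : ∀ (_≟_ : DecidableEquality X) {z} {xs : List X} (f : X → ℚ) → All (z ≢_) xs →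
           ∑ xs (λ x → 𝟙 (does (x ≟ z)) * f x) ≡ 0ℚ
∑-absent _≟_ f [] = refl
∑-absent _≟_ {z} {x ∷ xs} f (z≢x ∷ z∉xs) =
  cong₂ _+_ (trans (cong (λ b → 𝟙 b * f x) (dec-false (x ≟ z) (z≢x ∘ sym))) (*-zeroˡ (f x)))
            (∑-absent _≟_ f z∉xs)

∑-unique : ∀ (_≟_ : DecidableEquality X) {z} {xs : List X} (f : X → ℚ) → Unique xs → z ∈ xs →
           ∑ xs (λ x → 𝟙 (does (x ≟ z)) * f x) ≡ f z
∑-unique _≟_ {z} f (x∉xs ∷ _) (here refl) =
  trans (cong₂ _+_ (trans (cong (λ b → 𝟙 b * f z) (dec-true (z ≟ z) refl)) (*-identityˡ (f z)))
                   (∑-absent _≟_ f x∉xs))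
        (+-identityʳ (f z))
∑-unique _≟_ {z} {x ∷ xs} f (x∉xs ∷ u) (there z∈xs) =
  trans (cong₂ _+_ (trans (cong (λ b → 𝟙 b * f x) (dec-false (x ≟ z) (All.lookup x∉xs z∈xs))) (*-zeroˡ (f x)))
                   (∑-unique _≟_ f u z∈xs))
        (+-identityˡ (f z))

-- Insert a delta over `ys`, exchange the sums, read `y ≡ h x` as `x ≡ h⁻ y`, and collapse the delta
-- over `xs`. No permutation of lists is involved.
∑-bij : ∀ (_≟_ : DecidableEquality X) (_≟′_ : DecidableEquality Y) {xs ys} →
        Enumerates _≟_ xs → Enumerates _≟′_ ys → (h : X → Y) (h⁻ : Y → X) →
        (∀ x → h⁻ (h x) ≡ x) → (∀ y → h (h⁻ y) ≡ y) → ∀ f → ∑ xs (f ∘ h) ≡ ∑ ys f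
∑-bij _≟_ _≟′_ {xs} {ys} enX enY h h⁻ h⁻h hh⁻ f = begin
  ∑ xs (f ∘ h)                                                ≡⟨ ∑-cong xs (λ x → enY (h x) f) ⟨
  ∑ xs (λ x → ∑ ys (λ y → 𝟙 (does (y ≟′ h x)) * f y))         ≡⟨ ∑-swap xs ys _ ⟩
  ∑ ys (λ y → ∑ xs (λ x → 𝟙 (does (y ≟′ h x)) * f y))         ≡⟨ ∑-cong ys (λ y → ∑-cong xs (λ x → cong (λ b → 𝟙 b * f y) (flip-eq x y))) ⟩
  ∑ ys (λ y → ∑ xs (λ x → 𝟙 (does (x ≟ h⁻ y)) * f y))         ≡⟨ ∑-cong ys (λ y → enX (h⁻ y) (λ _ → f y)) ⟩
  ∑ ys f ∎
  where
  open ≡-Reasoning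
  flip-eq : ∀ x y → does (y ≟′ h x) ≡ does (x ≟ h⁻ y)
  flip-eq x y with x ≟ h⁻ y
  ... | yes refl = dec-true (y ≟′ h (h⁻ y)) (sym (hh⁻ y))
  ... | no  x≢   = dec-false (y ≟′ h x) (λ { refl → x≢ (sym (h⁻h x)) })

∑-allFin-suc : ∀ {c} (f : Fin (suc c) → ℚ) → ∑ (allFin (suc c)) f ≡ f zero + ∑ (allFin c) (f ∘ suc)
∑-allFin-suc {c} f = cong (f zero +_)
  (cong (foldr _+_ 0ℚ) (trans (map-tabulate suc f) (sym (map-tabulate id (f ∘ suc)))))

enumerates-allFin : ∀ n → Enumerates (_≟F_ {n}) (allFin n)
enumerates-allFin n z f = ∑-unique _≟F_ f (allFin⁺ n) (∈-allFin z)

_≟V_ : ∀ {n c} → DecidableEquality (Vec (Fin n) c)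
_≟V_ = VecP.≡-dec _≟F_

∑-allMaps-suc : ∀ n c f → ∑ (allMaps n (suc c)) f ≡ ∑ (allFin n) (λ y → ∑ (allMaps n c) (λ x → f (y ∷ x)))
∑-allMaps-suc n c f =
  trans (∑-concatMap _ (allFin n) f) (∑-cong (allFin n) (λ y → ∑-map (y ∷_) (allMaps n c) f))

enumerates-allMaps : ∀ n c → Enumerates _≟V_ (allMaps n c)
enumerates-allMaps n zero    []      f = trans (+-identityʳ _) (*-identityˡ _)
enumerates-allMaps n (suc c) (w ∷ z) f = begin
  ∑ (allMaps n (suc c)) (λ x → 𝟙 (does (x ≟V (w ∷ z))) * f x)
    ≡⟨ ∑-allMaps-suc n c _ ⟩
  ∑ (allFin n) (λ y → ∑ (allMaps n c) (λ x → 𝟙 (does (y ≟F w) ∧ does (x ≟V z)) * f (y ∷ x)))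
    ≡⟨ ∑-cong (allFin n) (λ y → trans (∑-cong (allMaps n c) (λ x →
         trans (cong (_* f (y ∷ x)) (𝟙-∧ (does (y ≟F w)) (does (x ≟V z)))) (*-assoc (𝟙 (does (y ≟F w))) _ _)))
         (∑-*ˡ (allMaps n c) (𝟙 (does (y ≟F w))) _)) ⟩
  ∑ (allFin n) (λ y → 𝟙 (does (y ≟F w)) * ∑ (allMaps n c) (λ x → 𝟙 (does (x ≟V z)) * f (y ∷ x)))
    ≡⟨ enumerates-allFin n w _ ⟩
  ∑ (allMaps n c) (λ x → 𝟙 (does (x ≟V z)) * f (w ∷ x))
    ≡⟨ enumerates-allMaps n c z (λ x → f (w ∷ x)) ⟩
  f (w ∷ z) ∎
  where open ≡-Reasoning

-- The normaliser computes its coefficients in `ℚᵘ`, where fractions are not reduced to lowest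
-- terms; this and the next lemma carry the results over to `ℚ`.
fromℚᵘ-+ : ∀ p q → fromℚᵘ (p ℚᵘ.+ q) ≡ fromℚᵘ p + fromℚᵘ q
fromℚᵘ-+ p q = toℚᵘ-injective (ℚᵘP.≃-trans (toℚᵘ-fromℚᵘ (p ℚᵘ.+ q))
  (ℚᵘP.≃-sym (ℚᵘP.≃-trans (toℚᵘ-homo-+ (fromℚᵘ p) (fromℚᵘ q)) (ℚᵘP.+-cong (toℚᵘ-fromℚᵘ p) (toℚᵘ-fromℚᵘ q)))))

fromℚᵘ-* : ∀ p q → fromℚᵘ (p ℚᵘ.* q) ≡ fromℚᵘ p * fromℚᵘ q
fromℚᵘ-* p q = toℚᵘ-injective (ℚᵘP.≃-trans (toℚᵘ-fromℚᵘ (p ℚᵘ.* q))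
  (ℚᵘP.≃-sym (ℚᵘP.≃-trans (toℚᵘ-homo-* (fromℚᵘ p) (fromℚᵘ q)) (ℚᵘP.*-cong (toℚᵘ-fromℚᵘ p) (toℚᵘ-fromℚᵘ q)))))

bool-ext : ∀ {a b} → (T a → T b) → (T b → T a) → a ≡ b
bool-ext {true}  {true}  _ _ = refl
bool-ext {true}  {false} f _ = contradiction _ f
bool-ext {false} {true}  _ f = contradiction _ f
bool-ext {false} {false} _ _ = refl

==F⇒≡ : ∀ {n} {i j : Fin n} → T (i ==F j) → i ≡ j
==F⇒≡ {i = i} {j} t with yes i≡j ← i ≟F j = i≡j

==F-refl : ∀ {n} (i : Fin n) → (i ==F i) ≡ true
==F-refl i = dec-true (i ≟F i) refl

≢⇒==F : ∀ {n} {i j : Fin n} → i ≢ j → (i ==F j) ≡ false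
≢⇒==F {i = i} {j} = dec-false (i ≟F j)

-- Sums over tuples of vertices

cons : ∀ {A : Set} {b} → A → (Fin b → A) → Fin (suc b) → A
cons y ρ zero    = y
cons y ρ (suc i) = ρ i

-- Tuples of vertices are functions, and pointwise equal ones need not be propositionally equal, so
-- invariance under `≗` is an explicit property.
Ext : ∀ {c} {X Y : Set} → ((Fin c → X) → Y) → Set
Ext w = ∀ {x y} → x ≗ y → w x ≡ w y

cons-cong : ∀ {X : Set} {b} (y : X) {ρ ρ' : Fin b → X} → ρ ≗ ρ' → cons y ρ ≗ cons y ρ'
cons-cong y eq zero    = refl
cons-cong y eq (suc i) = eq i

Inj : ∀ {c n} → (Fin c → Fin n) → Set
Inj x = ∀ i j → x i ≡ x j → i ≡ j

module _ {n : ℕ} where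

  ∑ᵗ : ∀ c → ((Fin c → Fin n) → ℚ) → ℚ
  ∑ᵗ zero    f = f (λ ())
  ∑ᵗ (suc c) f = ∑ (allFin n) (λ y → ∑ᵗ c (λ x → f (cons y x)))

  ∑ᵗ-cong : ∀ c {f h} → (∀ x → f x ≡ h x) → ∑ᵗ c f ≡ ∑ᵗ c h
  ∑ᵗ-cong zero    eq = eq _
  ∑ᵗ-cong (suc c) eq = ∑-cong (allFin n) (λ y → ∑ᵗ-cong c (λ x → eq (cons y x)))

  ∑ᵗ-+ : ∀ c f h → ∑ᵗ c (λ x → f x + h x) ≡ ∑ᵗ c f + ∑ᵗ c h
  ∑ᵗ-+ zero    f h = refl
  ∑ᵗ-+ (suc c) f h = trans (∑-cong (allFin n) (λ y → ∑ᵗ-+ c _ _)) (∑-+ (allFin n) _ _)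

  ∑ᵗ-*ˡ : ∀ c q f → ∑ᵗ c (λ x → q * f x) ≡ q * ∑ᵗ c f
  ∑ᵗ-*ˡ zero    q f = refl
  ∑ᵗ-*ˡ (suc c) q f = trans (∑-cong (allFin n) (λ y → ∑ᵗ-*ˡ c q _)) (∑-*ˡ (allFin n) q _)

  ∑ᵗ-swap : ∀ {X : Set} c (xs : List X) f → ∑ᵗ c (λ x → ∑ xs (f x)) ≡ ∑ xs (λ y → ∑ᵗ c (λ x → f x y))
  ∑ᵗ-swap zero    xs f = refl
  ∑ᵗ-swap (suc c) xs f =
    trans (∑-cong (allFin n) (λ y → ∑ᵗ-swap c xs (λ x → f (cons y x)))) (∑-swap (allFin n) xs _)

  ∑ᵗ-allMaps : ∀ c {f} → Ext f → ∑ᵗ c f ≡ ∑ (allMaps n c) (f ∘ lookup)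
  ∑ᵗ-allMaps zero    {f} ext = trans (ext (λ ())) (sym (+-identityʳ _))
  ∑ᵗ-allMaps (suc c) {f} ext = trans
    (∑-cong (allFin n) (λ y → trans (∑ᵗ-allMaps c (λ eq → ext (cons-cong y eq)))
                                    (∑-cong (allMaps n c) (λ x → ext {cons y (lookup x)} {lookup (y ∷ x)} λ { zero → refl ; (suc i) → refl }))))
    (sym (∑-allMaps-suc n c (f ∘ lookup)))

  fresh : ∀ {c} → Fin n → (Fin c → Fin n) → Bool
  fresh {zero}  y x = true
  fresh {suc c} y x = (y ≢ᵇ x zero) ∧ fresh y (x ∘ suc)

  pairwise : ∀ {c} → (Fin c → Fin n) → Bool
  pairwise {zero}  x = true
  pairwise {suc c} x = fresh (x zero) (x ∘ suc) ∧ pairwise (x ∘ suc)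

  fresh⇒≢ : ∀ {c} {y} {x : Fin c → Fin n} → T (fresh y x) → ∀ i → y ≢ x i
  fresh⇒≢ {suc c} {y} {x} t zero    y≡ with () ← subst (λ b → T (not b ∧ fresh y (x ∘ suc))) (dec-true (y ≟F x zero) y≡) t
  fresh⇒≢ {suc c}         t (suc i) = fresh⇒≢ (proj₂ (to T-∧ t)) i

  ≢⇒fresh : ∀ {c} {y} {x : Fin c → Fin n} → (∀ i → y ≢ x i) → fresh y x ≡ true
  ≢⇒fresh {zero}  ≢x = refl
  ≢⇒fresh {suc c} ≢x = cong₂ _∧_ (cong not (≢⇒==F (≢x zero))) (≢⇒fresh (≢x ∘ suc))

  pairwise⇒Inj : ∀ {c} {x : Fin c → Fin n} → T (pairwise x) → Inj x
  pairwise⇒Inj             t zero    zero    eq = refl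
  pairwise⇒Inj {suc c} {x} t zero    (suc j) eq = contradiction eq (fresh⇒≢ (proj₁ (to T-∧ t)) j)
  pairwise⇒Inj {suc c} {x} t (suc i) zero    eq = contradiction (sym eq) (fresh⇒≢ (proj₁ (to T-∧ t)) i)
  pairwise⇒Inj {suc c} {x} t (suc i) (suc j) eq = cong suc (pairwise⇒Inj (proj₂ (to T-∧ t)) i j eq)

  Inj⇒pairwise : ∀ {c} {x : Fin c → Fin n} → Inj x → pairwise x ≡ true
  Inj⇒pairwise {zero}  inj = refl
  Inj⇒pairwise {suc c} inj = cong₂ _∧_
    (≢⇒fresh (λ i eq → contradiction (inj zero (suc i) eq) λ ()))
    (Inj⇒pairwise (λ i j eq → suc-injective (inj (suc i) (suc j) eq)))

  ∑ⁱ : ∀ c → ((Fin c → Fin n) → ℚ) → ℚ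
  ∑ⁱ c w = ∑ᵗ c (λ x → 𝟙 (pairwise x) * w x)

  ∑ⁱ-cong : ∀ c {w w'} → (∀ x → Inj x → w x ≡ w' x) → ∑ⁱ c w ≡ ∑ⁱ c w'
  ∑ⁱ-cong c {w} {w'} eq = ∑ᵗ-cong c helper
    where
    helper : ∀ x → 𝟙 (pairwise x) * w x ≡ 𝟙 (pairwise x) * w' x
    helper x with pairwise x in px
    ... | true  = cong (1ℚ *_) (eq x (pairwise⇒Inj (from T-≡ px)))
    ... | false = trans (*-zeroˡ (w x)) (sym (*-zeroˡ (w' x)))

  ∑ⁱ-+ : ∀ c w w' → ∑ⁱ c (λ x → w x + w' x) ≡ ∑ⁱ c w + ∑ⁱ c w'
  ∑ⁱ-+ c w w' = trans (∑ᵗ-cong c (λ x → *-distribˡ-+ (𝟙 (pairwise x)) (w x) (w' x))) (∑ᵗ-+ c _ _)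

  ∑ⁱ-*ˡ : ∀ c q w → ∑ⁱ c (λ x → q * w x) ≡ q * ∑ⁱ c w
  ∑ⁱ-*ˡ c q w = trans (∑ᵗ-cong c (λ x → *-exchange (𝟙 (pairwise x)) q (w x))) (∑ᵗ-*ˡ c q _)

  ∑ⁱ-swap : ∀ {X : Set} c (xs : List X) (w : (Fin c → Fin n) → X → ℚ) → ∑ⁱ c (λ x → ∑ xs (w x)) ≡ ∑ xs (λ v → ∑ⁱ c (λ x → w x v))
  ∑ⁱ-swap c xs w = trans (∑ᵗ-cong c (λ x → sym (∑-*ˡ xs (𝟙 (pairwise x)) (w x)))) (∑ᵗ-swap c xs _)

  ∑ⁱ-zero : ∀ c {w} → (∀ x → w x ≡ 0ℚ) → ∑ⁱ c w ≡ 0ℚ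
  ∑ⁱ-zero c {w} eq = trans (∑ⁱ-cong c (λ x _ → trans (eq x) (sym (*-zeroˡ 1ℚ)))) (trans (∑ⁱ-*ˡ c 0ℚ (λ _ → 1ℚ)) (*-zeroˡ (∑ⁱ c (λ _ → 1ℚ))))

  ∑ⁱ-suc : ∀ c w → ∑ⁱ (suc c) w ≡ ∑ⁱ c (λ x → ∑ (allFin n) (λ y → 𝟙 (fresh y x) * w (cons y x)))
  ∑ⁱ-suc c w = begin
    ∑ (allFin n) (λ y → ∑ᵗ c (λ x → 𝟙 (fresh y x ∧ pairwise x) * w (cons y x)))
      ≡⟨ ∑ᵗ-swap c (allFin n) _ ⟨
    ∑ᵗ c (λ x → ∑ (allFin n) (λ y → 𝟙 (fresh y x ∧ pairwise x) * w (cons y x)))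
      ≡⟨ ∑ᵗ-cong c (λ x → trans (∑-cong (allFin n) (λ y → trans (cong (_* w (cons y x)) (𝟙-∧ (fresh y x) (pairwise x)))
                                (*-assoc-exchange (𝟙 (fresh y x)) (𝟙 (pairwise x)) (w (cons y x))))) (∑-*ˡ (allFin n) (𝟙 (pairwise x)) _)) ⟩
    ∑ⁱ c (λ x → ∑ (allFin n) (λ y → 𝟙 (fresh y x) * w (cons y x))) ∎
    where open ≡-Reasoning

  -- This is the splitting of a bound variable into "new" and "equal to an earlier one". By
  -- injectivity `x zero` is fresh for the remaining entries, so the induction removes exactly one
  -- term from the fresh part at each step.
  ∑-split : ∀ {c} (x : Fin c → Fin n) → Inj x → ∀ f →
            ∑ (allFin n) f ≡ ∑ (allFin n) (λ y → 𝟙 (fresh y x) * f y) + ∑ (allFin c) (f ∘ x)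
  ∑-split {zero}  x inj f = trans (∑-cong (allFin n) (λ y → sym (*-identityˡ (f y)))) (sym (+-identityʳ _))
  ∑-split {suc c} x inj f = begin
    ∑ (allFin n) f
      ≡⟨ ∑-split (x ∘ suc) (λ i j eq → suc-injective (inj (suc i) (suc j) eq)) f ⟩
    ∑ (allFin n) (λ y → 𝟙 (fresh y (x ∘ suc)) * f y) + rest
      ≡⟨ cong (_+ rest) (trans (∑-cong (allFin n) (λ y → separate (y ==F x zero) (fresh y (x ∘ suc)) (f y))) (∑-+ (allFin n) _ _)) ⟩
    (∑ (allFin n) (λ y → 𝟙 (fresh y x) * f y) + ∑ (allFin n) (λ y → 𝟙 (y ==F x zero) * (𝟙 (fresh y (x ∘ suc)) * f y))) + rest
      ≡⟨ cong (λ s → (∑ (allFin n) (λ y → 𝟙 (fresh y x) * f y) + s) + rest)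
              (trans (enumerates-allFin n (x zero) _) (trans (cong (λ b → 𝟙 b * f (x zero)) x₀-fresh) (*-identityˡ _))) ⟩
    (∑ (allFin n) (λ y → 𝟙 (fresh y x) * f y) + f (x zero)) + rest
      ≡⟨ +-assoc (∑ (allFin n) (λ y → 𝟙 (fresh y x) * f y)) (f (x zero)) rest ⟩
    ∑ (allFin n) (λ y → 𝟙 (fresh y x) * f y) + (f (x zero) + rest)
      ≡⟨ cong (∑ (allFin n) (λ y → 𝟙 (fresh y x) * f y) +_) (∑-allFin-suc (f ∘ x)) ⟨
    ∑ (allFin n) (λ y → 𝟙 (fresh y x) * f y) + ∑ (allFin (suc c)) (f ∘ x) ∎
    where
    open ≡-Reasoning
    rest = ∑ (allFin c) (f ∘ x ∘ suc)
    x₀-fresh : fresh (x zero) (x ∘ suc) ≡ true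
    x₀-fresh = ≢⇒fresh (λ i eq → contradiction (inj zero (suc i) eq) λ ())
    separate : ∀ a b z → 𝟙 b * z ≡ 𝟙 (not a ∧ b) * z + 𝟙 a * (𝟙 b * z)
    separate true  b z = sym (trans (cong₂ _+_ (*-zeroˡ z) (*-identityˡ (𝟙 b * z))) (+-identityˡ _))
    separate false b z = sym (trans (cong (𝟙 b * z +_) (*-zeroˡ (𝟙 b * z))) (+-identityʳ _))

-- Boolean tests on lists, injectivity, degrees and relabelling

all-cong : ∀ {p q : X → Bool} xs → (∀ x → p x ≡ q x) → all p xs ≡ all q xs
all-cong []       eq = refl
all-cong (x ∷ xs) eq = cong₂ _∧_ (eq x) (all-cong xs eq)

all-map : ∀ {p : Y → Bool} (f : X → Y) xs → all p (map f xs) ≡ all (p ∘ f) xs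
all-map f []       = refl
all-map f (x ∷ xs) = cong (_ ∧_) (all-map f xs)

any-cong : ∀ {p q : X → Bool} xs → (∀ x → p x ≡ q x) → any p xs ≡ any q xs
any-cong []       eq = refl
any-cong (x ∷ xs) eq = cong₂ _∨_ (eq x) (any-cong xs eq)

all-∈ : ∀ (p : X → Bool) {xs} → T (all p xs) → ∀ {x} → x ∈ xs → T (p x)
all-∈ p {xs} t = All.lookup (all⁺ p xs t)

∈-all : ∀ (p : X → Bool) {xs} → (∀ {x} → x ∈ xs → T (p x)) → T (all p xs)
∈-all p h = all⁻ p (All.tabulate h)

∈-any : ∀ (p : X → Bool) {xs x} → x ∈ xs → T (p x) → T (any p xs)
∈-any p x∈xs px = any⁺ p (lose x∈xs px)

any-∈ : ∀ (p : X → Bool) {xs} → T (any p xs) → ∃ λ x → x ∈ xs × T (p x)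
any-∈ p {xs} t = find (any⁻ p xs t)

≡⇒==F : ∀ {n} {i j : Fin n} → i ≡ j → T (i ==F j)
≡⇒==F {i = i} refl = from T-≡ (==F-refl i)

injectiveᵇ⇒Inj : ∀ {n c} (p : Vec (Fin n) c) → T (injectiveᵇ p) → Inj (lookup p)
injectiveᵇ⇒Inj p t a b eq with to (T-∨ {a ==F b}) (all-∈ _ (all-∈ _ t (∈-allFin a)) (∈-allFin b))
... | inj₁ a==b = ==F⇒≡ a==b
... | inj₂ pa≢pb with () ← subst (λ b → T (not b)) (dec-true (lookup p a ≟F lookup p b) eq) pa≢pb

Inj⇒injectiveᵇ : ∀ {n c} (p : Vec (Fin n) c) → Inj (lookup p) → T (injectiveᵇ p)
Inj⇒injectiveᵇ {c = c} p inj = ∈-all _ {allFin c} (λ {a} _ → ∈-all _ {allFin c} (λ {b} _ → pair a b))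
  where
  pair : ∀ a b → T ((a ==F b) ∨ not (lookup p a ==F lookup p b))
  pair a b with a ≟F b
  ... | yes _   = _
  ... | no  a≢b = from T-≡ (cong not (≢⇒==F (a≢b ∘ inj a b)))

unique-lookup : ∀ {X : Set} {xs : List X} → Unique xs → ∀ i j → List.lookup xs i ≡ List.lookup xs j → i ≡ j
unique-lookup (x∉xs ∷ u) zero    zero    eq = refl
unique-lookup (x∉xs ∷ u) zero    (suc j) eq = contradiction eq (All.lookup x∉xs (∈-lookup j))
unique-lookup (x∉xs ∷ u) (suc i) zero    eq = contradiction (sym eq) (All.lookup x∉xs (∈-lookup i))
unique-lookup (x∉xs ∷ u) (suc i) (suc j) eq = cong suc (unique-lookup u i j eq)

sel-unique : ∀ {n} (p : Fin n → Bool) → Unique (sel p)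
sel-unique {n} p = filter⁺ (T? ∘ p) (allFin⁺ n)

deg≡length : ∀ {n} (G : Graph n) v → deg G v ≡ length (sel (adj G v))
deg≡length {n} G v = go (allFin n)
  where
  go : ∀ us → foldr ℕ._+_ 0 (map (g G v) us) ≡ length (filter (T? ∘ adj G v) us)
  go []       = refl
  go (u ∷ us) with adj G v u
  ... | true  = cong suc (go us)
  ... | false = go us

module _ {n : ℕ} where

  pairwise-ext : ∀ {c} → Ext {c} (pairwise {n})
  pairwise-ext {c} {x} {y} eq = bool-ext
    (λ t → from T-≡ (Inj⇒pairwise (λ i j e → pairwise⇒Inj t i j (trans (eq i) (trans e (sym (eq j)))))))
    (λ t → from T-≡ (Inj⇒pairwise (λ i j e → pairwise⇒Inj t i j (trans (sym (eq i)) (trans e (eq j))))))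

  -- The reindexing argument `∑-bij` needs decidable equality of the indices, which functions do not
  -- have; hence the passage through vectors and back.
  ∑ⁱ-relabel : ∀ {c c'} (p : Fin c → Fin c') (q : Fin c' → Fin c) → (∀ i → q (p i) ≡ i) → (∀ i → p (q i) ≡ i) →
               ∀ w → Ext w → ∑ⁱ {n} c w ≡ ∑ⁱ c' (λ x → w (x ∘ p))
  ∑ⁱ-relabel {c} {c'} p q qp pq w ext = begin
    ∑ⁱ c w
      ≡⟨ ∑ᵗ-allMaps c W-ext ⟩
    ∑ (allMaps n c) (W ∘ lookup)
      ≡⟨ ∑-bij _≟V_ _≟V_ {allMaps n c'} {allMaps n c} (enumerates-allMaps n c') (enumerates-allMaps n c)
               (λ v → Vec.tabulate (lookup v ∘ p)) (λ u → Vec.tabulate (lookup u ∘ q))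
               (λ v → inverse v p q pq) (λ u → inverse u q p qp) (W ∘ lookup) ⟨
    ∑ (allMaps n c') (λ v → W (lookup (Vec.tabulate (lookup v ∘ p))))
      ≡⟨ ∑-cong (allMaps n c') (λ v → trans (W-ext (VecP.lookup∘tabulate (lookup v ∘ p)))
                                            (cong (λ b → 𝟙 b * w (lookup v ∘ p)) (pairwise-∘ (lookup v)))) ⟩
    ∑ (allMaps n c') (W' ∘ lookup)
      ≡⟨ ∑ᵗ-allMaps c' W'-ext ⟨
    ∑ⁱ c' (λ x → w (x ∘ p)) ∎
    where
    open ≡-Reasoning
    W : (Fin c → Fin n) → ℚ
    W x = 𝟙 (pairwise x) * w x
    W' : (Fin c' → Fin n) → ℚ
    W' x = 𝟙 (pairwise x) * w (x ∘ p)
    W-ext : Ext W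
    W-ext eq = cong₂ (λ b z → 𝟙 b * z) (pairwise-ext eq) (ext eq)
    W'-ext : Ext W'
    W'-ext eq = cong₂ (λ b z → 𝟙 b * z) (pairwise-ext eq) (ext (eq ∘ p))
    inverse : ∀ {c c'} (v : Vec (Fin n) c') (p : Fin c → Fin c') q → (∀ i → p (q i) ≡ i) →
              Vec.tabulate (lookup (Vec.tabulate (lookup v ∘ p)) ∘ q) ≡ v
    inverse v p q pq = trans
      (VecP.tabulate-cong (λ i → trans (VecP.lookup∘tabulate (lookup v ∘ p) (q i)) (cong (lookup v) (pq i))))
      (VecP.tabulate∘lookup v)
    pairwise-∘ : ∀ x → pairwise (x ∘ p) ≡ pairwise x
    pairwise-∘ x = bool-ext
      (λ t → from T-≡ (Inj⇒pairwise (λ i j eq → trans (sym (pq i)) (trans (cong p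
                 (pairwise⇒Inj t (q i) (q j) (trans (cong x (pq i)) (trans eq (sym (cong x (pq j))))))) (pq j)))))
      (λ t → from T-≡ (Inj⇒pairwise (λ i j eq → trans (sym (qp i)) (trans (cong q (pairwise⇒Inj t (p i) (p j) eq)) (qp j)))))

-- Copies and embeddings of a graphlet

joins : ∀ {c} → Fin c → Fin c → Fin c × Fin c → Bool
joins a b (u , v) = ((u ==F a) ∧ (v ==F b)) ∨ ((u ==F b) ∧ (v ==F a))

identity : ∀ n → Vec (Fin n) n
identity n = Vec.tabulate id

-- Equality of images says that σ maps the links of F onto the links of F.
automorphism : (F : Graphlet) → Vec (Fin (size F)) (size F) → Bool
automorphism F σ = injectiveᵇ σ ∧ does (image F σ ≟S image F (identity (size F)))

#Aut : Graphlet → ℕ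
#Aut F = length (filterᵇ (automorphism F) (allMaps (size F) (size F)))

ℚ[]-+ : ∀ m k → ℚ[ m ℕ.+ k ] ≡ ℚ[ m ] + ℚ[ k ]
ℚ[]-+ m k = trans (fromℚᵘ-cong {mkℚᵘ (ℤ.+ (m ℕ.+ k)) 0} {mkℚᵘ (ℤ.+ m) 0 ℚᵘ.+ mkℚᵘ (ℤ.+ k) 0}
  (ℚᵘ.*≡* (cong (ℤ._* ℤ.1ℤ) (cong₂ ℤ._+_ (sym (ℤP.*-identityʳ (ℤ.+ m))) (sym (ℤP.*-identityʳ (ℤ.+ k)))))))
  (fromℚᵘ-+ (mkℚᵘ (ℤ.+ m) 0) (mkℚᵘ (ℤ.+ k) 0))

ℚ[]-* : ∀ m k → ℚ[ m ℕ.* k ] ≡ ℚ[ m ] * ℚ[ k ]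
ℚ[]-* m k = trans (fromℚᵘ-cong {mkℚᵘ (ℤ.+ (m ℕ.* k)) 0} {mkℚᵘ (ℤ.+ m) 0 ℚᵘ.* mkℚᵘ (ℤ.+ k) 0}
  (ℚᵘ.*≡* (cong (ℤ._* ℤ.1ℤ) (ℤP.pos-* m k))))
  (fromℚᵘ-* (mkℚᵘ (ℤ.+ m) 0) (mkℚᵘ (ℤ.+ k) 0))

ℚ[length] : ∀ {X : Set} (xs : List X) → ℚ[ length xs ] ≡ ∑ xs (λ _ → 1ℚ)
ℚ[length] []       = refl
ℚ[length] (x ∷ xs) = trans (ℚ[]-+ 1 (length xs)) (cong (1ℚ +_) (ℚ[length] xs))

ℚ[length-filter] : ∀ {X : Set} (p : X → Bool) xs → ℚ[ length (filterᵇ p xs) ] ≡ ∑ xs (𝟙 ∘ p)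
ℚ[length-filter] p xs = trans (ℚ[length] (filterᵇ p xs)) (trans (∑-filter p xs (λ _ → 1ℚ)) (∑-cong xs (λ x → *-identityʳ (𝟙 (p x)))))

T-joins : ∀ {n} {a b u v : Fin n} → T (joins a b (u , v)) → (u ≡ a × v ≡ b) ⊎ (u ≡ b × v ≡ a)
T-joins {a = a} {b} {u} {v} t with to (T-∨ {(u ==F a) ∧ (v ==F b)}) t
... | inj₁ t₁ = inj₁ (==F⇒≡ (proj₁ (to T-∧ t₁)) , ==F⇒≡ (proj₂ (to (T-∧ {u ==F a}) t₁)))
... | inj₂ t₂ = inj₂ (==F⇒≡ (proj₁ (to T-∧ t₂)) , ==F⇒≡ (proj₂ (to (T-∧ {u ==F b}) t₂)))

joins-T : ∀ {n} {a b u v : Fin n} → (u ≡ a × v ≡ b) ⊎ (u ≡ b × v ≡ a) → T (joins a b (u , v))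
joins-T {a = a} {b} {u} {v} (inj₁ (refl , refl)) =
  from (T-∨ {(u ==F a) ∧ (v ==F b)}) (inj₁ (from T-∧ (≡⇒==F {i = u} refl , ≡⇒==F {i = v} refl)))
joins-T {a = a} {b} {u} {v} (inj₂ (refl , refl)) =
  from (T-∨ {(u ==F a) ∧ (v ==F b)}) (inj₂ (from T-∧ (≡⇒==F {i = u} refl , ≡⇒==F {i = v} refl)))

comp : ∀ {n b c} → Vec (Fin n) b → Vec (Fin b) c → Vec (Fin n) c
comp φ σ = Vec.map (lookup φ) σ

lookup-comp : ∀ {n b c} (φ : Vec (Fin n) b) (σ : Vec (Fin b) c) a → lookup (comp φ σ) a ≡ lookup φ (lookup σ a)
lookup-comp φ σ a = VecP.lookup-map a (lookup φ) σ

comp-identity : ∀ {n b} (φ : Vec (Fin n) b) → comp φ (identity b) ≡ φ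
comp-identity φ = trans (sym (VecP.tabulate-∘ (lookup φ) id)) (VecP.tabulate∘lookup φ)

lookup-ext : ∀ {X : Set} {c} {u v : Vec X c} → (∀ i → lookup u i ≡ lookup v i) → u ≡ v
lookup-ext {u = u} {v} eq = trans (sym (VecP.tabulate∘lookup u)) (trans (VecP.tabulate-cong eq) (VecP.tabulate∘lookup v))

module _ (F : Graphlet) where
  private b = size F

  vertexᵇ : ∀ {n} → Vec (Fin n) b → Fin n → Bool
  vertexᵇ φ u = any (λ a → lookup φ a ==F u) (allFin b)

  edgeᵇ : ∀ {n} → Vec (Fin n) b → Fin n → Fin n → Bool
  edgeᵇ φ u v = any (λ e → joins u v (lookup φ (proj₁ e) , lookup φ (proj₂ e))) (links F)

  image-vertexᵇ : ∀ {n} (φ ψ : Vec (Fin n) b) → image F φ ≡ image F ψ → ∀ u → vertexᵇ φ u ≡ vertexᵇ ψ u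
  image-vertexᵇ φ ψ eq u = trans (sym (VecP.lookup∘tabulate (vertexᵇ φ) u))
    (trans (cong (λ S → lookup (proj₁ S) u) eq) (VecP.lookup∘tabulate (vertexᵇ ψ) u))

  image-edgeᵇ : ∀ {n} (φ ψ : Vec (Fin n) b) → image F φ ≡ image F ψ → ∀ u v → edgeᵇ φ u v ≡ edgeᵇ ψ u v
  image-edgeᵇ φ ψ eq u v = trans (sym (entry φ)) (trans (cong (λ S → lookup (lookup (proj₂ S) u) v) eq) (entry ψ))
    where
    entry : ∀ φ → lookup (lookup (proj₂ (image F φ)) u) v ≡ edgeᵇ φ u v
    entry φ = trans (cong (λ r → lookup r v) (VecP.lookup∘tabulate (λ u → Vec.tabulate (edgeᵇ φ u)) u)) (VecP.lookup∘tabulate (edgeᵇ φ u) v)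

  image-ext : ∀ {n} (φ ψ : Vec (Fin n) b) → (∀ u → vertexᵇ φ u ≡ vertexᵇ ψ u) → (∀ u v → edgeᵇ φ u v ≡ edgeᵇ ψ u v) →
              image F φ ≡ image F ψ
  image-ext φ ψ eqV eqE = cong₂ _,_ (VecP.tabulate-cong eqV) (VecP.tabulate-cong (λ u → VecP.tabulate-cong (eqE u)))

  vertexᵇ-lookup : ∀ {n} (φ : Vec (Fin n) b) a → T (vertexᵇ φ (lookup φ a))
  vertexᵇ-lookup φ a = ∈-any _ (∈-allFin a) (≡⇒==F {i = lookup φ a} refl)

  vertexᵇ⁻ : ∀ {n} (φ : Vec (Fin n) b) {u} → T (vertexᵇ φ u) → ∃ λ a → lookup φ a ≡ u
  vertexᵇ⁻ φ t = let a , _ , eq = any-∈ _ {allFin b} t in a , ==F⇒≡ eq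

  edgeᵇ-link : ∀ {n} (φ : Vec (Fin n) b) {e} → e ∈ links F → T (edgeᵇ φ (lookup φ (proj₁ e)) (lookup φ (proj₂ e)))
  edgeᵇ-link φ {u , v} e∈ = ∈-any _ {links F} e∈ (joins-T {u = lookup φ u} {v = lookup φ v} (inj₁ (refl , refl)))

  edgeᵇ⁻ : ∀ {n} (φ : Vec (Fin n) b) {u v} → T (edgeᵇ φ u v) →
           ∃ λ e → e ∈ links F × ((lookup φ (proj₁ e) ≡ u × lookup φ (proj₂ e) ≡ v) ⊎ (lookup φ (proj₁ e) ≡ v × lookup φ (proj₂ e) ≡ u))
  edgeᵇ⁻ φ {u} {v} t = let e , e∈ , j = any-∈ _ {links F} t in e , e∈ , T-joins {a = u} {v} {lookup φ (proj₁ e)} {lookup φ (proj₂ e)} j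

  edgeᵇ-intro : ∀ {n} (φ : Vec (Fin n) b) {u v e} → e ∈ links F →
                (lookup φ (proj₁ e) ≡ u × lookup φ (proj₂ e) ≡ v) ⊎ (lookup φ (proj₁ e) ≡ v × lookup φ (proj₂ e) ≡ u) → T (edgeᵇ φ u v)
  edgeᵇ-intro φ {e = e} e∈ j = ∈-any _ {links F} e∈ (joins-T {u = lookup φ (proj₁ e)} {lookup φ (proj₂ e)} j)

  module _ {n} (φ : Vec (Fin n) b) where

    private
      via : ∀ (σ : Vec (Fin b) b) a {p} → lookup σ a ≡ p → lookup (comp φ σ) a ≡ lookup φ p
      via σ a eq = trans (lookup-comp φ σ a) (cong (lookup φ) eq)

      push-vertex : ∀ (σ τ : Vec (Fin b) b) → image F σ ≡ image F τ → ∀ {u} → T (vertexᵇ (comp φ σ) u) → T (vertexᵇ (comp φ τ) u)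
      push-vertex σ τ eq {u} t =
        let a , φσa≡u  = vertexᵇ⁻ (comp φ σ) t
            c , τc≡σa = vertexᵇ⁻ τ (subst T (image-vertexᵇ σ τ eq (lookup σ a)) (vertexᵇ-lookup σ a))
        in subst (T ∘ vertexᵇ (comp φ τ)) (trans (via τ c τc≡σa) (trans (sym (lookup-comp φ σ a)) φσa≡u)) (vertexᵇ-lookup (comp φ τ) c)

      push-edge : ∀ (σ τ : Vec (Fin b) b) → image F σ ≡ image F τ → ∀ {u v} → T (edgeᵇ (comp φ σ) u v) → T (edgeᵇ (comp φ τ) u v)
      push-edge σ τ eq {u} {v} t with edgeᵇ⁻ (comp φ σ) t
      ... | e , e∈ , ends with edgeᵇ⁻ τ (subst T (image-edgeᵇ σ τ eq (lookup σ (proj₁ e)) (lookup σ (proj₂ e))) (edgeᵇ-link σ e∈))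
      ...   | (c , d) , e'∈ , ends' = edgeᵇ-intro (comp φ τ) e'∈ (combine ends' ends)
        where
        σ→τ : ∀ a c {w} → lookup τ c ≡ lookup σ a → lookup (comp φ σ) a ≡ w → lookup (comp φ τ) c ≡ w
        σ→τ a c eq eq' = trans (via τ c eq) (trans (sym (lookup-comp φ σ a)) eq')
        combine : _ → _ → _
        combine (inj₁ (p , q)) (inj₁ (r , s)) = inj₁ (σ→τ _ c p r , σ→τ _ d q s)
        combine (inj₁ (p , q)) (inj₂ (r , s)) = inj₂ (σ→τ _ c p r , σ→τ _ d q s)
        combine (inj₂ (p , q)) (inj₁ (r , s)) = inj₂ (σ→τ _ c p s , σ→τ _ d q r)
        combine (inj₂ (p , q)) (inj₂ (r , s)) = inj₁ (σ→τ _ c p s , σ→τ _ d q r)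

    -- The image under a composite is the image under `φ` of the vertex and edge sets hit by `σ`, so
    -- it depends on `σ` only through those sets.
    image-comp : ∀ (σ τ : Vec (Fin b) b) → image F σ ≡ image F τ → image F (comp φ σ) ≡ image F (comp φ τ)
    image-comp σ τ eq = image-ext (comp φ σ) (comp φ τ)
      (λ u → bool-ext (push-vertex σ τ eq) (push-vertex τ σ (sym eq)))
      (λ u v → bool-ext (push-edge σ τ eq) (push-edge τ σ (sym eq)))

    module _ (inj : Inj (lookup φ)) where

      private
        ==F-lookup : ∀ (σ : Vec (Fin b) b) a p → (lookup (comp φ σ) a ==F lookup φ p) ≡ (lookup σ a ==F p)
        ==F-lookup σ a p = bool-ext
          (λ t → ≡⇒==F (inj _ _ (trans (sym (lookup-comp φ σ a)) (==F⇒≡ t))))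
          (λ t → ≡⇒==F (via σ a (==F⇒≡ t)))

        pull-vertex : ∀ (σ : Vec (Fin b) b) p → vertexᵇ (comp φ σ) (lookup φ p) ≡ vertexᵇ σ p
        pull-vertex σ p = any-cong (allFin b) (λ a → ==F-lookup σ a p)

        pull-edge : ∀ (σ : Vec (Fin b) b) p q → edgeᵇ (comp φ σ) (lookup φ p) (lookup φ q) ≡ edgeᵇ σ p q
        pull-edge σ p q = any-cong (links F) (λ (u , v) → cong₂ _∨_
          (cong₂ _∧_ (==F-lookup σ u p) (==F-lookup σ v q)) (cong₂ _∧_ (==F-lookup σ u q) (==F-lookup σ v p)))

      -- Injectivity of `φ` lets the vertex and edge sets of `σ` be recovered by testing the
      -- composite image at vertices of the form `lookup φ p`.
      image-cancel : ∀ (σ τ : Vec (Fin b) b) → image F (comp φ σ) ≡ image F (comp φ τ) → image F σ ≡ image F τ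
      image-cancel σ τ eq = image-ext σ τ
        (λ p → trans (sym (pull-vertex σ p)) (trans (image-vertexᵇ (comp φ σ) (comp φ τ) eq (lookup φ p)) (pull-vertex τ p)))
        (λ p q → trans (sym (pull-edge σ p q)) (trans (image-edgeᵇ (comp φ σ) (comp φ τ) eq (lookup φ p) (lookup φ q)) (pull-edge τ p q)))

  module _ {n} (G : Graph n) where

    embeds : Vec (Fin n) b → Bool
    embeds φ = injectiveᵇ φ ∧ homᵇ G F φ

    -- Each link is sent by `σ` to a link of F, possibly reversed; the reversed case is where
    -- symmetry of the adjacency relation enters.
    hom-comp : ∀ φ σ → image F σ ≡ image F (identity b) → T (homᵇ G F φ) → T (homᵇ G F (comp φ σ))
    hom-comp φ σ eq hom = ∈-all _ {links F} step
      where
      φ-edge : ∀ {e} → e ∈ links F → T (adj G (lookup φ (proj₁ e)) (lookup φ (proj₂ e)))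
      φ-edge = all-∈ (λ e → adj G (lookup φ (proj₁ e)) (lookup φ (proj₂ e))) hom
      back : ∀ a c → lookup (identity b) c ≡ lookup σ a → lookup φ c ≡ lookup (comp φ σ) a
      back a c eq = trans (cong (lookup φ) (trans (sym (VecP.lookup∘tabulate id c)) eq)) (sym (lookup-comp φ σ a))
      step : ∀ {e} → e ∈ links F → T (adj G (lookup (comp φ σ) (proj₁ e)) (lookup (comp φ σ) (proj₂ e)))
      step {u , v} e∈ with edgeᵇ⁻ (identity b) (subst T (image-edgeᵇ σ (identity b) eq (lookup σ u) (lookup σ v)) (edgeᵇ-link σ e∈))
      ... | (c , d) , e'∈ , inj₁ (p , q) = subst T (cong₂ (adj G) (back u c p) (back v d q)) (φ-edge e'∈)
      ... | (c , d) , e'∈ , inj₂ (p , q) = subst T (trans (adj-sym G _ _) (cong₂ (adj G) (back u d q) (back v c p))) (φ-edge e'∈)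

    module _ (φ : Vec (Fin n) b) (φ-embeds : T (embeds φ)) where

      private
        φ-inj : Inj (lookup φ)
        φ-inj = injectiveᵇ⇒Inj φ (proj₁ (to T-∧ φ-embeds))

        same : Vec (Fin n) b → Bool
        same ψ = does (image F φ ≟S image F ψ)

      same⇒≡ : ∀ ψ → T (same ψ) → image F φ ≡ image F ψ
      same⇒≡ ψ t with yes eq ← image F φ ≟S image F ψ = eq

      translate : ∀ σ → embeds (comp φ σ) ∧ same (comp φ σ) ≡ automorphism F σ
      translate σ = bool-ext forward backward
        where
        forward : T (embeds (comp φ σ) ∧ same (comp φ σ)) → T (automorphism F σ)
        forward t =
          let emb , sm = to (T-∧ {embeds (comp φ σ)}) t
              eq = image-cancel φ φ-inj σ (identity b) (trans (sym (same⇒≡ (comp φ σ) sm)) (cong (image F) (sym (comp-identity φ))))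
          in from T-∧ ( Inj⇒injectiveᵇ σ (λ i j e → injectiveᵇ⇒Inj (comp φ σ) (proj₁ (to T-∧ emb)) i j
                          (trans (lookup-comp φ σ i) (trans (cong (lookup φ) e) (sym (lookup-comp φ σ j)))))
                      , from T-≡ (dec-true (image F σ ≟S image F (identity b)) eq) )
        backward : T (automorphism F σ) → T (embeds (comp φ σ) ∧ same (comp φ σ))
        backward t =
          let σ-inj , σ-im = to (T-∧ {injectiveᵇ σ}) t
              eq = image-eq σ-im
          in from T-∧ ( from T-∧ ( Inj⇒injectiveᵇ (comp φ σ) (λ i j e → injectiveᵇ⇒Inj σ σ-inj i j
                                     (φ-inj _ _ (trans (sym (lookup-comp φ σ i)) (trans e (lookup-comp φ σ j)))))
                                 , hom-comp φ σ eq (proj₂ (to (T-∧ {injectiveᵇ φ}) φ-embeds)) )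
                      , from T-≡ (dec-true (image F φ ≟S image F (comp φ σ))
                          (trans (cong (image F) (sym (comp-identity φ))) (sym (image-comp φ σ (identity b) eq)))) )
          where
          image-eq : T (does (image F σ ≟S image F (identity b))) → image F σ ≡ image F (identity b)
          image-eq t with yes eq ← image F σ ≟S image F (identity b) = eq

      factor : ∀ {ψ : Vec (Fin n) b} → (∀ a → ∃ λ c → lookup φ c ≡ lookup ψ a) → ∃ λ (σ : Vec (Fin b) b) → comp φ σ ≡ ψ
      factor f = Vec.tabulate (proj₁ ∘ f) , lookup-ext (λ i →
        trans (lookup-comp φ (Vec.tabulate (proj₁ ∘ f)) i)
              (trans (cong (lookup φ) (VecP.lookup∘tabulate (proj₁ ∘ f) i)) (proj₂ (f i))))

      factors? : ∀ (ψ : Vec (Fin n) b) → Dec (∃ λ (σ : Vec (Fin b) b) → comp φ σ ≡ ψ)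
      factors? ψ with all? (λ a → any? (λ c → lookup φ c ≟F lookup ψ a))
      ... | yes f = yes (factor f)
      ... | no ¬f = no (λ { (σ , refl) → ¬f (λ a → lookup σ a , sym (lookup-comp φ σ a)) })

      -- At most one term on the right is nonzero, since `φ` is injective and so `comp φ σ`
      -- determines `σ`. If `ψ` factors through `φ`, then `translate` identifies the two conditions
      -- on `σ`. If it does not, the vertex sets of the two images already differ and both sides
      -- vanish.
      fibre-pointwise : ∀ ψ → 𝟙 (embeds ψ) * 𝟙 (same ψ)
                        ≡ ∑ (allMaps b b) (λ σ → 𝟙 (automorphism F σ) * 𝟙 (does (ψ ≟V comp φ σ)))
      fibre-pointwise ψ with factors? ψ
      ... | yes (σ , refl) = sym (begin
        ∑ (allMaps b b) (λ τ → 𝟙 (automorphism F τ) * 𝟙 (does (comp φ σ ≟V comp φ τ)))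
          ≡⟨ ∑-cong (allMaps b b) (λ τ → trans (*-comm (𝟙 (automorphism F τ)) (𝟙 (does (comp φ σ ≟V comp φ τ)))) (cong (λ t → 𝟙 t * 𝟙 (automorphism F τ)) (cancel τ))) ⟩
        ∑ (allMaps b b) (λ τ → 𝟙 (does (τ ≟V σ)) * 𝟙 (automorphism F τ))
          ≡⟨ enumerates-allMaps b b σ (𝟙 ∘ automorphism F) ⟩
        𝟙 (automorphism F σ)
          ≡⟨ trans (cong 𝟙 (sym (translate σ))) (𝟙-∧ (embeds (comp φ σ)) (same (comp φ σ))) ⟩
        𝟙 (embeds (comp φ σ)) * 𝟙 (same (comp φ σ)) ∎)
        where
        open ≡-Reasoning
        cancel : ∀ τ → does (comp φ σ ≟V comp φ τ) ≡ does (τ ≟V σ)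
        cancel τ with τ ≟V σ
        ... | yes refl = dec-true (comp φ σ ≟V comp φ σ) refl
        ... | no  τ≢σ  = dec-false (comp φ σ ≟V comp φ τ) (λ eq → τ≢σ (lookup-ext (λ i → φ-inj _ _
                           (trans (sym (lookup-comp φ τ i)) (trans (cong (λ v → lookup v i) (sym eq)) (lookup-comp φ σ i))))))
      ... | no ¬σ = trans
        (trans (cong (λ t → 𝟙 (embeds ψ) * 𝟙 t) (dec-false (image F φ ≟S image F ψ) different)) (*-zeroʳ (𝟙 (embeds ψ))))
        (sym (trans (∑-cong (allMaps b b) (λ σ → trans (cong (λ t → 𝟙 (automorphism F σ) * 𝟙 t) (dec-false (ψ ≟V comp φ σ) (λ eq → ¬σ (σ , sym eq))))
                                                       (*-zeroʳ (𝟙 (automorphism F σ)))))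
                    (∑-zero (allMaps b b))))
        where
        different : image F φ ≢ image F ψ
        different eq = ¬σ (factor (λ a →
          vertexᵇ⁻ φ (subst T (sym (image-vertexᵇ φ ψ eq (lookup ψ a))) (vertexᵇ-lookup ψ a))))

      fibre : ∑ (filterᵇ embeds (allMaps n b)) (𝟙 ∘ same) ≡ ℚ[ #Aut F ]
      fibre = begin
        ∑ (filterᵇ embeds (allMaps n b)) (𝟙 ∘ same)
          ≡⟨ ∑-filter embeds (allMaps n b) (𝟙 ∘ same) ⟩
        ∑ (allMaps n b) (λ ψ → 𝟙 (embeds ψ) * 𝟙 (same ψ))
          ≡⟨ ∑-cong (allMaps n b) fibre-pointwise ⟩
        ∑ (allMaps n b) (λ ψ → ∑ (allMaps b b) (λ σ → 𝟙 (automorphism F σ) * 𝟙 (does (ψ ≟V comp φ σ))))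
          ≡⟨ ∑-swap (allMaps n b) (allMaps b b) (λ ψ σ → 𝟙 (automorphism F σ) * 𝟙 (does (ψ ≟V comp φ σ))) ⟩
        ∑ (allMaps b b) (λ σ → ∑ (allMaps n b) (λ ψ → 𝟙 (automorphism F σ) * 𝟙 (does (ψ ≟V comp φ σ))))
          ≡⟨ ∑-cong (allMaps b b) (λ σ → trans (∑-cong (allMaps n b) (λ ψ → *-comm (𝟙 (automorphism F σ)) (𝟙 (does (ψ ≟V comp φ σ)))))
                                               (enumerates-allMaps n b (comp φ σ) (λ _ → 𝟙 (automorphism F σ)))) ⟩
        ∑ (allMaps b b) (𝟙 ∘ automorphism F)
          ≡⟨ ℚ[length-filter] (automorphism F) (allMaps b b) ⟨
        ℚ[ #Aut F ] ∎
        where open ≡-Reasoning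

    -- Double counting of pairs of an embedding and its image: every embedding meets exactly one
    -- entry of the deduplicated list, and every entry is met by `#Aut F` embeddings.
    #Aut*count : ℚ[ #Aut F ] * # F ⟨ G ⟩ ≡ ∑ (allMaps n b) (𝟙 ∘ embeds)
    #Aut*count = sym (begin
      ∑ (allMaps n b) (𝟙 ∘ embeds)
        ≡⟨ trans (sym (ℚ[length-filter] embeds (allMaps n b))) (ℚ[length] L) ⟩
      ∑ L (λ _ → 1ℚ)
        ≡⟨ ∑-cong-∈ L (λ φ φ∈L → ∑-unique _≟S_ (λ _ → 1ℚ) (deduplicate-! _≟S_ (map (image F) L)) (∈-deduplicate⁺ _≟S_ (∈-map⁺ (image F) φ∈L))) ⟨
      ∑ L (λ φ → ∑ D (λ S → 𝟙 (does (S ≟S image F φ)) * 1ℚ))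
        ≡⟨ ∑-swap L D (λ φ S → 𝟙 (does (S ≟S image F φ)) * 1ℚ) ⟩
      ∑ D (λ S → ∑ L (λ φ → 𝟙 (does (S ≟S image F φ)) * 1ℚ))
        ≡⟨ ∑-cong-∈ D fibre-of ⟩
      ∑ D (λ S → ℚ[ #Aut F ] * 1ℚ)
        ≡⟨ trans (∑-*ˡ D ℚ[ #Aut F ] (λ _ → 1ℚ)) (cong (ℚ[ #Aut F ] *_) (sym (trans (cong ℚ[_] count≡) (ℚ[length] D)))) ⟩
      ℚ[ #Aut F ] * # F ⟨ G ⟩ ∎)
      where
      open ≡-Reasoning
      L : List (Vec (Fin n) b)
      L = filterᵇ embeds (allMaps n b)
      D : List (Subgraph n)
      D = deduplicate _≟S_ (map (image F) L)
      count≡ : count G F ≡ length D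
      count≡ = refl
      fibre-of : ∀ S → S ∈ D → ∑ L (λ φ → 𝟙 (does (S ≟S image F φ)) * 1ℚ) ≡ ℚ[ #Aut F ] * 1ℚ
      fibre-of S S∈D =
        let φ , φ∈L , S≡ = ∈-map⁻ (image F) (∈-deduplicate⁻ _≟S_ (map (image F) L) S∈D)
        in trans (∑-cong L (λ ψ → trans (*-identityʳ (𝟙 (does (S ≟S image F ψ)))) (cong (λ R → 𝟙 (does (R ≟S image F ψ))) S≡)))
                 (trans (fibre φ (proj₂ (∈-filter⁻ (T? ∘ embeds) {xs = allMaps n b} φ∈L))) (sym (*-identityʳ ℚ[ #Aut F ])))

-- Expansion into embedding numbers

-- Vertex variables are de Bruijn indices.
data Core (b : ℕ) : Set where
  con     : ℚᵘ → Core b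
  _⊕_ _⊗_ : Core b → Core b → Core b
  edge    : Fin b → Fin b → Core b
  neq     : Fin b → Fin b → Core b
  guard   : ℕ → Fin b → Core b
  sum     : Core (suc b) → Core b

infixl 6 _⊕_
infixl 7 _⊗_

-- An embedding problem: c pairwise distinct vertices, some pairs required to be adjacent, and
-- pairs (m , u) requiring deg u > m.
record Mono (c : ℕ) : Set where
  constructor mono
  field
    edges  : List (Fin c × Fin c)
    guards : List (ℕ × Fin c)
open Mono

Term : Set
Term = ℚᵘ × Σ ℕ Mono

_has_─_ : ∀ {c} → List (Fin c × Fin c) → Fin c → Fin c → Bool
E has a ─ b = any (joins a b) E

rename : ∀ {c c'} → (Fin c → Fin c') → Mono c → Mono c'
rename p (mono E H) = mono (map (λ (u , v) → p u , p v) E) (map (λ (m , u) → m , p u) H)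

-- The last argument says where the `c` variables known to the caller have gone, since expanding a
-- factor may introduce further vertices and shift the indices.
Cont : ℕ → Set
Cont c = ∀ c' → ℚᵘ → Mono c' → (Fin c → Fin c') → List Term

-- Expands q · Σ M(x) · e(x ∘ ρ) · w(x), the sum over tuples x of c distinct vertices, where the
-- continuation k expands the remaining factor w.  Making the rest of a product a continuation
-- lets its bound variables be split against those already introduced by e.
norm : ∀ {b c} → Core b → ℚᵘ → Mono c → (Fin b → Fin c) → Cont c → List Term
norm (con p)     q M ρ k = k _ (p ℚᵘ.* q) M id
norm (e ⊕ f)     q M ρ k = norm e q M ρ k ++ norm f q M ρ k
norm (e ⊗ f)     q M ρ k = norm e q M ρ λ c' q' M' τ → norm f q' M' (τ ∘ ρ) λ c'' q'' M'' τ' → k c'' q'' M'' (τ' ∘ τ)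
norm (edge a b)  q M ρ k =
  if ρ a ==F ρ b then [] else
  if edges M has ρ a ─ ρ b then k _ q M id else
  k _ q (mono ((ρ a , ρ b) ∷ edges M) (guards M)) id
norm (neq a b)   q M ρ k = if ρ a ==F ρ b then [] else k _ q M id
norm (guard m a) q M ρ k = k _ q (mono (edges M) ((m , ρ a) ∷ guards M)) id
norm {c = c} (sum e) q M ρ k =
  norm e q (rename suc M) (cons zero (suc ∘ ρ)) (λ c' q' M' τ → k c' q' M' (τ ∘ suc))
  ++ concatMap (λ v → norm e q M (cons v ρ) k) (allFin c)

terms : Core 0 → List Term
terms e = norm {c = 0} e ℚᵘ.1ℚᵘ (mono [] []) (λ ()) (λ c q M _ → (q , c , M) ∷ [])

nbrs : ∀ {c} → List (Fin c × Fin c) → Fin c → List (Fin c)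
nbrs {c} E a = filterᵇ (E has a ─_) (allFin c)

implied : ∀ {c} → List (Fin c × Fin c) → ℕ × Fin c → Bool
implied E (m , a) = m <ᵇ length (nbrs E a)

dropGuards : ∀ {c} → Mono c → Mono c
dropGuards (mono E H) = mono E (filterᵇ (not ∘ implied E) H)

-- Candidates only: isIso rechecks them, so no property of search is needed.
search : ∀ {m c c'} → (Fin m → Fin c) → Mono c → Mono c' → List (Vec (Fin c') m)
search {zero}          f M M' = [] ∷ []
search {suc m} {c} {c'} f M M' =
  concatMap (λ p → mapMaybe (λ v → if fits v (f ∘ suc) p then just (v ∷ p) else nothing) (allFin c'))
            (search (f ∘ suc) M M')
  where
  fits : ∀ {m} → Fin c' → (Fin m → Fin c) → Vec (Fin c') m → Bool
  fits v h []      = true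
  fits v h (w ∷ p) = not (v ==F w) ∧ does ((edges M has f zero ─ h zero) ≟B (edges M' has v ─ w)) ∧ fits v (h ∘ suc) p

-- Inclusion of edges and guards as sets: order, repetition and the orientation of edges are
-- disregarded.
_⊑_ : ∀ {c} → Mono c → Mono c → Bool
mono E H ⊑ mono E' H' =
  all (λ (u , v) → E' has u ─ v) E ∧ all (λ (m , u) → any (λ (m' , u') → (m ≡ᵇ m') ∧ (u ==F u')) H') H

surjectiveᵇ : ∀ {c c'} → Vec (Fin c') c → Bool
surjectiveᵇ {c} {c'} p = all (λ v → any (λ a → lookup p a ==F v) (allFin c)) (allFin c')

isIso : ∀ {c c'} → Mono c → Mono c' → Vec (Fin c') c → Bool
isIso M M' p = (injectiveᵇ p ∧ surjectiveᵇ p) ∧ (rename (lookup p) M ⊑ M' ∧ M' ⊑ rename (lookup p) M)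

iso : ∀ {c c'} → Mono c → Mono c' → Bool
iso {c} {c'} M M' = (c ≡ᵇ c') ∧ any (isIso M M') (search id M M')

insert : Term → List Term → List Term
insert t [] = t ∷ []
insert (q , c , M) ((q' , c' , M') ∷ ts) =
  if iso M M' then (q ℚᵘ.+ q' , c' , M') ∷ ts else (q' , c' , M') ∷ insert (q , c , M) ts

-- Guards are dropped only here, once a monomial is complete: a guard is usually recorded before the
-- edges that imply it.
collect : List Term → List Term
collect = foldr (λ (q , c , M) → insert (q , c , dropGuards M)) []

-- An unreduced zero may carry any denominator, so only the numerator is inspected.
isZero : ℚᵘ → Bool
isZero (mkℚᵘ (ℤ.+ 0) _) = true
isZero _                = false

vanishes : Core 0 → Bool
vanishes e = all (isZero ∘ proj₁) (collect (terms e))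

-- Soundness of the expansion

module Semantics {n : ℕ} (G : Graph n) where

  ⟦_⟧ : ∀ {b} → Core b → (Fin b → Fin n) → ℚ
  ⟦ con q ⟧     ρ = fromℚᵘ q
  ⟦ e ⊕ f ⟧     ρ = ⟦ e ⟧ ρ + ⟦ f ⟧ ρ
  ⟦ e ⊗ f ⟧     ρ = ⟦ e ⟧ ρ * ⟦ f ⟧ ρ
  ⟦ edge a b ⟧  ρ = 𝟙 (adj G (ρ a) (ρ b))
  ⟦ neq a b ⟧   ρ = 𝟙 (ρ a ≢ᵇ ρ b)
  ⟦ guard m a ⟧ ρ = 𝟙 (m <ᵇ deg G (ρ a))
  ⟦ sum e ⟧     ρ = ∑ (allFin n) (λ y → ⟦ e ⟧ (cons y ρ))

  ⟦⟧-ext : ∀ {b} (e : Core b) → Ext ⟦ e ⟧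
  ⟦⟧-ext (con q)     eq = refl
  ⟦⟧-ext (e ⊕ f)     eq = cong₂ _+_ (⟦⟧-ext e eq) (⟦⟧-ext f eq)
  ⟦⟧-ext (e ⊗ f)     eq = cong₂ _*_ (⟦⟧-ext e eq) (⟦⟧-ext f eq)
  ⟦⟧-ext (edge a b)  eq = cong₂ (λ u v → 𝟙 (adj G u v)) (eq a) (eq b)
  ⟦⟧-ext (neq a b)   eq = cong₂ (λ u v → 𝟙 (u ≢ᵇ v)) (eq a) (eq b)
  ⟦⟧-ext (guard m a) eq = cong (λ u → 𝟙 (m <ᵇ deg G u)) (eq a)
  ⟦⟧-ext (sum e)     eq = ∑-cong (allFin n) (λ y → ⟦⟧-ext e (cons-cong y eq))

  edgeHolds : ∀ {c} → (Fin c → Fin n) → Fin c × Fin c → Bool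
  edgeHolds x (u , v) = adj G (x u) (x v)

  guardHolds : ∀ {c} → (Fin c → Fin n) → ℕ × Fin c → Bool
  guardHolds x (m , u) = m <ᵇ deg G (x u)

  holds : ∀ {c} → Mono c → (Fin c → Fin n) → Bool
  holds (mono E H) x = all (edgeHolds x) E ∧ all (guardHolds x) H

  holds-ext : ∀ {c} (M : Mono c) → Ext (holds M)
  holds-ext (mono E H) eq = cong₂ _∧_
    (all-cong E (λ (u , v) → cong₂ (adj G) (eq u) (eq v))) (all-cong H (λ (m , u) → cong (λ w → m <ᵇ deg G w) (eq u)))

  holds-rename : ∀ {c c'} (p : Fin c → Fin c') (M : Mono c) x → holds (rename p M) x ≡ holds M (x ∘ p)
  holds-rename p (mono E H) x = cong₂ _∧_ (all-map _ E) (all-map _ H)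

  has⇒adj : ∀ {c} (E : List (Fin c × Fin c)) {a b x} → T (E has a ─ b) → T (all (edgeHolds x) E) → T (adj G (x a) (x b))
  has⇒adj E {a} {b} {x} E∋ab E-holds with any-∈ (joins a b) {E} E∋ab
  ... | (u , v) , e∈E , j with T-joins {a = a} {b} {u} {v} j | all-∈ (edgeHolds x) E-holds e∈E
  ...   | inj₁ (refl , refl) | uv = uv
  ...   | inj₂ (refl , refl) | uv = subst T (adj-sym G (x u) (x v)) uv

  value : Term → ℚ
  value (q , c , M) = fromℚᵘ q * ∑ⁱ c (λ x → 𝟙 (holds M x))

  -- All later monomials and renamings are quantified over, because `w` is expanded only after other
  -- factors may have added vertices and edges.
  Sound : ∀ {c} → Cont c → ((Fin c → Fin n) → ℚ) → Set
  Sound k w = ∀ c' q M τ → ∑ (k c' q M τ) value ≡ fromℚᵘ q * ∑ⁱ c' (λ x → 𝟙 (holds M x) * w (x ∘ τ))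

  -- Induction on `e` for all pending factors `w` at once: in a product the right factor joins `w`,
  -- and in a sum `∑-split` matches the two lists of terms, one for a new vertex and one for each
  -- coincidence with an old one.
  norm-sound : ∀ {b c} (e : Core b) q (M : Mono c) ρ k w → Ext w → Sound k w →
               ∑ (norm e q M ρ k) value ≡ fromℚᵘ q * ∑ⁱ c (λ x → 𝟙 (holds M x) * (⟦ e ⟧ (x ∘ ρ) * w x))
  norm-sound {c = c} (con p) q M ρ k w ext snd = begin
    ∑ (k c (p ℚᵘ.* q) M id) value
      ≡⟨ snd c (p ℚᵘ.* q) M id ⟩
    fromℚᵘ (p ℚᵘ.* q) * ∑ⁱ c (λ x → 𝟙 (holds M x) * w x)
      ≡⟨ cong (_* _) (fromℚᵘ-* p q) ⟩
    (fromℚᵘ p * fromℚᵘ q) * ∑ⁱ c (λ x → 𝟙 (holds M x) * w x)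
      ≡⟨ *-assoc-exchange (fromℚᵘ p) (fromℚᵘ q) _ ⟩
    fromℚᵘ q * (fromℚᵘ p * ∑ⁱ c (λ x → 𝟙 (holds M x) * w x))
      ≡⟨ cong (fromℚᵘ q *_) (sym (trans (∑ⁱ-cong c (λ x _ → *-exchange (𝟙 (holds M x)) (fromℚᵘ p) (w x))) (∑ⁱ-*ˡ c (fromℚᵘ p) _))) ⟩
    fromℚᵘ q * ∑ⁱ c (λ x → 𝟙 (holds M x) * (fromℚᵘ p * w x)) ∎
    where open ≡-Reasoning
  norm-sound {c = c} (e ⊕ f) q M ρ k w ext snd = begin
    ∑ (norm e q M ρ k ++ norm f q M ρ k) value
      ≡⟨ ∑-++ (norm e q M ρ k) _ value ⟩
    ∑ (norm e q M ρ k) value + ∑ (norm f q M ρ k) value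
      ≡⟨ cong₂ _+_ (norm-sound e q M ρ k w ext snd) (norm-sound f q M ρ k w ext snd) ⟩
    fromℚᵘ q * ∑ⁱ c (W e) + fromℚᵘ q * ∑ⁱ c (W f)
      ≡⟨ *-distribˡ-+ (fromℚᵘ q) (∑ⁱ c (W e)) (∑ⁱ c (W f)) ⟨
    fromℚᵘ q * (∑ⁱ c (W e) + ∑ⁱ c (W f))
      ≡⟨ cong (fromℚᵘ q *_) (sym (trans (∑ⁱ-cong c (λ x _ → *-distrib-middle (𝟙 (holds M x)) (⟦ e ⟧ (x ∘ ρ)) (⟦ f ⟧ (x ∘ ρ)) (w x))) (∑ⁱ-+ c (W e) (W f)))) ⟩
    fromℚᵘ q * ∑ⁱ c (λ x → 𝟙 (holds M x) * ((⟦ e ⟧ (x ∘ ρ) + ⟦ f ⟧ (x ∘ ρ)) * w x)) ∎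
    where
    open ≡-Reasoning
    W : Core _ → (Fin c → Fin n) → ℚ
    W h x = 𝟙 (holds M x) * (⟦ h ⟧ (x ∘ ρ) * w x)
  norm-sound {c = c} (e ⊗ f) q M ρ k w ext snd = trans
    (norm-sound e q M ρ _ (λ x → ⟦ f ⟧ (x ∘ ρ) * w x) (λ eq → cong₂ _*_ (⟦⟧-ext f (λ i → eq (ρ i))) (ext eq))
      (λ c' q' M' τ → norm-sound f q' M' (τ ∘ ρ) _ (λ x → w (x ∘ τ)) (λ eq → ext (λ i → eq (τ i)))
        (λ c'' q'' M'' τ' → snd c'' q'' M'' (τ' ∘ τ))))
    (cong (fromℚᵘ q *_) (∑ⁱ-cong c (λ x _ → cong (𝟙 (holds M x) *_) (sym (*-assoc (⟦ e ⟧ (x ∘ ρ)) _ _)))))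
  norm-sound {c = c} (edge a b) q M ρ k w ext snd with ρ a ≟F ρ b
  ... | yes ρa≡ρb = sym (trans (cong (fromℚᵘ q *_) (∑ⁱ-zero c (λ x →
          trans (cong (λ t → 𝟙 (holds M x) * (𝟙 t * w x)) (trans (cong (λ t → adj G (x (ρ a)) (x t)) (sym ρa≡ρb)) (irrefl G (x (ρ a)))))
                (trans (cong (𝟙 (holds M x) *_) (*-zeroˡ (w x))) (*-zeroʳ (𝟙 (holds M x)))))))
        (*-zeroʳ (fromℚᵘ q)))
  ... | no  _ with edges M has ρ a ─ ρ b in E∋ab
  -- An indicator is idempotent, so an edge that `M` already requires contributes nothing new and
  -- edges never acquire multiplicities.
  ...   | true  = trans (snd c q M id) (cong (fromℚᵘ q *_) (∑ⁱ-cong c (λ x _ → absorb x)))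
    where
    absorb : ∀ x → 𝟙 (holds M x) * w x ≡ 𝟙 (holds M x) * (𝟙 (adj G (x (ρ a)) (x (ρ b))) * w x)
    absorb x with holds M x in Mx
    ... | false = trans (*-zeroˡ (w x)) (sym (*-zeroˡ (𝟙 (adj G (x (ρ a)) (x (ρ b))) * w x)))
    ... | true  = cong (1ℚ *_) (sym (trans (cong (λ t → 𝟙 t * w x)
                    (to T-≡ (has⇒adj (edges M) {x = x} (from T-≡ E∋ab) (proj₁ (to T-∧ (from T-≡ Mx)))))) (*-identityˡ (w x))))
  ...   | false = trans (snd c q _ id) (cong (fromℚᵘ q *_) (∑ⁱ-cong c (λ x _ → extend x)))
    where
    extend : ∀ x → 𝟙 (holds (mono ((ρ a , ρ b) ∷ edges M) (guards M)) x) * w x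
                   ≡ 𝟙 (holds M x) * (𝟙 (adj G (x (ρ a)) (x (ρ b))) * w x)
    extend x with adj G (x (ρ a)) (x (ρ b))
    ... | true  = cong (𝟙 (holds M x) *_) (sym (*-identityˡ (w x)))
    ... | false = trans (*-zeroˡ (w x)) (sym (trans (cong (𝟙 (holds M x) *_) (*-zeroˡ (w x))) (*-zeroʳ (𝟙 (holds M x)))))
  norm-sound {c = c} (neq a b) q M ρ k w ext snd with ρ a ≟F ρ b
  ... | yes ρa≡ρb = sym (trans (cong (fromℚᵘ q *_) (∑ⁱ-zero c (λ x →
          trans (cong (λ t → 𝟙 (holds M x) * (𝟙 (not t) * w x)) (dec-true (x (ρ a) ≟F x (ρ b)) (cong x ρa≡ρb)))
                (trans (cong (𝟙 (holds M x) *_) (*-zeroˡ (w x))) (*-zeroʳ (𝟙 (holds M x)))))))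
        (*-zeroʳ (fromℚᵘ q)))
  -- Different variables denote different vertices because only injective tuples are summed, so the
  -- factor is 1.
  ... | no  ρa≢ρb = trans (snd c q M id) (cong (fromℚᵘ q *_) (∑ⁱ-cong c (λ x inj →
          cong (𝟙 (holds M x) *_) (sym (trans (cong (λ t → 𝟙 (not t) * w x) (dec-false (x (ρ a) ≟F x (ρ b)) (λ eq → ρa≢ρb (inj _ _ eq)))) (*-identityˡ (w x)))))))
  norm-sound {c = c} (guard m a) q M ρ k w ext snd = trans (snd c q _ id) (cong (fromℚᵘ q *_) (∑ⁱ-cong c (λ x _ → extend x)))
    where
    extend : ∀ x → 𝟙 (holds (mono (edges M) ((m , ρ a) ∷ guards M)) x) * w x
                   ≡ 𝟙 (holds M x) * (𝟙 (m <ᵇ deg G (x (ρ a))) * w x)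
    extend x with m <ᵇ deg G (x (ρ a)) | all (edgeHolds x) (edges M)
    ... | true  | t     = cong (𝟙 (t ∧ all (guardHolds x) (guards M)) *_) (sym (*-identityˡ (w x)))
    ... | false | true  = trans (*-zeroˡ (w x)) (sym (trans (cong (𝟙 (all (guardHolds x) (guards M)) *_) (*-zeroˡ (w x))) (*-zeroʳ (𝟙 (all (guardHolds x) (guards M))))))
    ... | false | false = trans (*-zeroˡ (w x)) (sym (*-zeroˡ (0ℚ * w x)))
  norm-sound {c = c} (sum e) q M ρ k w ext snd = begin
    ∑ (norm e q (rename suc M) (cons zero (suc ∘ ρ)) k↑ ++ concatMap (λ v → norm e q M (cons v ρ) k) (allFin c)) value
      ≡⟨ trans (∑-++ (norm e q (rename suc M) (cons zero (suc ∘ ρ)) k↑) _ value) (cong (∑ (norm e q (rename suc M) (cons zero (suc ∘ ρ)) k↑) value +_) (∑-concatMap (λ v → norm e q M (cons v ρ) k) (allFin c) value)) ⟩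
    ∑ (norm e q (rename suc M) (cons zero (suc ∘ ρ)) k↑) value + ∑ (allFin c) (λ v → ∑ (norm e q M (cons v ρ) k) value)
      ≡⟨ cong₂ _+_ new old ⟩
    fromℚᵘ q * ∑ⁱ c (λ x → H x * (∑ (allFin n) (λ y → 𝟙 (fresh y x) * val x y) * w x))
      + fromℚᵘ q * ∑ⁱ c (λ x → H x * (∑ (allFin c) (val x ∘ x) * w x))
      ≡⟨ trans (sym (*-distribˡ-+ (fromℚᵘ q) (∑ⁱ c W₁) (∑ⁱ c W₂))) (cong (fromℚᵘ q *_) (sym (∑ⁱ-+ c W₁ W₂))) ⟩
    fromℚᵘ q * ∑ⁱ c (λ x → H x * (∑ (allFin n) (λ y → 𝟙 (fresh y x) * val x y) * w x) + H x * (∑ (allFin c) (val x ∘ x) * w x))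
      ≡⟨ cong (fromℚᵘ q *_) (∑ⁱ-cong c (λ x inj → trans (sym (*-distrib-middle (H x) (∑ (allFin n) (λ y → 𝟙 (fresh y x) * val x y)) (∑ (allFin c) (val x ∘ x)) (w x))) (cong (λ s → H x * (s * w x)) (sym (∑-split x inj (val x)))))) ⟩
    fromℚᵘ q * ∑ⁱ c (λ x → H x * (∑ (allFin n) (val x) * w x)) ∎
    where
    open ≡-Reasoning
    k↑ : Cont (suc c)
    k↑ c' q' M' τ = k c' q' M' (τ ∘ suc)
    H : (Fin c → Fin n) → ℚ
    H x = 𝟙 (holds M x)
    val : (Fin c → Fin n) → Fin n → ℚ
    val x y = ⟦ e ⟧ (cons y (x ∘ ρ))
    W₁ W₂ : (Fin c → Fin n) → ℚ
    W₁ x = H x * (∑ (allFin n) (λ y → 𝟙 (fresh y x) * val x y) * w x)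
    W₂ x = H x * (∑ (allFin c) (val x ∘ x) * w x)
    new-env : ∀ (x : Fin c → Fin n) y → cons y x ∘ cons zero (suc ∘ ρ) ≗ cons y (x ∘ ρ)
    new-env x y zero    = refl
    new-env x y (suc i) = refl
    old-env : ∀ (x : Fin c → Fin n) v → x ∘ cons v ρ ≗ cons (x v) (x ∘ ρ)
    old-env x v zero    = refl
    old-env x v (suc i) = refl
    new : ∑ (norm e q (rename suc M) (cons zero (suc ∘ ρ)) k↑) value
          ≡ fromℚᵘ q * ∑ⁱ c (λ x → H x * (∑ (allFin n) (λ y → 𝟙 (fresh y x) * val x y) * w x))
    new = trans (norm-sound e q (rename suc M) (cons zero (suc ∘ ρ)) k↑ (λ x → w (x ∘ suc)) (λ eq → ext (eq ∘ suc))
                  (λ c' q' M' τ → snd c' q' M' (τ ∘ suc)))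
      (cong (fromℚᵘ q *_) (trans (∑ⁱ-suc c (λ x → 𝟙 (holds (rename suc M) x) * (⟦ e ⟧ (x ∘ cons zero (suc ∘ ρ)) * w (x ∘ suc)))) (∑ⁱ-cong c (λ x _ →
        trans (∑-cong (allFin n) (λ y →
                trans (cong (𝟙 (fresh y x) *_) (cong₂ (λ h v → 𝟙 h * (v * w x)) (holds-rename suc M (cons y x)) (⟦⟧-ext e (new-env x y))))
                      (trans (*-rotate (𝟙 (fresh y x)) (H x) (val x y) (w x)) (sym (*-assoc (H x) (w x) (𝟙 (fresh y x) * val x y))))))
              (trans (∑-*ˡ (allFin n) (H x * w x) (λ y → 𝟙 (fresh y x) * val x y)) (trans (*-assoc (H x) (w x) (S x)) (cong (H x *_) (*-comm (w x) (S x)))))))))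
      where
      S : (Fin c → Fin n) → ℚ
      S x = ∑ (allFin n) (λ y → 𝟙 (fresh y x) * val x y)
    old : ∑ (allFin c) (λ v → ∑ (norm e q M (cons v ρ) k) value)
          ≡ fromℚᵘ q * ∑ⁱ c (λ x → H x * (∑ (allFin c) (val x ∘ x) * w x))
    old = trans (∑-cong (allFin c) (λ v → norm-sound e q M (cons v ρ) k w ext snd))
      (trans (∑-*ˡ (allFin c) (fromℚᵘ q) (λ v → ∑ⁱ c (λ x → H x * (⟦ e ⟧ (x ∘ cons v ρ) * w x)))) (cong (fromℚᵘ q *_) (trans (sym (∑ⁱ-swap c (allFin c) (λ x v → H x * (⟦ e ⟧ (x ∘ cons v ρ) * w x)))) (∑ⁱ-cong c (λ x _ →
        trans (∑-*ˡ (allFin c) (H x) (λ v → ⟦ e ⟧ (x ∘ cons v ρ) * w x)) (cong (H x *_) (trans (∑-*ʳ (allFin c) (w x) (λ v → ⟦ e ⟧ (x ∘ cons v ρ)))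
          (cong (_* w x) (∑-cong (allFin c) (λ v → ⟦⟧-ext e (old-env x v)))))))))))

  terms-sound : ∀ e → ⟦ e ⟧ (λ ()) ≡ ∑ (terms e) value
  terms-sound e = sym (trans
    (norm-sound {c = 0} e ℚᵘ.1ℚᵘ (mono [] []) (λ ()) _ (λ _ → 1ℚ) (λ _ → refl)
      (λ c q M _ → trans (+-identityʳ _) (cong (fromℚᵘ q *_) (∑ⁱ-cong c (λ x _ → sym (*-identityʳ _))))))
    -- The units removed are the initial coefficient, the distinctness of the empty tuple, the empty
    -- monomial and the factor of the final continuation.
    (trans (*-identityˡ _) (trans (*-identityˡ _) (trans (*-identityˡ _) (trans (*-identityʳ _) (⟦⟧-ext e (λ ())))))))

-- Soundness of dropping guards and merging isomorphic terms

module Collecting {n : ℕ} (G : Graph n) where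
  open Semantics G

  -- The neighbours of `a` in `E` are sent by the injective tuple `x` to different members of the
  -- neighbour list of `x a`, whose length is the degree.
  implied-sound : ∀ {c} (E : List (Fin c × Fin c)) h x → Inj x →
                  T (all (edgeHolds x) E) → T (implied E h) → T (guardHolds x h)
  implied-sound E (m , a) x inj E-holds m<nbrs = <⇒<ᵇ (ℕP.≤-trans (<ᵇ⇒< m _ m<nbrs)
    (subst (length (nbrs E a) ℕ.≤_) (sym (deg≡length G (x a))) (injective⇒≤ {f = f} (f-inj _ _))))
    where
    mem : ∀ i → x (List.lookup (nbrs E a) i) ∈ sel (adj G (x a))
    mem i = ∈-filter⁺ (T? ∘ adj G (x a)) (∈-allFin _)
      (has⇒adj E {x = x} (proj₂ (∈-filter⁻ (T? ∘ (E has a ─_)) {xs = allFin _} (∈-lookup i))) E-holds)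
    f : Fin (length (nbrs E a)) → Fin (length (sel (adj G (x a))))
    f i = Any.index (mem i)
    f-inj : ∀ i j → f i ≡ f j → i ≡ j
    f-inj i j eq = unique-lookup (filter⁺ (T? ∘ (E has a ─_)) (allFin⁺ _)) i j
      (inj _ _ (trans (lookup-index (mem i)) (trans (cong (List.lookup (sel (adj G (x a)))) eq) (sym (lookup-index (mem j))))))

  dropGuards-sound : ∀ {c} (M : Mono c) x → Inj x → holds M x ≡ holds (dropGuards M) x
  dropGuards-sound (mono E H) x inj with all (edgeHolds x) E in Ex
  ... | false = refl
  ... | true  = go H
    where
    go : ∀ H → all (guardHolds x) H ≡ all (guardHolds x) (filterᵇ (not ∘ implied E) H)
    go []      = refl
    go (h ∷ H) with implied E h in imp
    ... | true  = trans (cong (_∧ all (guardHolds x) H) (to T-≡ (implied-sound E h x inj (from T-≡ Ex) (from T-≡ imp)))) (go H)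
    ... | false = cong (guardHolds x h ∧_) (go H)

  ⊑-sound : ∀ {c} (M M' : Mono c) x → T (M ⊑ M') → T (holds M' x) → T (holds M x)
  ⊑-sound (mono E H) (mono E' H') x M⊑M' M'x =
    let E⊑E' , H⊑H' = to (T-∧ {all (λ (u , v) → E' has u ─ v) E}) M⊑M'
        E'x , H'x   = to (T-∧ {all (edgeHolds x) E'}) M'x
    in from T-∧ ( ∈-all (edgeHolds x) {E} (λ e∈E → has⇒adj E' {x = x} (all-∈ (λ (u , v) → E' has u ─ v) E⊑E' e∈E) E'x)
                , ∈-all (guardHolds x) {H} (λ {(m , u)} h∈H →
                    let (m' , u') , h'∈H' , same = any-∈ _ {H'} (all-∈ _ {H} H⊑H' h∈H)
                        m≡ᵇm' , u==u' = to (T-∧ {m ≡ᵇ m'}) same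
                    in subst T (cong₂ (λ k v → k <ᵇ deg G (x v)) (sym (≡ᵇ⇒≡ m m' m≡ᵇm')) (sym (==F⇒≡ u==u')))
                             (all-∈ (guardHolds x) H'x h'∈H')))

  isIso-sound : ∀ {c c'} (M : Mono c) (M' : Mono c') p → T (isIso M M' p) →
                ∑ⁱ c (λ x → 𝟙 (holds M x)) ≡ ∑ⁱ c' (λ x → 𝟙 (holds M' x))
  isIso-sound {c} {c'} M M' p t =
    trans (∑ⁱ-relabel (lookup p) (proj₁ ∘ preimage) (λ i → inj _ _ (proj₂ (preimage (lookup p i)))) (proj₂ ∘ preimage)
                      (λ x → 𝟙 (holds M x)) (λ eq → cong 𝟙 (holds-ext M eq)))
          (∑ⁱ-cong c' (λ x _ → cong 𝟙 (trans (sym (holds-rename (lookup p) M x)) (bool-ext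
            (⊑-sound M' (rename (lookup p) M) x (proj₂ (to (T-∧ {rename (lookup p) M ⊑ M'}) both)))
            (⊑-sound (rename (lookup p) M) M' x (proj₁ (to T-∧ both)))))))
    where
    bij = proj₁ (to T-∧ t)
    both = proj₂ (to (T-∧ {injectiveᵇ p ∧ surjectiveᵇ p}) t)
    inj = injectiveᵇ⇒Inj p (proj₁ (to T-∧ bij))
    preimage : ∀ v → ∃ λ a → lookup p a ≡ v
    preimage v = let a , _ , pa==v = any-∈ _ {allFin c} (all-∈ _ {allFin c'} (proj₂ (to (T-∧ {injectiveᵇ p}) bij)) (∈-allFin v))
                 in a , ==F⇒≡ pa==v

  iso-sound : ∀ {c c'} (M : Mono c) (M' : Mono c') → T (iso M M') →
              ∑ⁱ c (λ x → 𝟙 (holds M x)) ≡ ∑ⁱ c' (λ x → 𝟙 (holds M' x))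
  iso-sound {c} {c'} M M' t =
    let p , _ , p-iso = any-∈ (isIso M M') {search id M M'} (proj₂ (to (T-∧ {c ≡ᵇ c'}) t)) in isIso-sound M M' p p-iso

  insert-sound : ∀ t ts → ∑ (insert t ts) value ≡ value t + ∑ ts value
  insert-sound t [] = refl
  insert-sound (q , c , M) ((q' , c' , M') ∷ ts) with iso M M' in eq
  ... | true  = trans (cong (_+ rest) (trans (cong (_* S') (fromℚᵘ-+ q q')) (trans (*-distribʳ-+ S' (fromℚᵘ q) (fromℚᵘ q'))
                  (cong (λ s → fromℚᵘ q * s + fromℚᵘ q' * S') (sym (iso-sound M M' (from T-≡ eq)))))))
                  (+-assoc (value (q , c , M)) (value (q' , c' , M')) rest)
    where
    S' = ∑ⁱ c' (λ x → 𝟙 (holds M' x))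
    rest = ∑ ts value
  ... | false = trans (cong (value (q' , c' , M') +_) (insert-sound (q , c , M) ts))
                      (+-exchange (value (q' , c' , M')) (value (q , c , M)) (∑ ts value))

  collect-sound : ∀ ts → ∑ (collect ts) value ≡ ∑ ts value
  collect-sound []                = refl
  collect-sound ((q , c , M) ∷ ts) = trans (insert-sound (q , c , dropGuards M) (collect ts))
    (cong₂ _+_ (cong (fromℚᵘ q *_) (∑ⁱ-cong c (λ x inj → cong 𝟙 (sym (dropGuards-sound M x inj))))) (collect-sound ts))

  isZero-sound : ∀ q → T (isZero q) → fromℚᵘ q ≡ 0ℚ
  isZero-sound (mkℚᵘ (ℤ.+ 0) d) _ = fromℚᵘ-cong {mkℚᵘ (ℤ.+ 0) d} {ℚᵘ.0ℚᵘ} (ℚᵘ.*≡* refl)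

  vanishes-sound : ∀ e → vanishes e ≡ true → ⟦ e ⟧ (λ ()) ≡ 0ℚ
  vanishes-sound e eq = begin
    ⟦ e ⟧ (λ ())              ≡⟨ terms-sound e ⟩
    ∑ (terms e) value           ≡⟨ collect-sound (terms e) ⟨
    ∑ (collect (terms e)) value ≡⟨ zeros (collect (terms e)) (from T-≡ eq) ⟩
    0ℚ ∎
    where
    open ≡-Reasoning
    zeros : ∀ ts → T (all (isZero ∘ proj₁) ts) → ∑ ts value ≡ 0ℚ
    zeros []                 _ = refl
    zeros ((q , c , M) ∷ ts) t = cong₂ _+_
      (trans (cong (_* S) (isZero-sound q (proj₁ (to T-∧ t)))) (*-zeroˡ S)) (zeros ts (proj₂ (to (T-∧ {isZero q}) t)))
      where S = ∑ⁱ c (λ x → 𝟙 (holds M x))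

-- The expressions occurring in the identities

data BExp (b : ℕ) : Set where
  adjacent distinct : Fin b → Fin b → BExp b
  deg>  : ℕ → Fin b → BExp b
  _and_ : BExp b → BExp b → BExp b

infixr 6 _and_

-- The number of automorphisms is stored as a literal with its proof, so that the expansions divide
-- by a constant instead of enumerating self-maps again.
record Motif : Set where
  constructor motif
  field
    shape       : Graphlet
    order       : ℕ
    {{order≢0}} : ℕ.NonZero order
    #Aut≡       : #Aut shape ≡ order
open Motif

-- K, P and A are the paper's k_i, (g^r)_ij and g_ij; s within B counts copies of s in the subgraph
-- induced on the vertices satisfying B, whose variable zero is the vertex tested.
data Exp (b : ℕ) : Set where
  nat         : ℕ → Exp b
  K           : Fin b → Exp b
  P           : ℕ → Fin b → Fin b → Exp b
  A           : Fin b → Fin b → Exp b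
  _⊟_ _⊠_     : Exp b → Exp b → Exp b
  _÷_         : Exp b → (d : ℕ) → .{{_ : ℕ.NonZero d}} → Exp b
  _⇒_         : BExp b → Exp b → Exp b
  _choose_    : Exp b → ℕ → Exp b
  Σᵉ          : Exp (suc b) → Exp b
  #ᵉ          : Motif → Exp b
  _within_    : Motif → BExp (suc b) → Exp b

infixl 6 _⊟_
infixl 7 _⊠_
infixl 8 _÷_
infixr 5 _⇒_
infix  9 _choose_ _within_

natᶜ : ∀ {b} → ℕ → Core b
natᶜ m = con (mkℚᵘ (ℤ.+ m) 0)

negᶜ : ∀ {b} → Core b → Core b
negᶜ e = con (ℚᵘ.- ℚᵘ.1ℚᵘ) ⊗ e

oneᶜ : ∀ {b} → Core b
oneᶜ = con ℚᵘ.1ℚᵘ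

-- The case 1 is separate only to keep the expansion small.
path : ∀ {b} → ℕ → Fin b → Fin b → Core b
path 0             a c = oneᶜ ⊕ negᶜ (neq a c)
path 1             a c = edge a c
path (suc (suc r)) a c = sum (path (suc r) (suc a) zero ⊗ edge zero (suc c))

boolᶜ : ∀ {b c} → (Fin b → Fin c) → BExp b → Core c
boolᶜ f (adjacent a c) = edge (f a) (f c)
boolᶜ f (distinct a c) = neq (f a) (f c)
boolᶜ f (deg> m a)     = guard m (f a)
boolᶜ f (B and C)      = boolᶜ f B ⊗ boolᶜ f C

fallingᶜ : ∀ {b} → Core b → ℕ → Core b
fallingᶜ e zero    = oneᶜ
fallingᶜ e (suc r) = fallingᶜ e r ⊗ (e ⊕ negᶜ (natᶜ r))

prodᶜ : ∀ {b} {A : Set} → List A → (A → Core b) → Core b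
prodᶜ []       f = oneᶜ
prodᶜ (x ∷ xs) f = f x ⊗ prodᶜ xs f

sums : ∀ {b} m → Core (m ℕ.+ b) → Core b
sums zero    e = e
sums (suc m) e = sums m (sum e)

-- The constant 1/d; `mkℚᵘ` stores the denominator minus one.
overᶜ : ∀ {b} → ℕ → Core b
overᶜ d = con (mkℚᵘ (ℤ.+ 1) (ℕ.pred d))

-- Distinctness is imposed for both orders of each pair, so that the product mirrors `injectiveᵇ`
-- factor by factor.
homᶜ : ∀ {b} (F : Graphlet) → Core (size F ℕ.+ b)
homᶜ {b} F =
  prodᶜ (links F) (λ (u , v) → edge (u ↑ˡ b) (v ↑ˡ b))
  ⊗ prodᶜ (allFin (size F)) (λ u → prodᶜ (allFin (size F)) (λ v → if u ==F v then oneᶜ else neq (u ↑ˡ b) (v ↑ˡ b)))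

desugar : ∀ {b} → Exp b → Core b
desugar (nat m)      = natᶜ m
desugar (K a)        = sum (edge (suc a) zero)
desugar (P r a c)    = path r a c
desugar (A a c)      = edge a c
desugar (e ⊟ f)      = desugar e ⊕ negᶜ (desugar f)
desugar (e ⊠ f)      = desugar e ⊗ desugar f
desugar (e ÷ d)      = desugar e ⊗ overᶜ d
desugar (B ⇒ e)      = boolᶜ id B ⊗ desugar e
desugar (e choose r) = fallingᶜ (desugar e) r ⊗ overᶜ (fact r)
desugar (Σᵉ e)       = sum (desugar e)
desugar (#ᵉ s)       = overᶜ (order s) ⊗ sums (size (shape s)) (homᶜ (shape s))
desugar {b} (s within B) = overᶜ (order s) ⊗ sums (size (shape s)) (homᶜ (shape s)
  ⊗ prodᶜ (allFin (size (shape s))) (λ v → boolᶜ (cons (v ↑ˡ b) (size (shape s) ↑ʳ_)) B))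

Σ≠ᵉ ΣE⋆ᵉ : ∀ {b} → Exp (suc (suc b)) → Exp b
Σ≠ᵉ e  = Σᵉ (Σᵉ (distinct (suc zero) zero ⇒ e))
ΣE⋆ᵉ e = Σᵉ (Σᵉ (adjacent (suc zero) zero ⇒ e))

-- Soundness of the translation of expressions

recip : ∀ d .{{_ : ℕ.NonZero d}} → fromℚᵘ (mkℚᵘ (ℤ.+ 1) (ℕ.pred d)) * ℚ[ d ] ≡ 1ℚ
recip (suc d) = trans (sym (fromℚᵘ-* (mkℚᵘ (ℤ.+ 1) d) (mkℚᵘ (ℤ.+ suc d) 0)))
  (fromℚᵘ-cong {mkℚᵘ (ℤ.+ 1) d ℚᵘ.* mkℚᵘ (ℤ.+ suc d) 0} {ℚᵘ.1ℚᵘ} (ℚᵘ.*≡* (trans (ℤP.*-identityʳ _)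
    (trans (ℤP.*-identityˡ (ℤ.+ suc d)) (sym (trans (ℤP.*-identityˡ _) (cong (λ m → ℤ.+ suc m) (ℕP.*-identityʳ d))))))))

ℚ[sumℕ] : ∀ {n} (f : Fin n → ℕ) → ℚ[ sumℕ f ] ≡ ∑ (allFin n) (λ y → ℚ[ f y ])
ℚ[sumℕ] {n} f = go (allFin n)
  where
  go : ∀ ys → ℚ[ foldr ℕ._+_ 0 (map f ys) ] ≡ ∑ ys (λ y → ℚ[ f y ])
  go []       = refl
  go (y ∷ ys) = trans (ℚ[]-+ (f y) (foldr ℕ._+_ 0 (map f ys))) (cong (ℚ[ f y ] +_) (go ys))

ℚ[if] : ∀ t → ℚ[ if t then 1 else 0 ] ≡ 𝟙 t
ℚ[if] true  = refl
ℚ[if] false = refl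

∑ᵗ-tabulate : ∀ {n} c f → ∑ᵗ {n} c (f ∘ Vec.tabulate) ≡ ∑ (allMaps n c) f
∑ᵗ-tabulate     zero    f = sym (+-identityʳ (f []))
∑ᵗ-tabulate {n} (suc c) f = trans (∑-cong (allFin n) (λ y → ∑ᵗ-tabulate c (f ∘ (y ∷_)))) (sym (∑-allMaps-suc n c f))

all-allFin-suc : ∀ {c} (p : Fin (suc c) → Bool) → all p (allFin (suc c)) ≡ p zero ∧ all (p ∘ suc) (allFin c)
all-allFin-suc {c} p = cong (λ ps → p zero ∧ foldr _∧_ true ps) (trans (map-tabulate suc p) (sym (map-tabulate id (p ∘ suc))))

_⧺_ : ∀ {X : Set} {m b} → (Fin m → X) → (Fin b → X) → Fin (m ℕ.+ b) → X
_⧺_ {m = zero}  x ρ = ρ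
_⧺_ {m = suc m} x ρ = cons (x zero) ((x ∘ suc) ⧺ ρ)

⧺-↑ˡ : ∀ {X : Set} {m b} (x : Fin m → X) (ρ : Fin b → X) i → (x ⧺ ρ) (i ↑ˡ b) ≡ x i
⧺-↑ˡ x ρ zero    = refl
⧺-↑ˡ x ρ (suc i) = ⧺-↑ˡ (x ∘ suc) ρ i

⧺-↑ʳ : ∀ {X : Set} {m b} (x : Fin m → X) (ρ : Fin b → X) j → (x ⧺ ρ) (m ↑ʳ j) ≡ ρ j
⧺-↑ʳ {m = zero}  x ρ j = refl
⧺-↑ʳ {m = suc m} x ρ j = ⧺-↑ʳ (x ∘ suc) ρ j

module _ {n : ℕ} (G : Graph n) (p : Fin n → Bool) where
  private
    pick : Fin (length (sel p)) → Fin n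
    pick = List.lookup (sel p)

  ∑-sel : ∀ f → ∑ (allFin (length (sel p))) (f ∘ pick) ≡ ∑ (allFin n) (λ y → 𝟙 (p y) * f y)
  ∑-sel f = trans (cong (foldr _+_ 0ℚ) (trans (map-tabulate id (f ∘ pick))
                    (trans (sym (map-tabulate pick f)) (cong (map f) (tabulate-lookup (sel p))))))
                  (∑-filter p (allFin n) f)

  -- This moves a count in an induced subgraph into the ambient graph: `sel p` is a filtered list,
  -- so each coordinate ranging over it turns into an indicator of `p`.
  ∑ᵗ-sel : ∀ c {f} → Ext f → ∑ᵗ c (λ x → f (pick ∘ x)) ≡ ∑ᵗ c (λ x → f x * 𝟙 (all (p ∘ x) (allFin c)))
  ∑ᵗ-sel zero    {f} ext = trans (ext (λ ())) (sym (*-identityʳ (f (λ ()))))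
  ∑ᵗ-sel (suc c) {f} ext = begin
    ∑ (allFin (length (sel p))) (λ a → ∑ᵗ c (λ x → f (pick ∘ cons a x)))
      ≡⟨ ∑-cong (allFin (length (sel p))) (λ a → ∑ᵗ-cong c (λ x → ext {pick ∘ cons a x} {cons (pick a) (pick ∘ x)} λ { zero → refl ; (suc i) → refl })) ⟩
    ∑ (allFin (length (sel p))) (λ a → ∑ᵗ c (λ x → f (cons (pick a) (pick ∘ x))))
      ≡⟨ ∑-cong (allFin (length (sel p))) (λ a → ∑ᵗ-sel c {λ x → f (cons (pick a) x)} (λ eq → ext (cons-cong (pick a) eq))) ⟩
    ∑ (allFin (length (sel p))) (λ a → ∑ᵗ c (λ x → f (cons (pick a) x) * 𝟙 (all (p ∘ x) (allFin c))))
      ≡⟨ ∑-sel (λ y → ∑ᵗ c (λ x → f (cons y x) * 𝟙 (all (p ∘ x) (allFin c)))) ⟩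
    ∑ (allFin n) (λ y → 𝟙 (p y) * ∑ᵗ c (λ x → f (cons y x) * 𝟙 (all (p ∘ x) (allFin c))))
      ≡⟨ ∑-cong (allFin n) (λ y → trans (sym (∑ᵗ-*ˡ c (𝟙 (p y)) _)) (∑ᵗ-cong c (λ x → regroup y x))) ⟩
    ∑ (allFin n) (λ y → ∑ᵗ c (λ x → f (cons y x) * 𝟙 (all (p ∘ cons y x) (allFin (suc c))))) ∎
    where
    open ≡-Reasoning
    regroup : ∀ y x → 𝟙 (p y) * (f (cons y x) * 𝟙 (all (p ∘ x) (allFin c))) ≡ f (cons y x) * 𝟙 (all (p ∘ cons y x) (allFin (suc c)))
    regroup y x = trans (*-exchange (𝟙 (p y)) (f (cons y x)) (𝟙 (all (p ∘ x) (allFin c))))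
      (cong (f (cons y x) *_) (sym (trans (cong 𝟙 (all-allFin-suc (p ∘ cons y x))) (𝟙-∧ (p y) (all (p ∘ x) (allFin c))))))

  embeds-induce : ∀ F x → embeds F (induce G p) (Vec.tabulate x) ≡ embeds F G (Vec.tabulate (pick ∘ x))
  embeds-induce F x = cong₂ _∧_
    (bool-ext
      (λ t → Inj⇒injectiveᵇ (Vec.tabulate (pick ∘ x)) (λ i j eq → injectiveᵇ⇒Inj (Vec.tabulate x) t i j
        (trans (VecP.lookup∘tabulate x i) (trans (unique-lookup (sel-unique p) (x i) (x j)
          (trans (sym (VecP.lookup∘tabulate (pick ∘ x) i)) (trans eq (VecP.lookup∘tabulate (pick ∘ x) j))))
          (sym (VecP.lookup∘tabulate x j))))))
      (λ t → Inj⇒injectiveᵇ (Vec.tabulate x) (λ i j eq → injectiveᵇ⇒Inj (Vec.tabulate (pick ∘ x)) t i j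
        (trans (VecP.lookup∘tabulate (pick ∘ x) i) (trans (cong pick
          (trans (sym (VecP.lookup∘tabulate x i)) (trans eq (VecP.lookup∘tabulate x j))))
          (sym (VecP.lookup∘tabulate (pick ∘ x) j)))))))
    (all-cong (links F) (λ (u , v) → cong₂ (adj G) (move u) (move v)))
    where
    move : ∀ u → pick (lookup (Vec.tabulate x) u) ≡ lookup (Vec.tabulate (pick ∘ x)) u
    move u = trans (cong pick (VecP.lookup∘tabulate x u)) (sym (VecP.lookup∘tabulate (pick ∘ x) u))

count-∑ᵗ : ∀ {n} (G : Graph n) (s : Motif) →
           # shape s ⟨ G ⟩ ≡ fromℚᵘ (mkℚᵘ (ℤ.+ 1) (ℕ.pred (order s))) * ∑ᵗ (size (shape s)) (λ x → 𝟙 (embeds (shape s) G (Vec.tabulate x)))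
count-∑ᵗ {n} G s = begin
  N                                ≡⟨ *-identityˡ N ⟨
  1ℚ * N                           ≡⟨ cong (_* N) (recip (order s)) ⟨
  (r * ℚ[ order s ]) * N   ≡⟨ *-assoc r ℚ[ order s ] N ⟩
  r * (ℚ[ order s ] * N)   ≡⟨ cong (λ α → r * (ℚ[ α ] * N)) (#Aut≡ s) ⟨
  r * (ℚ[ #Aut (shape s) ] * N)    ≡⟨ cong (r *_) (#Aut*count (shape s) G) ⟩
  r * ∑ (allMaps n (size (shape s))) (𝟙 ∘ embeds (shape s) G)
    ≡⟨ cong (r *_) (∑ᵗ-tabulate (size (shape s)) (𝟙 ∘ embeds (shape s) G)) ⟨
  r * ∑ᵗ (size (shape s)) (λ x → 𝟙 (embeds (shape s) G (Vec.tabulate x))) ∎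
  where
  open ≡-Reasoning
  N = # shape s ⟨ G ⟩
  r = fromℚᵘ (mkℚᵘ (ℤ.+ 1) (ℕ.pred (order s)))

module Surface {n : ℕ} (G : Graph n) where
  open Semantics G
  open Collecting G

  evalᵇ : ∀ {b} → BExp b → (Fin b → Fin n) → Bool
  evalᵇ (adjacent a c) ρ = adj G (ρ a) (ρ c)
  evalᵇ (distinct a c) ρ = ρ a ≢ᵇ ρ c
  evalᵇ (deg> m a)     ρ = m <ᵇ deg G (ρ a)
  evalᵇ (B and C)      ρ = evalᵇ B ρ ∧ evalᵇ C ρ

  eval : ∀ {b} → Exp b → (Fin b → Fin n) → ℚ
  eval (nat m)      ρ = ℚ[ m ]
  eval (K a)        ρ = ℚ[ deg G (ρ a) ]
  eval (P r a c)    ρ = ℚ[ pw G r (ρ a) (ρ c) ]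
  eval (A a c)      ρ = ℚ[ g G (ρ a) (ρ c) ]
  eval (e ⊟ f)      ρ = eval e ρ - eval f ρ
  eval (e ⊠ f)      ρ = eval e ρ * eval f ρ
  eval (e ÷ d)      ρ = eval e ρ ÷ℕ d
  eval (B ⇒ e)      ρ = [ evalᵇ B ρ ]? eval e ρ
  eval (e choose r) ρ = binom (eval e ρ) r
  eval (Σᵉ e)       ρ = Σv (λ y → eval e (cons y ρ))
  eval (#ᵉ s)       ρ = # shape s ⟨ G ⟩
  eval (s within B) ρ = # shape s ⟨ induce G (λ y → evalᵇ B (cons y ρ)) ⟩

  evalᵇ-ext : ∀ {b} (B : BExp b) → Ext (evalᵇ B)
  evalᵇ-ext (adjacent a c) eq = cong₂ (adj G) (eq a) (eq c)
  evalᵇ-ext (distinct a c) eq = cong₂ _≢ᵇ_ (eq a) (eq c)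
  evalᵇ-ext (deg> m a)     eq = cong (λ u → m <ᵇ deg G u) (eq a)
  evalᵇ-ext (B and C)      eq = cong₂ _∧_ (evalᵇ-ext B eq) (evalᵇ-ext C eq)

  negᶜ-sound : ∀ {b} (e : Core b) ρ → ⟦ negᶜ e ⟧ ρ ≡ - ⟦ e ⟧ ρ
  negᶜ-sound e ρ = trans (sym (neg-distribˡ-* 1ℚ (⟦ e ⟧ ρ))) (cong -_ (*-identityˡ (⟦ e ⟧ ρ)))

  overᶜ-sound : ∀ {b} d .{{_ : ℕ.NonZero d}} (ρ : Fin b → Fin n) → ⟦ overᶜ d ⟧ ρ ≡ ℤ.+ 1 / d
  overᶜ-sound (suc d) ρ = refl

  path-sound : ∀ {b} r (a c : Fin b) ρ → ⟦ path r a c ⟧ ρ ≡ ℚ[ pw G r (ρ a) (ρ c) ]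
  path-sound 0 a c ρ = trans (cong (1ℚ +_) (negᶜ-sound (neq a c) ρ)) (complement (ρ a ==F ρ c))
    where
    complement : ∀ t → 1ℚ + - 𝟙 (not t) ≡ ℚ[ if t then 1 else 0 ]
    complement true  = refl
    complement false = refl
  path-sound 1 a c ρ = sym (begin
    ℚ[ sumℕ (λ l → idM (ρ a) l ℕ.* g G l (ρ c)) ]
      ≡⟨ ℚ[sumℕ] (λ l → idM (ρ a) l ℕ.* g G l (ρ c)) ⟩
    ∑ (allFin n) (λ l → ℚ[ idM (ρ a) l ℕ.* g G l (ρ c) ])
      ≡⟨ ∑-cong (allFin n) (λ l → trans (ℚ[]-* (idM (ρ a) l) (g G l (ρ c))) (cong₂ _*_
           (trans (ℚ[if] (ρ a ==F l)) (cong 𝟙 (does-sym _≟F_ (ρ a) l))) (ℚ[if] (adj G l (ρ c))))) ⟩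
    ∑ (allFin n) (λ l → 𝟙 (l ==F ρ a) * 𝟙 (adj G l (ρ c)))
      ≡⟨ enumerates-allFin n (ρ a) (λ l → 𝟙 (adj G l (ρ c))) ⟩
    𝟙 (adj G (ρ a) (ρ c)) ∎)
    where open ≡-Reasoning
  path-sound (suc (suc r)) a c ρ = sym (trans (ℚ[sumℕ] (λ l → pw G (suc r) (ρ a) l ℕ.* g G l (ρ c)))
    (∑-cong (allFin n) (λ l → trans (ℚ[]-* (pw G (suc r) (ρ a) l) (g G l (ρ c))) (cong₂ _*_
      (sym (path-sound (suc r) (suc a) zero (cons l ρ))) (ℚ[if] (adj G l (ρ c)))))))

  boolᶜ-sound : ∀ {b c} (f : Fin b → Fin c) (B : BExp b) ρ → ⟦ boolᶜ f B ⟧ ρ ≡ 𝟙 (evalᵇ B (ρ ∘ f))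
  boolᶜ-sound f (adjacent a c) ρ = refl
  boolᶜ-sound f (distinct a c) ρ = refl
  boolᶜ-sound f (deg> m a)     ρ = refl
  boolᶜ-sound f (B and C)      ρ = trans (cong₂ _*_ (boolᶜ-sound f B ρ) (boolᶜ-sound f C ρ))
                                         (sym (𝟙-∧ (evalᵇ B (ρ ∘ f)) (evalᵇ C (ρ ∘ f))))

  fallingᶜ-sound : ∀ {b} (e : Core b) {z} ρ → ⟦ e ⟧ ρ ≡ z → ∀ r → ⟦ fallingᶜ e r ⟧ ρ ≡ falling z r
  fallingᶜ-sound e ρ eq zero    = refl
  fallingᶜ-sound e ρ eq (suc r) = cong₂ _*_ (fallingᶜ-sound e ρ eq r) (cong₂ _+_ eq (negᶜ-sound (natᶜ r) ρ))

  prodᶜ-sound : ∀ {b} {X : Set} (xs : List X) (f : X → Core b) (p : X → Bool) ρ → (∀ x → ⟦ f x ⟧ ρ ≡ 𝟙 (p x)) →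
                ⟦ prodᶜ xs f ⟧ ρ ≡ 𝟙 (all p xs)
  prodᶜ-sound []       f p ρ eq = refl
  prodᶜ-sound (x ∷ xs) f p ρ eq = trans (cong₂ _*_ (eq x) (prodᶜ-sound xs f p ρ eq)) (sym (𝟙-∧ (p x) (all p xs)))

  sums-sound : ∀ {b} m (e : Core (m ℕ.+ b)) ρ → ⟦ sums m e ⟧ ρ ≡ ∑ᵗ m (λ x → ⟦ e ⟧ (x ⧺ ρ))
  sums-sound zero    e ρ = refl
  sums-sound (suc m) e ρ = trans (sums-sound m (sum e) ρ) (∑ᵗ-swap m (allFin n) (λ x y → ⟦ e ⟧ (cons y (x ⧺ ρ))))

  homᶜ-sound : ∀ {b} F x (ρ : Fin b → Fin n) → ⟦ homᶜ F ⟧ (x ⧺ ρ) ≡ 𝟙 (embeds F G (Vec.tabulate x))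
  homᶜ-sound {b} F x ρ = begin
    ⟦ homᶜ F ⟧ (x ⧺ ρ)
      ≡⟨ cong₂ _*_ (prodᶜ-sound (links F) _ _ (x ⧺ ρ) (λ (u , v) → cong₂ (λ w z → 𝟙 (adj G w z)) (at u) (at v)))
                   (prodᶜ-sound (allFin (size F)) _ _ (x ⧺ ρ) (λ u → prodᶜ-sound (allFin (size F)) _ _ (x ⧺ ρ) (λ v → pair u v))) ⟩
    𝟙 (homᵇ G F (Vec.tabulate x)) * 𝟙 (injectiveᵇ (Vec.tabulate x))
      ≡⟨ 𝟙-∧ (homᵇ G F (Vec.tabulate x)) (injectiveᵇ (Vec.tabulate x)) ⟨
    𝟙 (homᵇ G F (Vec.tabulate x) ∧ injectiveᵇ (Vec.tabulate x))
      ≡⟨ cong 𝟙 (∧-comm (homᵇ G F (Vec.tabulate x)) (injectiveᵇ (Vec.tabulate x))) ⟩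
    𝟙 (embeds F G (Vec.tabulate x)) ∎
    where
    open ≡-Reasoning
    at : ∀ u → (x ⧺ ρ) (u ↑ˡ b) ≡ lookup (Vec.tabulate x) u
    at u = trans (⧺-↑ˡ x ρ u) (sym (VecP.lookup∘tabulate x u))
    pair : ∀ u v → ⟦ if u ==F v then oneᶜ else neq (u ↑ˡ b) (v ↑ˡ b) ⟧ (x ⧺ ρ)
                   ≡ 𝟙 ((u ==F v) ∨ not (lookup (Vec.tabulate x) u ==F lookup (Vec.tabulate x) v))
    pair u v with u ==F v
    ... | true  = refl
    ... | false = cong₂ (λ w z → 𝟙 (w ≢ᵇ z)) (at u) (at v)

  desugar-sound : ∀ {b} (e : Exp b) ρ → ⟦ desugar e ⟧ ρ ≡ eval e ρ
  desugar-sound (nat m)      ρ = refl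
  desugar-sound (K a)        ρ = sym (trans (ℚ[sumℕ] (g G (ρ a))) (∑-cong (allFin n) (λ y → ℚ[if] (adj G (ρ a) y))))
  desugar-sound (P r a c)    ρ = path-sound r a c ρ
  desugar-sound (A a c)      ρ = sym (ℚ[if] (adj G (ρ a) (ρ c)))
  desugar-sound (e ⊟ f)      ρ = cong₂ _+_ (desugar-sound e ρ) (trans (negᶜ-sound (desugar f) ρ) (cong -_ (desugar-sound f ρ)))
  desugar-sound (e ⊠ f)      ρ = cong₂ _*_ (desugar-sound e ρ) (desugar-sound f ρ)
  desugar-sound (e ÷ d)      ρ = cong₂ _*_ (desugar-sound e ρ) (overᶜ-sound d ρ)
  desugar-sound (B ⇒ e)      ρ = trans (cong₂ _*_ (boolᶜ-sound id B ρ) (desugar-sound e ρ)) (sym ([]?-𝟙 (evalᵇ B ρ) (eval e ρ)))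
  desugar-sound (e choose r) ρ = cong₂ _*_ (fallingᶜ-sound (desugar e) ρ (desugar-sound e ρ) r) (overᶜ-sound (fact r) {{fact-nz r}} ρ)
  desugar-sound (Σᵉ e)       ρ = ∑-cong (allFin n) (λ y → desugar-sound e (cons y ρ))
  desugar-sound (#ᵉ s)       ρ = trans (cong (fromℚᵘ (mkℚᵘ (ℤ.+ 1) (ℕ.pred (order s))) *_)
    (trans (sums-sound (size (shape s)) (homᶜ (shape s)) ρ) (∑ᵗ-cong (size (shape s)) (λ x → homᶜ-sound (shape s) x ρ))))
    (sym (count-∑ᵗ G s))
  desugar-sound {b} (s within B) ρ = begin
    r * ⟦ sums m body ⟧ ρ
      ≡⟨ cong (r *_) (sums-sound m body ρ) ⟩
    r * ∑ᵗ m (λ x → ⟦ body ⟧ (x ⧺ ρ))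
      ≡⟨ cong (r *_) (∑ᵗ-cong m (λ x → cong₂ _*_ (homᶜ-sound F x ρ)
           (prodᶜ-sound (allFin m) _ (p ∘ x) (x ⧺ ρ) (λ v → trans (boolᶜ-sound _ B (x ⧺ ρ)) (cong 𝟙 (evalᵇ-ext B (env x v))))))) ⟩
    r * ∑ᵗ m (λ x → 𝟙 (embeds F G (Vec.tabulate x)) * 𝟙 (all (p ∘ x) (allFin m)))
      ≡⟨ cong (r *_) (∑ᵗ-sel G p m {λ x → 𝟙 (embeds F G (Vec.tabulate x))} (λ eq → cong (𝟙 ∘ embeds F G) (VecP.tabulate-cong eq))) ⟨
    r * ∑ᵗ m (λ x → 𝟙 (embeds F G (Vec.tabulate (List.lookup (sel p) ∘ x))))
      ≡⟨ cong (r *_) (∑ᵗ-cong m (λ x → cong 𝟙 (embeds-induce G p F x))) ⟨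
    r * ∑ᵗ m (λ x → 𝟙 (embeds F (induce G p) (Vec.tabulate x)))
      ≡⟨ count-∑ᵗ (induce G p) s ⟨
    # F ⟨ induce G p ⟩ ∎
    where
    open ≡-Reasoning
    F = shape s
    m = size F
    r = fromℚᵘ (mkℚᵘ (ℤ.+ 1) (ℕ.pred (order s)))
    p : Fin n → Bool
    p y = evalᵇ B (cons y ρ)
    body : Core (m ℕ.+ b)
    body = homᶜ F ⊗ prodᶜ (allFin m) (λ v → boolᶜ (cons (v ↑ˡ b) (m ↑ʳ_)) B)
    env : ∀ x v → (x ⧺ ρ) ∘ cons (v ↑ˡ b) (m ↑ʳ_) ≗ cons (x v) ρ
    env x v zero    = ⧺-↑ˡ x ρ v
    env x v (suc i) = ⧺-↑ʳ x ρ i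

  -- The premise mentions neither `n` nor `G`: it is a closed Boolean computation, and supplying
  -- `refl` for it runs the normaliser.
  by-counting : ∀ (e f : Exp 0) → vanishes (desugar (e ⊟ f)) ≡ true → eval e (λ ()) ≡ eval f (λ ())
  by-counting e f eq = x-y≡0⇒x≡y (eval e (λ ())) (eval f (λ ()))
    (trans (sym (desugar-sound (e ⊟ f) (λ ()))) (vanishes-sound (desugar (e ⊟ f)) eq))

-- Sums over unordered pairs

<ᵇ-true : ∀ {m k} → m ℕ.< k → (m <ᵇ k) ≡ true
<ᵇ-true {m} {k} m<k = dec-true (m ℕ.<? k) m<k

<ᵇ-false : ∀ {m k} → m ℕ.≮ k → (m <ᵇ k) ≡ false
<ᵇ-false {m} {k} m≮k = dec-false (m ℕ.<? k) m≮k

≢ᵇ-split : ∀ {n} (i j : Fin n) z → [ i ≢ᵇ j ]? z ≡ [ i <ᶠ j ]? z + [ j <ᶠ i ]? z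
≢ᵇ-split i j z with ℕP.<-cmp (Fin.toℕ i) (Fin.toℕ j)
... | tri< i<j i≢j j≮i
  rewrite ≢⇒==F (i≢j ∘ cong Fin.toℕ) | <ᵇ-true i<j | <ᵇ-false j≮i = sym (+-identityʳ z)
... | tri≈ i≮j i≡j j≮i
  rewrite toℕ-injective i≡j | ==F-refl j | <ᵇ-false j≮i = refl
... | tri> i≮j i≢j j<i
  rewrite ≢⇒==F (i≢j ∘ cong Fin.toℕ) | <ᵇ-true j<i | <ᵇ-false i≮j = sym (+-identityˡ z)

-- Of two distinct vertices exactly one is the smaller, and by symmetry of `h` the half with
-- `j <ᶠ i` has the same sum as the half with `i <ᶠ j`.
∑<≡½Σ≠ : ∀ {n} (h : Fin n → Fin n → ℚ) → (∀ i j → h i j ≡ h j i) →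
         Σv (λ i → Σv (λ j → [ i <ᶠ j ]? h i j)) ≡ Σ≠ h ÷ℕ 2
∑<≡½Σ≠ {n} h h-sym = sym (begin
  Σ≠ h ÷ℕ 2
    ≡⟨ cong (_÷ℕ 2) (∑-cong (allFin n) (λ i → trans (∑-cong (allFin n) (λ j → ≢ᵇ-split i j (h i j)))
                                                      (∑-+ (allFin n) (λ j → [ i <ᶠ j ]? h i j) (λ j → [ j <ᶠ i ]? h i j)))) ⟩
  Σv (λ i → Σv (λ j → [ i <ᶠ j ]? h i j) + Σv (λ j → [ j <ᶠ i ]? h i j)) ÷ℕ 2
    ≡⟨ cong (_÷ℕ 2) (∑-+ (allFin n) (λ i → Σv (λ j → [ i <ᶠ j ]? h i j)) (λ i → Σv (λ j → [ j <ᶠ i ]? h i j))) ⟩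
  (S + Σv (λ i → Σv (λ j → [ j <ᶠ i ]? h i j))) ÷ℕ 2
    ≡⟨ cong (λ s → (S + s) ÷ℕ 2) (trans (∑-swap (allFin n) (allFin n) (λ i j → [ j <ᶠ i ]? h i j))
         (∑-cong (allFin n) (λ j → ∑-cong (allFin n) (λ i → cong ([ j <ᶠ i ]?_) (h-sym i j))))) ⟩
  (S + S) ÷ℕ 2
    ≡⟨ *-distribʳ-+ (ℤ.+ 1 / 2) S S ⟩
  S ÷ℕ 2 + S ÷ℕ 2
    ≡⟨ *-distribˡ-+ S (ℤ.+ 1 / 2) (ℤ.+ 1 / 2) ⟨
  S * 1ℚ
    ≡⟨ *-identityʳ S ⟩
  S ∎)
  where
  open ≡-Reasoning
  S = Σv (λ i → Σv (λ j → [ i <ᶠ j ]? h i j))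

[∧]? : ∀ a b z → [ a ∧ b ]? z ≡ [ a ]? ([ b ]? z)
[∧]? true  b z = refl
[∧]? false b z = refl

[]?-÷ : ∀ t z d .{{_ : ℕ.NonZero d}} → [ t ]? (z ÷ℕ d) ≡ ([ t ]? z) ÷ℕ d
[]?-÷ true  z d = refl
[]?-÷ false z d = sym (*-zeroˡ (ℤ.+ 1 / d))

Σv-÷ : ∀ {n} d .{{_ : ℕ.NonZero d}} {f h : Fin n → ℚ} → (∀ i → f i ≡ h i ÷ℕ d) → Σv f ≡ Σv h ÷ℕ d
Σv-÷ {n} d {f} {h} eq = trans (∑-cong (allFin n) eq) (∑-*ʳ (allFin n) (ℤ.+ 1 / d) h)

∧-exchange : ∀ a b c → a ∧ b ∧ c ≡ b ∧ a ∧ c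
∧-exchange a b c = trans (sym (∧-assoc a b c)) (trans (cong (_∧ c) (∧-comm a b)) (∧-assoc b a c))

ΣE≡½Σ≠ : ∀ {n} (G : Graph n) (f : Fin n → Fin n → ℚ) → (∀ i j → f i j ≡ f j i) →
         ΣE G f ≡ Σ≠ (λ i j → [ adj G i j ]? f i j) ÷ℕ 2
ΣE≡½Σ≠ {n} G f f-sym = trans
  (∑-cong (allFin n) (λ i → ∑-cong (allFin n) (λ j →
    trans (cong ([_]? f i j) (∧-comm (adj G i j) (i <ᶠ j))) ([∧]? (i <ᶠ j) (adj G i j) (f i j)))))
  (∑<≡½Σ≠ (λ i j → [ adj G i j ]? f i j) (λ i j → cong₂ [_]?_ (adj-sym G i j) (f-sym i j)))

-- Traces, edge numbers and symmetry of the powers of the adjacency matrix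

module _ {n : ℕ} (G : Graph n) where

  ℚ[tr] : ∀ r → ℚ[ tr G r ] ≡ Σv (λ i → ℚ[ pw G r i i ])
  ℚ[tr] r = ℚ[sumℕ] (λ i → pw G r i i)

  ℚ[edges#] : ℚ[ edges# G ] ≡ Σ≠ (λ i j → ℚ[ g G i j ]) ÷ℕ 2
  ℚ[edges#] = trans (ℚ[sumℕ] (λ i → sumℕ (λ j → if i <ᶠ j then g G i j else 0)))
    (trans (∑-cong (allFin n) (λ i → trans (ℚ[sumℕ] (λ j → if i <ᶠ j then g G i j else 0))
                                           (∑-cong (allFin n) (λ j → push (i <ᶠ j) (g G i j)))))
           (∑<≡½Σ≠ (λ i j → ℚ[ g G i j ]) (λ i j → cong (λ t → ℚ[ if t then 1 else 0 ]) (adj-sym G i j))))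
    where
    push : ∀ t m → ℚ[ if t then m else 0 ] ≡ [ t ]? ℚ[ m ]
    push true  m = refl
    push false m = refl

  private
    Q : ℕ → Fin n → Fin n → ℚ
    Q r i j = ℚ[ pw G r i j ]
    a : Fin n → Fin n → ℚ
    a i j = ℚ[ g G i j ]

  a-sym : ∀ i j → a i j ≡ a j i
  a-sym i j = cong (λ t → ℚ[ if t then 1 else 0 ]) (adj-sym G i j)

  pw-0 : ∀ i j → Q 0 i j ≡ 𝟙 (i ==F j)
  pw-0 i j = ℚ[if] (i ==F j)

  pw-suc : ∀ r i j → Q (suc r) i j ≡ ∑ (allFin n) (λ l → Q r i l * a l j)
  pw-suc r i j = trans (ℚ[sumℕ] (λ l → pw G r i l ℕ.* g G l j)) (∑-cong (allFin n) (λ l → ℚ[]-* (pw G r i l) (g G l j)))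

  -- `pw` multiplies by the adjacency matrix on the right, whereas transposing a power puts that
  -- factor on the left; symmetry of the powers needs both recursions.
  pw-sucˡ : ∀ r i j → Q (suc r) i j ≡ ∑ (allFin n) (λ l → a i l * Q r l j)
  pw-sucˡ zero i j = begin
    Q 1 i j
      ≡⟨ pw-suc 0 i j ⟩
    ∑ (allFin n) (λ l → Q 0 i l * a l j)
      ≡⟨ ∑-cong (allFin n) (λ l → cong (_* a l j) (trans (pw-0 i l) (cong 𝟙 (does-sym _≟F_ i l)))) ⟩
    ∑ (allFin n) (λ l → 𝟙 (l ==F i) * a l j)
      ≡⟨ enumerates-allFin n i (λ l → a l j) ⟩
    a i j
      ≡⟨ enumerates-allFin n j (a i) ⟨
    ∑ (allFin n) (λ l → 𝟙 (l ==F j) * a i l)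
      ≡⟨ ∑-cong (allFin n) (λ l → trans (*-comm (𝟙 (l ==F j)) (a i l)) (cong (a i l *_) (sym (pw-0 l j)))) ⟩
    ∑ (allFin n) (λ l → a i l * Q 0 l j) ∎
    where open ≡-Reasoning
  pw-sucˡ (suc r) i j = begin
    Q (suc (suc r)) i j
      ≡⟨ pw-suc (suc r) i j ⟩
    ∑ (allFin n) (λ l → Q (suc r) i l * a l j)
      ≡⟨ ∑-cong (allFin n) (λ l → trans (cong (_* a l j) (pw-sucˡ r i l)) (sym (∑-*ʳ (allFin n) (a l j) (λ m → a i m * Q r m l)))) ⟩
    ∑ (allFin n) (λ l → ∑ (allFin n) (λ m → a i m * Q r m l * a l j))
      ≡⟨ ∑-swap (allFin n) (allFin n) (λ l m → a i m * Q r m l * a l j) ⟩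
    ∑ (allFin n) (λ m → ∑ (allFin n) (λ l → a i m * Q r m l * a l j))
      ≡⟨ ∑-cong (allFin n) (λ m → trans (∑-cong (allFin n) (λ l → *-assoc (a i m) (Q r m l) (a l j))) (∑-*ˡ (allFin n) (a i m) (λ l → Q r m l * a l j))) ⟩
    ∑ (allFin n) (λ m → a i m * ∑ (allFin n) (λ l → Q r m l * a l j))
      ≡⟨ ∑-cong (allFin n) (λ m → cong (a i m *_) (sym (pw-suc r m j))) ⟩
    ∑ (allFin n) (λ m → a i m * Q (suc r) m j) ∎
    where open ≡-Reasoning

  pw-sym : ∀ r i j → Q r i j ≡ Q r j i
  pw-sym zero    i j = cong (λ t → ℚ[ if t then 1 else 0 ]) (does-sym _≟F_ i j)
  pw-sym (suc r) i j = trans (pw-suc r i j) (trans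
    (∑-cong (allFin n) (λ l → trans (*-comm (Q r i l) (a l j)) (cong₂ _*_ (a-sym l j) (pw-sym r i l))))
    (sym (pw-sucˡ r j i)))

-- The identities

pattern v0 = zero
pattern v1 = suc zero
pattern v2 = suc (suc zero)
pattern v3 = suc (suc (suc zero))

m3 m7 m11 m13 m15 m30 m31 m63 : Motif
m3 = motif M3-3 2 refl
m7 = motif M7-3 6 refl
m11 = motif M11-4 6 refl
m13 = motif M13-4 2 refl
m15 = motif M15-4 2 refl
m30 = motif M30-4 8 refl
m31 = motif M31-4 4 refl
m63 = motif M63-4 24 refl

m75 m77 m79 m86 m87 m94 m95 m117 m119 m127 m222 m223 m235 m236 m237 m239 m254 m255 m507 m511 m1023 : Motif
m75 = motif M75-5 24 refl
m77 = motif M77-5 2 refl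
m79 = motif M79-5 4 refl
m86 = motif M86-5 2 refl
m87 = motif M87-5 2 refl
m94 = motif M94-5 2 refl
m95 = motif M95-5 2 refl
m117 = motif M117-5 2 refl
m119 = motif M119-5 2 refl
m127 = motif M127-5 6 refl
m222 = motif M222-5 12 refl
m223 = motif M223-5 12 refl
m235 = motif M235-5 8 refl
m236 = motif M236-5 10 refl
m237 = motif M237-5 2 refl
m239 = motif M239-5 2 refl
m254 = motif M254-5 4 refl
m255 = motif M255-5 4 refl
m507 = motif M507-5 8 refl
m511 = motif M511-5 12 refl
m1023 = motif M1023-5 120 refl

-- eval returns the terms of theorem1 definitionally, so its statements unify with those of by-counting.
by-counting₂ : ∀ {n} (G : Graph n) (e f h : Exp 0) → let open Surface G in
               vanishes (desugar (e ⊟ f)) ≡ true → vanishes (desugar (f ⊟ h)) ≡ true →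
               (eval e (λ ()) ≡ eval f (λ ())) × (eval f (λ ()) ≡ eval h (λ ()))
by-counting₂ G e f h ef fh = Surface.by-counting G e f ef , Surface.by-counting G f h fh

-- Triangle and four-vertex counts, to be applied to induced subgraphs

module _ {n : ℕ} (G : Graph n) where
  open Surface G using (by-counting)

  triangles : # M7-3 ⟨ G ⟩ ≡ ℚ[ tr G 3 ] ÷ℕ 6
  triangles = trans (by-counting (#ᵉ m7) (Σᵉ (P 3 v0 v0) ÷ 6) refl) (cong (_÷ℕ 6) (sym (ℚ[tr] G 3)))

  six-triangles : ℚ[ tr G 3 ] ≡ ℚ[ 6 ] * # M7-3 ⟨ G ⟩
  six-triangles = trans (ℚ[tr] G 3) (by-counting (Σᵉ (P 3 v0 v0)) (nat 6 ⊠ #ᵉ m7) refl)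

  -- Extend a middle edge at both ends. The two new vertices coincide precisely in a triangle, which
  -- arises from each of its three edges.
  paths : # M13-4 ⟨ G ⟩ ≡ ΣE G (λ i j → (ℚ[ deg G i ] - ℚ[ 1 ]) * (ℚ[ deg G j ] - ℚ[ 1 ])) - ℚ[ 3 ] * # M7-3 ⟨ G ⟩
  paths = trans
    (by-counting (#ᵉ m13) (Σ≠ᵉ (adjacent v1 v0 ⇒ (K v1 ⊟ nat 1) ⊠ (K v0 ⊟ nat 1)) ÷ 2 ⊟ nat 3 ⊠ #ᵉ m7) refl)
    (cong (_- ℚ[ 3 ] * # M7-3 ⟨ G ⟩)
      (sym (ΣE≡½Σ≠ G (λ i j → (ℚ[ deg G i ] - ℚ[ 1 ]) * (ℚ[ deg G j ] - ℚ[ 1 ]))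
                     (λ i j → *-comm (ℚ[ deg G i ] - ℚ[ 1 ]) (ℚ[ deg G j ] - ℚ[ 1 ])))))

  paws : # M15-4 ⟨ G ⟩ ≡ Σv (λ r → [ 2 <ᵇ deg G r ]? (ℚ[ pw G 3 r r ] * (ℚ[ deg G r ] - ℚ[ 2 ]))) ÷ℕ 2
  paws = by-counting (#ᵉ m15) (Σᵉ (deg> 2 v0 ⇒ P 3 v0 v0 ⊠ (K v0 ⊟ nat 2)) ÷ 2) refl

  -- A square carries 8 closed walks of length 4, from four starts and two directions. The
  -- degenerate ones retrace an edge (2 per edge) or cover a path with two edges (4 per path).
  squares : # M30-4 ⟨ G ⟩ ≡ (ℚ[ tr G 4 ] - ℚ[ 2 ] * ℚ[ edges# G ] - ℚ[ 4 ] * # M3-3 ⟨ G ⟩) ÷ℕ 8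
  squares = trans
    (by-counting (#ᵉ m30) ((Σᵉ (P 4 v0 v0) ⊟ nat 2 ⊠ (Σ≠ᵉ (A v1 v0) ÷ 2) ⊟ nat 4 ⊠ #ᵉ m3) ÷ 8) refl)
    (cong₂ (λ t m → (t - ℚ[ 2 ] * m - ℚ[ 4 ] * # M3-3 ⟨ G ⟩) ÷ℕ 8) (sym (ℚ[tr] G 4)) (sym (ℚ[edges#] G)))

  -- A diamond is an edge with two common neighbours of its ends, and those ends then have degree at
  -- least 3; the factor 1/2 accounts for their order.
  diamonds : # M31-4 ⟨ G ⟩ ≡ Σ≠ (λ r s → [ (2 <ᵇ deg G r) ∧ (2 <ᵇ deg G s) ]? binom (ℚ[ pw G 2 r s ] * ℚ[ g G r s ]) 2) ÷ℕ 2
  diamonds = by-counting (#ᵉ m31) (Σ≠ᵉ (deg> 2 v1 and deg> 2 v0 ⇒ (P 2 v1 v0 ⊠ A v1 v0) choose 2) ÷ 2) refl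

-- Five-vertex identities with sums over edges or unordered pairs

module _ {n : ℕ} (G : Graph n) where
  open Surface G using (by-counting)
  private
    k : Fin n → ℚ
    k i = ℚ[ deg G i ]
    Q : ℕ → Fin n → Fin n → ℚ
    Q r i j = ℚ[ pw G r i j ]
    _>ₖ_ : Fin n → ℕ → Bool
    i >ₖ c = c <ᵇ deg G i
    guard₂ : ℕ → Fin n → Fin n → Bool
    guard₂ c i j = (i >ₖ c) ∧ (j >ₖ c)
    guard₂-sym : ∀ c i j → guard₂ c i j ≡ guard₂ c j i
    guard₂-sym c i j = ∧-comm (i >ₖ c) (j >ₖ c)

  -- Choose an edge, a triangle on it and a further neighbour at each end. The two further
  -- neighbours coincide in a diamond, seen from its central edge in 2 ways.
  bulls : # M87-5 ⟨ G ⟩ ≡ ΣE G (λ i j → [ guard₂ 2 i j ]? (Q 2 i j * (k i - ℚ[ 2 ]) * (k j - ℚ[ 2 ]))) - ℚ[ 2 ] * # M31-4 ⟨ G ⟩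
  bulls = trans
    (by-counting (#ᵉ m87) (Σ≠ᵉ (adjacent v1 v0 ⇒ deg> 2 v1 and deg> 2 v0 ⇒ P 2 v1 v0 ⊠ (K v1 ⊟ nat 2) ⊠ (K v0 ⊟ nat 2)) ÷ 2 ⊟ nat 2 ⊠ #ᵉ m31) refl)
    (cong (_- ℚ[ 2 ] * # M31-4 ⟨ G ⟩) (sym (ΣE≡½Σ≠ G (λ i j → [ guard₂ 2 i j ]? (Q 2 i j * (k i - ℚ[ 2 ]) * (k j - ℚ[ 2 ]))) f-sym)))
    where
    f-sym : ∀ i j → [ guard₂ 2 i j ]? (Q 2 i j * (k i - ℚ[ 2 ]) * (k j - ℚ[ 2 ])) ≡ [ guard₂ 2 j i ]? (Q 2 j i * (k j - ℚ[ 2 ]) * (k i - ℚ[ 2 ]))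
    f-sym i j = cong₂ [_]?_ (guard₂-sym 2 i j) (begin
      Q 2 i j * (k i - ℚ[ 2 ]) * (k j - ℚ[ 2 ])   ≡⟨ *-assoc (Q 2 i j) (k i - ℚ[ 2 ]) (k j - ℚ[ 2 ]) ⟩
      Q 2 i j * ((k i - ℚ[ 2 ]) * (k j - ℚ[ 2 ])) ≡⟨ cong₂ _*_ (pw-sym G 2 i j) (*-comm (k i - ℚ[ 2 ]) (k j - ℚ[ 2 ])) ⟩
      Q 2 j i * ((k j - ℚ[ 2 ]) * (k i - ℚ[ 2 ])) ≡⟨ *-assoc (Q 2 j i) (k j - ℚ[ 2 ]) (k i - ℚ[ 2 ]) ⟨
      Q 2 j i * (k j - ℚ[ 2 ]) * (k i - ℚ[ 2 ])   ∎)
      where open ≡-Reasoning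

  -- Here `r` is the outer vertex of the diamond on the central edge that bears the tail. The tail
  -- runs into the other outer vertex only in a complete graph on four vertices: 6 central edges, 2
  -- choices of `r`.
  tailed-diamonds : # M119-5 ⟨ G ⟩ ≡
    ΣE G (λ i j → [ guard₂ 2 i j ]? ((Q 2 i j - ℚ[ 1 ]) * Σv (λ r → [ adj G i r ∧ adj G j r ∧ (r >ₖ 1) ]? (k r - ℚ[ 2 ])))) - ℚ[ 12 ] * # M63-4 ⟨ G ⟩
  tailed-diamonds = trans
    (by-counting (#ᵉ m119) (Σ≠ᵉ (adjacent v1 v0 ⇒ deg> 2 v1 and deg> 2 v0 ⇒
      (P 2 v1 v0 ⊟ nat 1) ⊠ Σᵉ (adjacent v2 v0 and adjacent v1 v0 and deg> 1 v0 ⇒ K v0 ⊟ nat 2)) ÷ 2 ⊟ nat 12 ⊠ #ᵉ m63) refl)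
    (cong (_- ℚ[ 12 ] * # M63-4 ⟨ G ⟩) (sym (ΣE≡½Σ≠ G (λ i j → [ guard₂ 2 i j ]? ((Q 2 i j - ℚ[ 1 ]) * inner i j)) f-sym)))
    where
    inner : Fin n → Fin n → ℚ
    inner i j = Σv (λ r → [ adj G i r ∧ adj G j r ∧ (r >ₖ 1) ]? (k r - ℚ[ 2 ]))
    f-sym : ∀ i j → [ guard₂ 2 i j ]? ((Q 2 i j - ℚ[ 1 ]) * inner i j) ≡ [ guard₂ 2 j i ]? ((Q 2 j i - ℚ[ 1 ]) * inner j i)
    f-sym i j = cong₂ [_]?_ (guard₂-sym 2 i j) (cong₂ (λ x y → (x - ℚ[ 1 ]) * y) (pw-sym G 2 i j)
      (∑-cong (allFin n) (λ r → cong ([_]? (k r - ℚ[ 2 ])) (∧-exchange (adj G i r) (adj G j r) (r >ₖ 1)))))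

  -- Where `i` and `j` are not adjacent the argument of `binom` is 0, and so is its value; this
  -- restricts the left side to edges.
  books : (Σ≠ (λ i j → [ guard₂ 3 i j ]? binom (Q 2 i j * ℚ[ g G i j ]) 3)) ÷ℕ 2 ≡
          (ΣE G (λ i j → [ guard₂ 3 i j ]? (Q 2 i j * (Q 2 i j - ℚ[ 1 ]) * (Q 2 i j - ℚ[ 2 ])))) ÷ℕ 6
  books = trans
    (by-counting (Σ≠ᵉ (deg> 3 v1 and deg> 3 v0 ⇒ (P 2 v1 v0 ⊠ A v1 v0) choose 3) ÷ 2)
                 (Σ≠ᵉ (adjacent v1 v0 ⇒ deg> 3 v1 and deg> 3 v0 ⇒ P 2 v1 v0 ⊠ (P 2 v1 v0 ⊟ nat 1) ⊠ (P 2 v1 v0 ⊟ nat 2)) ÷ 2 ÷ 6) refl)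
    (cong (_÷ℕ 6) (sym (ΣE≡½Σ≠ G (λ i j → [ guard₂ 3 i j ]? (Q 2 i j * (Q 2 i j - ℚ[ 1 ]) * (Q 2 i j - ℚ[ 2 ])))
      (λ i j → cong₂ (λ t x → [ t ]? (x * (x - ℚ[ 1 ]) * (x - ℚ[ 2 ]))) (guard₂-sym 3 i j) (pw-sym G 2 i j)))))

  -- The edge joins the roof to the square. Walks of length 3 between its ends that stay in the roof
  -- triangle number 3 per edge, hence 9; those stepping out of it and back give 2 per paw; true
  -- paths through the apex give one for each of the 4 outer edges of a diamond.
  houses : # M237-5 ⟨ G ⟩ ≡ ΣE G (λ i j → Q 3 i j * Q 2 i j) - ℚ[ 9 ] * # M7-3 ⟨ G ⟩ - ℚ[ 2 ] * # M15-4 ⟨ G ⟩ - ℚ[ 4 ] * # M31-4 ⟨ G ⟩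
  houses = trans
    (by-counting (#ᵉ m237) (Σ≠ᵉ (adjacent v1 v0 ⇒ P 3 v1 v0 ⊠ P 2 v1 v0) ÷ 2 ⊟ nat 9 ⊠ #ᵉ m7 ⊟ nat 2 ⊠ #ᵉ m15 ⊟ nat 4 ⊠ #ᵉ m31) refl)
    (cong (λ z → z - ℚ[ 9 ] * # M7-3 ⟨ G ⟩ - ℚ[ 2 ] * # M15-4 ⟨ G ⟩ - ℚ[ 4 ] * # M31-4 ⟨ G ⟩)
      (sym (ΣE≡½Σ≠ G (λ i j → Q 3 i j * Q 2 i j) (λ i j → cong₂ _*_ (pw-sym G 3 i j) (pw-sym G 2 i j)))))

  -- The shape is a diamond on a central edge `i j` whose outer vertices `r` and `q` have one more
  -- common neighbour; the 2 subtracted are `i` and `j` themselves.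
  spanned-squares : # M254-5 ⟨ G ⟩ ≡ ΣE G (λ i j → [ guard₂ 2 i j ]? Σv (λ r → Σv (λ q →
    [ (r <ᶠ q) ∧ adj G i r ∧ adj G j r ∧ adj G i q ∧ adj G j q ∧ (r >ₖ 2) ∧ (q >ₖ 2) ]? (Q 2 r q - ℚ[ 2 ]))))
  spanned-squares = trans
    (by-counting (#ᵉ m254) (Σ≠ᵉ (adjacent v1 v0 ⇒ deg> 2 v1 and deg> 2 v0 ⇒ Σ≠ᵉ (
      adjacent v3 v1 and adjacent v2 v1 and adjacent v3 v0 and adjacent v2 v0 and deg> 2 v1 and deg> 2 v0 ⇒ P 2 v1 v0 ⊟ nat 2) ÷ 2) ÷ 2) refl)
    -- Both the edge and the pair `r`, `q` are unordered, so the sum is symmetrised twice, the inner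
    -- one under the conditions of the outer.
    (sym (trans (ΣE≡½Σ≠ G (λ i j → [ guard₂ 2 i j ]? inner i j) f-sym)
      (cong (_÷ℕ 2) (∑-cong (allFin n) (λ i → ∑-cong (allFin n) (λ j →
        cong (λ z → [ i ≢ᵇ j ]? ([ adj G i j ]? ([ guard₂ 2 i j ]? z))) (inner≡ i j)))))))
    where
    both : (i j r q : Fin n) → Bool
    both i j r q = adj G i r ∧ adj G j r ∧ adj G i q ∧ adj G j q ∧ (r >ₖ 2) ∧ (q >ₖ 2)
    inner : Fin n → Fin n → ℚ
    inner i j = Σv (λ r → Σv (λ q → [ (r <ᶠ q) ∧ both i j r q ]? (Q 2 r q - ℚ[ 2 ])))
    both-symˡ : ∀ i j r q → both i j r q ≡ both j i r q
    both-symˡ i j r q = trans (∧-exchange (adj G i r) (adj G j r) (adj G i q ∧ adj G j q ∧ (r >ₖ 2) ∧ (q >ₖ 2)))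
      (cong (λ t → adj G j r ∧ adj G i r ∧ t) (∧-exchange (adj G i q) (adj G j q) ((r >ₖ 2) ∧ (q >ₖ 2))))
    both-symʳ : ∀ i j r q → both i j r q ≡ both i j q r
    both-symʳ i j r q = permute (adj G i r) (adj G j r) (adj G i q) (adj G j q) (r >ₖ 2) (q >ₖ 2)
      where
      permute : ∀ a b c d e f → a ∧ b ∧ c ∧ d ∧ e ∧ f ≡ c ∧ d ∧ a ∧ b ∧ f ∧ e
      permute true  true  c d e f = cong (λ t → c ∧ d ∧ t) (∧-comm e f)
      permute true  false c d e f = sym (trans (cong (c ∧_) (∧-zeroʳ d)) (∧-zeroʳ c))
      permute false b     c d e f = sym (trans (cong (c ∧_) (∧-zeroʳ d)) (∧-zeroʳ c))
    f-sym : ∀ i j → [ guard₂ 2 i j ]? inner i j ≡ [ guard₂ 2 j i ]? inner j i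
    f-sym i j = cong₂ [_]?_ (guard₂-sym 2 i j) (∑-cong (allFin n) (λ r → ∑-cong (allFin n) (λ q →
      cong (λ t → [ (r <ᶠ q) ∧ t ]? (Q 2 r q - ℚ[ 2 ])) (both-symˡ i j r q))))
    inner≡ : ∀ i j → inner i j ≡ Σ≠ (λ r q → [ both i j r q ]? (Q 2 r q - ℚ[ 2 ])) ÷ℕ 2
    inner≡ i j = trans
      (∑-cong (allFin n) (λ r → ∑-cong (allFin n) (λ q → [∧]? (r <ᶠ q) (both i j r q) (Q 2 r q - ℚ[ 2 ]))))
      (∑<≡½Σ≠ (λ r q → [ both i j r q ]? (Q 2 r q - ℚ[ 2 ]))
              (λ r q → cong₂ (λ t x → [ t ]? (x - ℚ[ 2 ])) (both-symʳ i j r q) (pw-sym G 2 r q)))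

÷-÷ : ∀ z c d .{{_ : ℕ.NonZero c}} .{{_ : ℕ.NonZero d}} e .{{_ : ℕ.NonZero e}} →
      (ℤ.+ 1 / c) * (ℤ.+ 1 / d) ≡ ℤ.+ 1 / e → (z ÷ℕ c) ÷ℕ d ≡ z ÷ℕ e
÷-÷ z c d e eq = trans (*-assoc z (ℤ.+ 1 / c) (ℤ.+ 1 / d)) (cong (z *_) eq)

theorem1 : ∀ {n} (G : Graph n) →
    let k : Fin n → ℚ
        k i = ℚ[ deg G i ]
        P : ℕ → Fin n → Fin n → ℚ
        P r i j = ℚ[ pw G r i j ]
        A : Fin n → Fin n → ℚ
        A i j = ℚ[ g G i j ]
        d : (i : Fin n) → Fin _ → ℚ
        d i r = ℚ[ deg (nbhd G i) r ]
        _>ₖ_ : Fin n → ℕ → _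
        i >ₖ c = c <ᵇ deg G i
    in
    -- (a)
    ( (# M75-5 ⟨ G ⟩ ≡ Σv (λ i → [ i >ₖ 3 ]? binom (k i) 4))
    × (Σv (λ i → [ i >ₖ 3 ]? binom (k i) 4)
       ≡ (Σv (λ i → [ i >ₖ 3 ]? (k i * (k i - ℚ[ 1 ]) * (k i - ℚ[ 2 ]) * (k i - ℚ[ 3 ])))) ÷ℕ 24) )
    -- (b)
    × ( (# M77-5 ⟨ G ⟩ ≡ ΣE⋆ G (λ i j → [ i >ₖ 2 ]? (binom (k i - ℚ[ 1 ]) 2 * (k j - ℚ[ 1 ])))
                          - ℚ[ 2 ] * # M15-4 ⟨ G ⟩)
      × (ΣE⋆ G (λ i j → [ i >ₖ 2 ]? (binom (k i - ℚ[ 1 ]) 2 * (k j - ℚ[ 1 ]))) - ℚ[ 2 ] * # M15-4 ⟨ G ⟩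
         ≡ (ΣE⋆ G (λ i j → [ i >ₖ 2 ]? ((k i - ℚ[ 1 ]) * (k i - ℚ[ 2 ]) * (k j - ℚ[ 1 ])))) ÷ℕ 2
           - ℚ[ 2 ] * # M15-4 ⟨ G ⟩) )
    -- (c)
    × ( (# M79-5 ⟨ G ⟩ ≡ (Σv (λ i → [ i >ₖ 3 ]? (P 3 i i * binom (k i - ℚ[ 2 ]) 2))) ÷ℕ 2)
      × ((Σv (λ i → [ i >ₖ 3 ]? (P 3 i i * binom (k i - ℚ[ 2 ]) 2))) ÷ℕ 2
         ≡ (Σv (λ i → [ i >ₖ 3 ]? (P 3 i i * (k i - ℚ[ 2 ]) * (k i - ℚ[ 3 ])))) ÷ℕ 4) )
    -- (d)
    × (# M86-5 ⟨ G ⟩ ≡ (Σ≠ (λ i j → P 4 i j)) ÷ℕ 2 - ℚ[ 2 ] * # M3-3 ⟨ G ⟩ - ℚ[ 9 ] * # M7-3 ⟨ G ⟩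
                        - ℚ[ 3 ] * # M11-4 ⟨ G ⟩ - ℚ[ 2 ] * # M13-4 ⟨ G ⟩ - ℚ[ 2 ] * # M15-4 ⟨ G ⟩)
    -- (e)
    × (# M87-5 ⟨ G ⟩ ≡ ΣE G (λ i j → [ (i >ₖ 2) ∧ (j >ₖ 2) ]? (P 2 i j * (k i - ℚ[ 2 ]) * (k j - ℚ[ 2 ])))
                        - ℚ[ 2 ] * # M31-4 ⟨ G ⟩)
    -- (f)
    × ( (# M94-5 ⟨ G ⟩ ≡ Σ≠ (λ i j → [ i >ₖ 2 ]? (binom (P 2 i j) 2 * (k i - ℚ[ 2 ]))) - ℚ[ 2 ] * # M31-4 ⟨ G ⟩)
      × (Σ≠ (λ i j → [ i >ₖ 2 ]? (binom (P 2 i j) 2 * (k i - ℚ[ 2 ]))) - ℚ[ 2 ] * # M31-4 ⟨ G ⟩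
         ≡ (Σ≠ (λ i j → [ i >ₖ 2 ]? (P 2 i j * (P 2 i j - ℚ[ 1 ]) * (k i - ℚ[ 2 ])))) ÷ℕ 2
           - ℚ[ 2 ] * # M31-4 ⟨ G ⟩) )
    -- (g)
    × ( (# M95-5 ⟨ G ⟩ ≡ Σ≠ (λ i j → [ i >ₖ 3 ]? (binom (P 2 i j * A i j) 2 * (k i - ℚ[ 3 ]))))
      × (Σ≠ (λ i j → [ i >ₖ 3 ]? (binom (P 2 i j * A i j) 2 * (k i - ℚ[ 3 ])))
         ≡ (ΣE⋆ G (λ i j → [ i >ₖ 3 ]? (P 2 i j * (P 2 i j - ℚ[ 1 ]) * (k i - ℚ[ 3 ])))) ÷ℕ 2) )
    -- (h)
    × (# M117-5 ⟨ G ⟩ ≡ (ΣE⋆ G (λ i j → P 3 i i * (k j - ℚ[ 1 ]))) ÷ℕ 2 - ℚ[ 6 ] * # M7-3 ⟨ G ⟩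
                         - ℚ[ 2 ] * # M15-4 ⟨ G ⟩ - ℚ[ 4 ] * # M31-4 ⟨ G ⟩)
    -- (i)
    × (# M119-5 ⟨ G ⟩ ≡ ΣE G (λ i j → [ (i >ₖ 2) ∧ (j >ₖ 2) ]?
                           ((P 2 i j - ℚ[ 1 ])
                            * Σv (λ r → [ adj G i r ∧ adj G j r ∧ (r >ₖ 1) ]? (k r - ℚ[ 2 ]))))
                         - ℚ[ 12 ] * # M63-4 ⟨ G ⟩)
    -- (j)
    × ( (# M127-5 ⟨ G ⟩ ≡ Σv (λ i → [ i >ₖ 3 ]? (# M7-3 ⟨ nbhd G i ⟩ * (k i - ℚ[ 3 ]))))
      × (Σv (λ i → [ i >ₖ 3 ]? (# M7-3 ⟨ nbhd G i ⟩ * (k i - ℚ[ 3 ])))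
         ≡ (Σv (λ i → [ i >ₖ 3 ]? (ℚ[ tr (nbhd G i) 3 ] * (k i - ℚ[ 3 ])))) ÷ℕ 6) )
    -- (k)
    × ( (# M222-5 ⟨ G ⟩ ≡ (Σ≠ (λ i j → [ (i >ₖ 2) ∧ (j >ₖ 2) ]? binom (P 2 i j) 3)) ÷ℕ 2)
      × ((Σ≠ (λ i j → [ (i >ₖ 2) ∧ (j >ₖ 2) ]? binom (P 2 i j) 3)) ÷ℕ 2
         ≡ (Σ≠ (λ i j → [ (i >ₖ 2) ∧ (j >ₖ 2) ]?
               (P 2 i j * (P 2 i j - ℚ[ 1 ]) * (P 2 i j - ℚ[ 2 ])))) ÷ℕ 12) )
    -- (l)
    × ( (# M223-5 ⟨ G ⟩ ≡ (Σ≠ (λ i j → [ (i >ₖ 3) ∧ (j >ₖ 3) ]? binom (P 2 i j * A i j) 3)) ÷ℕ 2)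
      × ((Σ≠ (λ i j → [ (i >ₖ 3) ∧ (j >ₖ 3) ]? binom (P 2 i j * A i j) 3)) ÷ℕ 2
         ≡ (ΣE G (λ i j → [ (i >ₖ 3) ∧ (j >ₖ 3) ]?
               (P 2 i j * (P 2 i j - ℚ[ 1 ]) * (P 2 i j - ℚ[ 2 ])))) ÷ℕ 6) )
    -- (m)
    × ( (# M235-5 ⟨ G ⟩ ≡ Σv (λ i → [ i >ₖ 2 ]? binom ((P 3 i i) ÷ℕ 2) 2) - ℚ[ 2 ] * # M31-4 ⟨ G ⟩)
      × (Σv (λ i → [ i >ₖ 2 ]? binom ((P 3 i i) ÷ℕ 2) 2) - ℚ[ 2 ] * # M31-4 ⟨ G ⟩
         ≡ (Σv (λ i → [ i >ₖ 2 ]? (P 3 i i * (P 3 i i - ℚ[ 2 ])))) ÷ℕ 8 - ℚ[ 2 ] * # M31-4 ⟨ G ⟩) )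
    -- (n)
    × (# M236-5 ⟨ G ⟩ ≡ (ℚ[ tr G 5 ] - ℚ[ 30 ] * # M7-3 ⟨ G ⟩ - ℚ[ 10 ] * # M15-4 ⟨ G ⟩) ÷ℕ 10)
    -- (o)
    × (# M237-5 ⟨ G ⟩ ≡ ΣE G (λ i j → P 3 i j * P 2 i j) - ℚ[ 9 ] * # M7-3 ⟨ G ⟩
                         - ℚ[ 2 ] * # M15-4 ⟨ G ⟩ - ℚ[ 4 ] * # M31-4 ⟨ G ⟩)
    -- (p)
    × ( (# M239-5 ⟨ G ⟩ ≡ Σv (λ i → [ i >ₖ 3 ]? # M13-4 ⟨ nbhd G i ⟩))
      × (Σv (λ i → [ i >ₖ 3 ]? # M13-4 ⟨ nbhd G i ⟩)
         ≡ Σv (λ i → [ i >ₖ 3 ]?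
              (ΣE (nbhd G i) (λ j r → (d i j - ℚ[ 1 ]) * (d i r - ℚ[ 1 ]))
               - ℚ[ 3 ] * # M7-3 ⟨ nbhd G i ⟩))) )
    -- (q)
    × (# M254-5 ⟨ G ⟩ ≡ ΣE G (λ i j → [ (i >ₖ 2) ∧ (j >ₖ 2) ]?
                           Σv (λ r → Σv (λ q →
                             [ (r <ᶠ q) ∧ adj G i r ∧ adj G j r ∧ adj G i q ∧ adj G j q
                               ∧ (r >ₖ 2) ∧ (q >ₖ 2) ]? (P 2 r q - ℚ[ 2 ])))))
    -- (r)
    × ( (# M255-5 ⟨ G ⟩ ≡ (Σv (λ i → [ i >ₖ 3 ]? # M15-4 ⟨ nbhd G i ⟩)) ÷ℕ 2)
      × ((Σv (λ i → [ i >ₖ 3 ]? # M15-4 ⟨ nbhd G i ⟩)) ÷ℕ 2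
         ≡ (Σv (λ i → [ i >ₖ 3 ]?
              Σv (λ r → [ 2 <ᵇ deg (nbhd G i) r ]?
                   (ℚ[ pw (nbhd G i) 3 r r ] * (d i r - ℚ[ 2 ]))))) ÷ℕ 4) )
    -- (s)
    × ( (# M507-5 ⟨ G ⟩ ≡ Σv (λ i → [ i >ₖ 3 ]? # M30-4 ⟨ nbhd G i ⟩))
      × (Σv (λ i → [ i >ₖ 3 ]? # M30-4 ⟨ nbhd G i ⟩)
         ≡ (Σv (λ i → [ i >ₖ 3 ]?
              (ℚ[ tr (nbhd G i) 4 ] - ℚ[ 2 ] * ℚ[ edges# (nbhd G i) ]
               - ℚ[ 4 ] * # M3-3 ⟨ nbhd G i ⟩))) ÷ℕ 8) )
    -- (t)
    × ( (# M511-5 ⟨ G ⟩ ≡ (Σv (λ i → [ i >ₖ 3 ]? # M31-4 ⟨ nbhd G i ⟩)) ÷ℕ 3)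
      × ((Σv (λ i → [ i >ₖ 3 ]? # M31-4 ⟨ nbhd G i ⟩)) ÷ℕ 3
         ≡ (Σv (λ i → [ i >ₖ 3 ]?
              Σ≠ (λ r s → [ (2 <ᵇ deg (nbhd G i) r) ∧ (2 <ᵇ deg (nbhd G i) s) ]?
                   binom (ℚ[ pw (nbhd G i) 2 r s ] * ℚ[ g (nbhd G i) r s ]) 2))) ÷ℕ 6) )
    -- (u)
    × ( (# M1023-5 ⟨ G ⟩ ≡ (Σv (λ i → [ i >ₖ 3 ]? # M63-4 ⟨ nbhd G i ⟩)) ÷ℕ 5)
      × ((Σv (λ i → [ i >ₖ 3 ]? # M63-4 ⟨ nbhd G i ⟩)) ÷ℕ 5
         ≡ (Σv (λ i → [ i >ₖ 3 ]?
              Σv (λ j → [ adj G i j ∧ (j >ₖ 2) ]? ℚ[ tr (common G i j) 3 ]))) ÷ℕ 120) )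
theorem1 {n} G =
    by-counting₂ G (#ᵉ m75) (Σᵉ (deg> 3 v0 ⇒ K v0 choose 4))
      (Σᵉ (deg> 3 v0 ⇒ K v0 ⊠ (K v0 ⊟ nat 1) ⊠ (K v0 ⊟ nat 2) ⊠ (K v0 ⊟ nat 3)) ÷ 24) refl refl
  , by-counting₂ G (#ᵉ m77) (ΣE⋆ᵉ (deg> 2 v1 ⇒ (K v1 ⊟ nat 1) choose 2 ⊠ (K v0 ⊟ nat 1)) ⊟ nat 2 ⊠ #ᵉ m15)
      (ΣE⋆ᵉ (deg> 2 v1 ⇒ (K v1 ⊟ nat 1) ⊠ (K v1 ⊟ nat 2) ⊠ (K v0 ⊟ nat 1)) ÷ 2 ⊟ nat 2 ⊠ #ᵉ m15) refl refl
  , by-counting₂ G (#ᵉ m79) (Σᵉ (deg> 3 v0 ⇒ P 3 v0 v0 ⊠ (K v0 ⊟ nat 2) choose 2) ÷ 2)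
      (Σᵉ (deg> 3 v0 ⇒ P 3 v0 v0 ⊠ (K v0 ⊟ nat 2) ⊠ (K v0 ⊟ nat 3)) ÷ 4) refl refl
  -- Walks of length 4 with distinct ends, up to reversal: apart from five-vertex paths, they cover
  -- one of the five subtracted graphs.
  , Surface.by-counting G (#ᵉ m86) (Σ≠ᵉ (P 4 v1 v0) ÷ 2 ⊟ nat 2 ⊠ #ᵉ m3 ⊟ nat 9 ⊠ #ᵉ m7
      ⊟ nat 3 ⊠ #ᵉ m11 ⊟ nat 2 ⊠ #ᵉ m13 ⊟ nat 2 ⊠ #ᵉ m15) refl
  , bulls G
  , by-counting₂ G (#ᵉ m94) (Σ≠ᵉ (deg> 2 v1 ⇒ P 2 v1 v0 choose 2 ⊠ (K v1 ⊟ nat 2)) ⊟ nat 2 ⊠ #ᵉ m31)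
      (Σ≠ᵉ (deg> 2 v1 ⇒ P 2 v1 v0 ⊠ (P 2 v1 v0 ⊟ nat 1) ⊠ (K v1 ⊟ nat 2)) ÷ 2 ⊟ nat 2 ⊠ #ᵉ m31) refl refl
  , by-counting₂ G (#ᵉ m95) (Σ≠ᵉ (deg> 3 v1 ⇒ (P 2 v1 v0 ⊠ A v1 v0) choose 2 ⊠ (K v1 ⊟ nat 3)))
      (ΣE⋆ᵉ (deg> 3 v1 ⇒ P 2 v1 v0 ⊠ (P 2 v1 v0 ⊟ nat 1) ⊠ (K v1 ⊟ nat 3)) ÷ 2) refl refl
  -- A triangle at `i` followed by a two-step tail through `j`: the corrections are tails that stay
  -- in the triangle (6), leave it at the second step (2 per paw) or return to it from outside (4
  -- per diamond).
  , Surface.by-counting G (#ᵉ m117) (ΣE⋆ᵉ (P 3 v1 v1 ⊠ (K v0 ⊟ nat 1)) ÷ 2 ⊟ nat 6 ⊠ #ᵉ m7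
      ⊟ nat 2 ⊠ #ᵉ m15 ⊟ nat 4 ⊠ #ᵉ m31) refl
  , tailed-diamonds G
  , ( Surface.by-counting G (#ᵉ m127) (Σᵉ (deg> 3 v0 ⇒ m7 within adjacent v1 v0 ⊠ (K v0 ⊟ nat 3))) refl
    , Σv-÷ 6 (λ i → trans (cong ([ 3 <ᵇ deg G i ]?_) (triangles-÷ i))
                          ([]?-÷ (3 <ᵇ deg G i) (ℚ[ tr (nbhd G i) 3 ] * (ℚ[ deg G i ] - ℚ[ 3 ])) 6)) )
  , by-counting₂ G (#ᵉ m222) (Σ≠ᵉ (deg> 2 v1 and deg> 2 v0 ⇒ P 2 v1 v0 choose 3) ÷ 2)
      (Σ≠ᵉ (deg> 2 v1 and deg> 2 v0 ⇒ P 2 v1 v0 ⊠ (P 2 v1 v0 ⊟ nat 1) ⊠ (P 2 v1 v0 ⊟ nat 2)) ÷ 12) refl refl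
  , ( Surface.by-counting G (#ᵉ m223) (Σ≠ᵉ (deg> 3 v1 and deg> 3 v0 ⇒ (P 2 v1 v0 ⊠ A v1 v0) choose 3) ÷ 2) refl
    , books G )
  -- Two triangles at `i` either share only `i` or form a diamond, which is met at both ends of its
  -- central edge.
  , by-counting₂ G (#ᵉ m235) (Σᵉ (deg> 2 v0 ⇒ (P 3 v0 v0 ÷ 2) choose 2) ⊟ nat 2 ⊠ #ᵉ m31)
      (Σᵉ (deg> 2 v0 ⇒ P 3 v0 v0 ⊠ (P 3 v0 v0 ⊟ nat 2)) ÷ 8 ⊟ nat 2 ⊠ #ᵉ m31) refl refl
  , trans (Surface.by-counting G (#ᵉ m236) ((Σᵉ (P 5 v0 v0) ⊟ nat 30 ⊠ #ᵉ m7 ⊟ nat 10 ⊠ #ᵉ m15) ÷ 10) refl)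
      (cong (λ t → (t - ℚ[ 30 ] * # M7-3 ⟨ G ⟩ - ℚ[ 10 ] * # M15-4 ⟨ G ⟩) ÷ℕ 10) (sym (ℚ[tr] G 5)))
  , houses G
  , ( Surface.by-counting G (#ᵉ m239) (Σᵉ (deg> 3 v0 ⇒ m13 within adjacent v1 v0)) refl
    , ∑-cong (allFin n) (λ i → cong ([ 3 <ᵇ deg G i ]?_) (paths (nbhd G i))) )
  , spanned-squares G
  -- A copy is met once for each of its vertices adjacent to the other four: two here, one in the
  -- square case below, then three and five. These are the divisors.
  , ( Surface.by-counting G (#ᵉ m255) (Σᵉ (deg> 3 v0 ⇒ m15 within adjacent v1 v0) ÷ 2) refl
    , trans (cong (_÷ℕ 2) (neighbourhoods M15-4 paw# 2 paws)) (÷-÷ (Σv (λ i → [ 3 <ᵇ deg G i ]? paw# (nbhd G i))) 2 2 4 refl) )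
  , ( Surface.by-counting G (#ᵉ m507) (Σᵉ (deg> 3 v0 ⇒ m30 within adjacent v1 v0)) refl
    , neighbourhoods M30-4 square# 8 squares )
  , ( Surface.by-counting G (#ᵉ m511) (Σᵉ (deg> 3 v0 ⇒ m31 within adjacent v1 v0) ÷ 3) refl
    , trans (cong (_÷ℕ 3) (neighbourhoods M31-4 diamond# 2 diamonds)) (÷-÷ (Σv (λ i → [ 3 <ᵇ deg G i ]? diamond# (nbhd G i))) 2 3 6 refl) )
  , ( Surface.by-counting G (#ᵉ m1023) (Σᵉ (deg> 3 v0 ⇒ m63 within adjacent v1 v0) ÷ 5) refl
    -- `Exp` cannot express the trace of an induced subgraph, so six times its number of triangles
    -- stands in and is exchanged for the trace afterwards.
    , trans (Surface.by-counting G (Σᵉ (deg> 3 v0 ⇒ m63 within adjacent v1 v0) ÷ 5)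
              (Σᵉ (deg> 3 v0 ⇒ Σᵉ (adjacent v1 v0 and deg> 2 v0 ⇒ nat 6 ⊠ m7 within (adjacent v2 v0 and adjacent v1 v0))) ÷ 120) refl)
        (cong (_÷ℕ 120) (∑-cong (allFin n) (λ i → cong ([ 3 <ᵇ deg G i ]?_) (∑-cong (allFin n) (λ j →
          cong ([ adj G i j ∧ (2 <ᵇ deg G j) ]?_) (sym (six-triangles (common G i j)))))))) )
  where
  paw# square# diamond# : ∀ {m} → Graph m → ℚ
  paw# H     = Σv (λ r → [ 2 <ᵇ deg H r ]? (ℚ[ pw H 3 r r ] * (ℚ[ deg H r ] - ℚ[ 2 ])))
  square# H  = ℚ[ tr H 4 ] - ℚ[ 2 ] * ℚ[ edges# H ] - ℚ[ 4 ] * # M3-3 ⟨ H ⟩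
  diamond# H = Σ≠ (λ r s → [ (2 <ᵇ deg H r) ∧ (2 <ᵇ deg H s) ]? binom (ℚ[ pw H 2 r s ] * ℚ[ g H r s ]) 2)
  triangles-÷ : ∀ i → # M7-3 ⟨ nbhd G i ⟩ * (ℚ[ deg G i ] - ℚ[ 3 ]) ≡ (ℚ[ tr (nbhd G i) 3 ] * (ℚ[ deg G i ] - ℚ[ 3 ])) ÷ℕ 6
  triangles-÷ i = trans (cong (_* (ℚ[ deg G i ] - ℚ[ 3 ])) (triangles (nbhd G i)))
    (*-swapʳ ℚ[ tr (nbhd G i) 3 ] (ℤ.+ 1 / 6) (ℚ[ deg G i ] - ℚ[ 3 ]))
  -- `value` is polymorphic in the number of vertices because different neighbourhoods have
  -- different index types.
  neighbourhoods : ∀ F (value : ∀ {m} → Graph m → ℚ) d .{{_ : ℕ.NonZero d}} → (∀ {m} (H : Graph m) → # F ⟨ H ⟩ ≡ value H ÷ℕ d) →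
                   Σv (λ i → [ 3 <ᵇ deg G i ]? # F ⟨ nbhd G i ⟩) ≡ Σv (λ i → [ 3 <ᵇ deg G i ]? value (nbhd G i)) ÷ℕ d
  neighbourhoods F value d eq = Σv-÷ d (λ i →
    trans (cong ([ 3 <ᵇ deg G i ]?_) (eq (nbhd G i))) ([]?-÷ (3 <ᵇ deg G i) (value (nbhd G i)) d))
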